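{- Let $k\ge 4$ and $\nu\ge 0$ be fixed integers. There exist two constants $c'_1,c'_2\ge k\left\lfloor\frac{\nu^2}{4}\right\rfloor$ (depending only on $k$ and $\nu$, not on $n$) such that \[ f(n,k,4,\nu) \ge \binom{n-k\nu-1}{k-1}+c'_1\binom{n-k\nu-1}{k-3} \] holds for all $n$ (with $n\ge k(\nu+1)$), and \[ f(n,k,4,\nu)\le\binom{n-k\nu-1}{k-1}+c'_2\binom{n-k\nu-1}{k-3} \] holds for all sufficiently large $n$. In particular, if $\nu=1$, then \[ f(n,k,4,1)\ge \binom{n-k-1}{k-1}+ex(n-k-1,P_{2}^{k-2})+1 \] holds for all $n$ (with $n\ge 2k$).
   Context: $[n]=\{1,\dots,n\}$, and $\binom{V}{k}$ is the collection of all $k$-element subsets of a set $V$. A $d$-cluster of $k$-sets is a collection of $d$ different $k$-sets $A_1,\dots,A_d$ with $|A_1\cup\dots\cup A_d|\le 2k$ and $A_1\cap\dots\cap A_d=\emptyset$. A family $\mathcal{F}\subset\binom{[n]}{k}$ is $d$-cluster-free if it contains no $d$-cluster. The matching number $\nu(\mathcal{F})$ is the maximum number of pairwise disjoint sets in $\mathcal{F}$. For $n\ge k(\nu+1)$, $f(n,k,d,\nu)$ is the maximum size of a $d$-cluster-free family $\mathcal{F}\subset\binom{[n]}{k}$ with $\nu(\mathcal{F})\ge\nu+1$. An $r$-graph is an $r$-uniform hypergraph without multiple edges. The tight $\ell$-path $P_{\ell}^{r}$ is the $r$-graph with edge set $\{v_iv_{i+1}\dots v_{i+r-1}:1\le i\le\ell\}$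 (with $v_1,\dots,v_{\ell+r-1}$ distinct); so $P_2^{r}$ consists of two $r$-sets sharing exactly $r-1$ vertices. $ex(n,P_{\ell}^{r})$ is the maximum number of edges in an $n$-vertex $r$-graph containing no copy of $P_{\ell}^{r}$ as a subgraph. -}

module Defs where

open import Data.Bool using (true; false)
import Data.Bool.Properties as Bool
open import Data.Fin as Fin using (Fin; combine)
open import Data.Fin.Properties using (any?; combine-injective; injective⇒≤; 2↔Bool)
open import Data.Fin.Subset using (Subset; Empty; ⁅_⁆; _∩_; ⋃; ⋂; ∣_∣)
open import Data.Fin.Subset.Properties using (nonempty?; anySubset?)
open import Data.List using (List; []; _∷_; length; map; lookup; take; drop; upTo)
open import Data.List.Membership.Propositional.Properties using (∈-lookup)
open import Data.List.Relation.Binary.Subset.Propositional using (_⊆_)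
import Data.List.Relation.Binary.Subset.DecPropositional as DecSubset
open import Data.List.Relation.Unary.All as All using (All; all?)
open import Data.List.Relation.Unary.AllPairs using (AllPairs; allPairs?; _∷_)
open import Data.List.Relation.Unary.Unique.Propositional using (Unique)
open import Data.Nat using (ℕ; zero; suc; _+_; _*_; _∸_; _^_; _≤_; z≤n; s≤s⁻¹; _≤?_; _≟_)
open import Data.Nat.Properties using (m≤n⇒m<n∨m≡n; suc-injective)
open import Data.Product using (∃; _×_; _,_)
open import Data.Sum using (inj₁; inj₂)
open import Data.Vec using ([]; _∷_)
open import Data.Vec.Properties using (≡-dec)
open import Function using (_∘_; Inverse; Injective)
open import Relation.Binary.Definitions using (DecidableEquality)
open import Relation.Binary.PropositionalEquality using (_≡_; refl; sym; cong; cong₂)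
open import Relation.Nullary using (Dec; yes; no; ¬_; ¬?; _×-dec_; contradiction)
open import Relation.Nullary.Decidable using (map′)
open import Relation.Unary using (Pred; Decidable)

private
  variable
    n : ℕ
    A : Set

-- A family of subsets of [n], or the edge set of a hypergraph on n vertices, is
-- a list of subsets.  Such lists are compared up to membership, and `Unique` is
-- imposed wherever a length is read as a cardinality.
Family : ℕ → Set
Family n = List (Subset n)

Uniform : ℕ → Family n → Set
Uniform k = All (λ S → ∣ S ∣ ≡ k)

Disjoint : Subset n → Subset n → Set
Disjoint S T = Empty (S ∩ T)

-- Subset n is Vec Bool n.
_≟ₛ_ : DecidableEquality (Subset n)
_≟ₛ_ = ≡-dec Bool._≟_

_⊆?_ : (𝒜 ℱ : Family n) → Dec (𝒜 ⊆ ℱ)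
_⊆?_ = DecSubset._⊆?_ _≟ₛ_

unique? : DecidableEquality A → Decidable (Unique {A = A})
unique? _≡?_ = allPairs? (λ x y → ¬? (x ≡? y))

uniform? : ∀ k → Decidable (Uniform {n} k)
uniform? k = all? (λ S → ∣ S ∣ ≟ k)

anyList? : (∀ {P : Pred A _} → Decidable P → Dec (∃ P)) →
           {Q : List A → Set} → Decidable Q →
           ∀ m → Dec (∃ λ xs → length xs ≡ m × Q xs)
anyList? any {Q} Q? zero    = map′ (λ q → [] , refl , q) (λ { ([] , _ , q) → q }) (Q? [])
anyList? any {Q} Q? (suc m) = map′
  (λ { (x , xs , eq , q) → x ∷ xs , cong suc eq , q })
  (λ { (x ∷ xs , eq , q) → x , xs , suc-injective eq , q })
  (any (λ x → anyList? any (λ xs → Q? (x ∷ xs)) m))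

-- The greatest m ≤ b satisfying P, or 0 if there is none.
greatest : {P : ℕ → Set} → Decidable P → ℕ → ℕ
greatest P? zero = zero
greatest P? (suc b) with P? (suc b)
... | yes _ = suc b
... | no  _ = greatest P? b

HasSize : (Family n → Set) → ℕ → Set
HasSize P m = ∃ λ ℱ → length ℱ ≡ m × Unique ℱ × P ℱ

hasSize? : {P : Family n → Set} → Decidable P → Decidable (HasSize P)
hasSize? P? = anyList? anySubset? (λ ℱ → unique? _≟ₛ_ ℱ ×-dec P? ℱ)

-- The maximum number of members of a family satisfying P (0 if there is none);
-- the bound 2 ^ n is no restriction, see `maxSize-upper` and `maxSize-attained`.
maxSize : (P : Family n → Set) → Decidable P → ℕ
maxSize {n} P P? = greatest (hasSize? P?) (2 ^ n)

IsMatchingIn : Family n → Family n → Set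
IsMatchingIn ℱ ℳ = ℳ ⊆ ℱ × AllPairs Disjoint ℳ

isMatchingIn? : (ℱ : Family n) → Decidable (IsMatchingIn ℱ)
isMatchingIn? ℱ ℳ = (ℳ ⊆? ℱ) ×-dec allPairs? (λ S T → ¬? (nonempty? (S ∩ T))) ℳ

matchingNumber : Family n → ℕ
matchingNumber ℱ = maxSize (IsMatchingIn ℱ) (isMatchingIn? ℱ)

IsCluster : (d k : ℕ) → Family n → Set
IsCluster d k 𝒜 =
  length 𝒜 ≡ d × Unique 𝒜 × Uniform k 𝒜 × ∣ ⋃ 𝒜 ∣ ≤ 2 * k × Empty (⋂ 𝒜)

ClusterFree : (d k : ℕ) → Family n → Set
ClusterFree d k ℱ = ¬ (∃ λ 𝒜 → IsCluster d k 𝒜 × 𝒜 ⊆ ℱ)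

clusterFree? : ∀ d k → Decidable (ClusterFree {n} d k)
clusterFree? d k ℱ = ¬? (map′
  (λ { (𝒜 , l , (u , k , c , e) , s) → 𝒜 , (l , u , k , c , e) , λ {S} → s {S} })
  (λ { (𝒜 , (l , u , k , c , e) , s) → 𝒜 , l , (u , k , c , e) , λ {S} → s {S} })
  (anyList? anySubset? (λ 𝒜 →
    (unique? _≟ₛ_ 𝒜 ×-dec uniform? k 𝒜 ×-dec (∣ ⋃ 𝒜 ∣ ≤? 2 * k) ×-dec ¬? (nonempty? (⋂ 𝒜)))
    ×-dec (𝒜 ⊆? ℱ)) d))

Admissible : (k d ν : ℕ) → Family n → Set
Admissible k d ν ℱ = Uniform k ℱ × ClusterFree d k ℱ × ν + 1 ≤ matchingNumber ℱ

admissible? : ∀ k d ν → Decidable (Admissible {n} k d ν)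
admissible? k d ν ℱ = uniform? k ℱ ×-dec clusterFree? d k ℱ ×-dec (ν + 1 ≤? matchingNumber ℱ)

f : (n k d ν : ℕ) → ℕ
f n k d ν = maxSize {n} (Admissible k d ν) (admissible? k d ν)

-- For vs = v₁, …, v_{ℓ+r-1} the edges are {vᵢ₊₁, …, vᵢ₊ᵣ} with 0 ≤ i < ℓ.
tightPath : (ℓ r : ℕ) → List (Fin n) → Family n
tightPath ℓ r vs = map (λ i → ⋃ (map ⁅_⁆ (take r (drop i vs)))) (upTo ℓ)

ContainsTightPath : (ℓ r : ℕ) → Family n → Set
ContainsTightPath ℓ r ℰ =
  ∃ λ vs → length vs ≡ ℓ + r ∸ 1 × Unique vs × tightPath ℓ r vs ⊆ ℰ

TightPathFree : (ℓ r : ℕ) → Family n → Set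
TightPathFree ℓ r ℰ = Uniform r ℰ × ¬ ContainsTightPath ℓ r ℰ

tightPathFree? : ∀ ℓ r → Decidable (TightPathFree {n} ℓ r)
tightPathFree? ℓ r ℰ = uniform? r ℰ ×-dec ¬? (anyList? any?
  (λ vs → unique? Fin._≟_ vs ×-dec (tightPath ℓ r vs ⊆? ℰ)) (ℓ + r ∸ 1))

exTightPath : (n ℓ r : ℕ) → ℕ
exTightPath n ℓ r = maxSize {n} (TightPathFree ℓ r) (tightPathFree? ℓ r)

module _ {P : ℕ → Set} (P? : Decidable P) where

  greatest-upper : ∀ {m} b → m ≤ b → P m → m ≤ greatest P? b
  greatest-upper zero    m≤b p = m≤b
  greatest-upper (suc b) m≤b p with P? (suc b)
  ... | yes _ = m≤b
  ... | no ¬p with m≤n⇒m<n∨m≡n m≤b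
  ...   | inj₁ m<b  = greatest-upper b (s≤s⁻¹ m<b) p
  ...   | inj₂ refl = contradiction p ¬p

  greatest-attained : ∀ {m} b → m ≤ b → P m → P (greatest P? b)
  greatest-attained zero    z≤n p = p
  greatest-attained (suc b) m≤b p with P? (suc b)
  ... | yes q = q
  ... | no ¬p with m≤n⇒m<n∨m≡n m≤b
  ...   | inj₁ m<b  = greatest-attained b (s≤s⁻¹ m<b) p
  ...   | inj₂ refl = contradiction p ¬p

lookup-injective : {xs : List A} → Unique xs → Injective _≡_ _≡_ (lookup xs)
lookup-injective (_ ∷ _)  {Fin.zero}  {Fin.zero}  _  = refl
lookup-injective (x∉ ∷ _) {Fin.zero}  {Fin.suc j} eq = contradiction eq (All.lookup x∉ (∈-lookup j))
lookup-injective (x∉ ∷ _) {Fin.suc i} {Fin.zero}  eq = contradiction (sym eq) (All.lookup x∉ (∈-lookup i))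
lookup-injective (_ ∷ u)  {Fin.suc i} {Fin.suc j} eq = cong Fin.suc (lookup-injective u eq)

encode : Subset n → Fin (2 ^ n)
encode []      = Fin.zero
encode (b ∷ S) = combine (Inverse.from 2↔Bool b) (encode S)

encode-injective : Injective _≡_ _≡_ (encode {n})
encode-injective {x = []}    {[]}    _  = refl
encode-injective {x = b ∷ S} {c ∷ T} eq
  with p , q ← combine-injective (Inverse.from 2↔Bool b) (encode S) (Inverse.from 2↔Bool c) (encode T) eq
  = cong₂ _∷_ (from-injective b c p) (encode-injective q)
  where
  from-injective : ∀ b c → Inverse.from 2↔Bool b ≡ Inverse.from 2↔Bool c → b ≡ c
  from-injective false false _ = refl
  from-injective true  true  _ = refl

length≤2^n : {ℱ : Family n} → Unique ℱ → length ℱ ≤ 2 ^ n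
length≤2^n {n} {ℱ} u = injective⇒≤ {f = encode ∘ lookup ℱ} (lookup-injective u ∘ encode-injective)

module _ (P : Family n → Set) (P? : Decidable P) {ℱ : Family n} (u : Unique ℱ) (p : P ℱ) where

  maxSize-upper : length ℱ ≤ maxSize P P?
  maxSize-upper = greatest-upper (hasSize? P?) (2 ^ n) (length≤2^n u) (ℱ , refl , u , p)

  maxSize-attained : HasSize P (maxSize P P?)
  maxSize-attained = greatest-attained (hasSize? P?) (2 ^ n) (length≤2^n u) (ℱ , refl , u , p)

{-# OPTIONS --safe #-}

-- Upper bound.  Deleting O(n^(k-2)) members of a 4-cluster-free family leaves a
-- subfamily in which every set D inside a member E either extends to a member
-- avoiding any prescribed 2k points (so that D behaves like the kernel of a large
-- sunflower) or is blocked by a small set meeting E in exactly one point.  Call y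
-- in E light if E - y is blocked.  Unless some light y makes E - y an own subset
-- (contained in no other member), swapping out parts of E produces a cluster.
-- Members with two light points use up more than one (k-1)-set each, so all but
-- O(n^(k-2)) of the (k-1)-sets D are own subsets of a member D ∪ y with a single
-- light point y.  Two such D sharing k-2 points get the same y, again because
-- otherwise there is a cluster, and hence one point x serves almost all D.  Then
-- only O(n) members avoid x.  Let U be the union of ν disjoint members avoiding x.
-- Two sets x a R, x a R′ of the family with a in U and |R ∪ R′| = k - 1 exclude
-- x ∪ R ∪ R′, so the members through x meeting U once are, up to O(n^(k-3)), paid
-- for by missing sets that avoid U.
--
-- Lower bound.  Take the star of an apex outside ν disjoint blocks, the blocks, and
-- the k-sets formed by the apex, two corresponding points of a left and a right
-- block, and k-3 points outside all blocks.  A cluster would consist of a block A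
-- and three sets through the apex; counting points inside and outside the blocks
-- forces two of these to coincide or all three to share a point with A.

module Submission where

open import Data.Bool using (Bool; true; false)
open import Data.Empty using (⊥-elim) renaming (⊥ to False)
open import Data.Fin as Fin using (Fin; zero; suc; combine)
import Data.Fin.Properties as Finₚ
open import Data.Fin.Subset using (Subset; _∈_; _∉_; _⊆_; ⊥; ⊤; ⁅_⁆; _∩_; _∪_; _─_; _-_; ∁; ⋃; ∣_∣; Empty; Nonempty)
open import Data.Fin.Subset.Properties as Subset using (_∈?_; _⊆?_; nonempty?; anySubset?)
  renaming (x∈p∧x≢y⇒x∈p-y to x∈p-y⁺; x∈p∧x∉q⇒x∈p─q to x∈p─q⁺; x∈p∩q⁺ to ∈-∩⁺; x∈p∩q⁻ to ∈-∩⁻)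
open import Data.List using (List; []; _∷_; _++_; length; map; concatMap; filter; take; drop; upTo; allFin; cartesianProduct; cartesianProductWith)
import Data.List.Properties as List
open import Data.Nat.ListAction using (sum)
open import Data.List.Membership.Propositional using (find; lose) renaming (_∈_ to _∈ˡ_; _∉_ to _∉ˡ_)
open import Data.List.Membership.Propositional.Properties as Mem using ()
import Data.List.Membership.DecPropositional as DecMem
open import Data.List.Relation.Binary.Subset.Propositional using () renaming (_⊆_ to _⊆ˡ_)
open import Data.List.Relation.Unary.All as All using (All; []; _∷_)
import Data.List.Relation.Unary.All.Properties as All
open import Data.List.Relation.Unary.AllPairs as AllPairs using (AllPairs; []; _∷_)
import Data.List.Relation.Unary.AllPairs.Properties as AllPairs
open import Data.List.Relation.Unary.Any as Any using (Any; here; there)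
open import Data.List.Relation.Unary.Unique.Propositional using (Unique)
import Data.List.Relation.Unary.Unique.Propositional.Properties as Unique
open import Data.Nat using (ℕ; zero; suc; _+_; _*_; _∸_; _^_; _⊓_; _/_; _≤_; _<_; z≤n; s≤s; s≤s⁻¹; >-nonZero; _≤?_; _≟_)
open import Data.Nat.Combinatorics using (_C_; nCk+nC[k+1]≡[n+1]C[k+1])
open import Data.Nat.DivMod using (m<n*o⇒m/o<n)
open import Data.Nat.Properties
open import Data.Nat.Tactic.RingSolver using (solve-∀)
open import Data.Product using (∃; ∃₂; _×_; _,_; proj₁; proj₂)
open import Data.Sum as Sum using (_⊎_; inj₁; inj₂; [_,_]′)
open import Data.Vec as Vec using ([]; _∷_; here; there)
import Data.Vec.Properties as Vec
open import Function using (_∘_; id; case_of_)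
open import Relation.Binary.PropositionalEquality using (_≡_; _≢_; refl; sym; trans; cong; cong₂; subst)
open import Relation.Nullary using (Dec; yes; no; ¬_; ¬?; _×-dec_; _⊎-dec_; _→-dec_; contradiction)
open import Relation.Nullary.Decidable using (decidable-stable)
open import Relation.Unary using (Decidable)
import Defs
open import Defs using (Family; Uniform; Disjoint; _≟ₛ_; greatest; maxSize-upper; HasSize; hasSize?; IsMatchingIn; isMatchingIn?; matchingNumber; ClusterFree; Admissible; admissible?; f; TightPathFree; tightPathFree?; ContainsTightPath; exTightPath)

-- Cleaning costs O(n^(k-2)) members, too coarse for the claimed error n^(k-3). It therefore only
-- serves to find x; everything after that counts members of the original family. A family below the
-- main term satisfies the upper bound at once, so a deficiency of order n^(k-2) against C(n,k-1)
-- may be assumed throughout the search for x. Almost-all statements are about tuples with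
-- repetition: their number is exactly a power of n, and fixing a coordinate leaves tuples of the
-- same kind. Proportions are multiplied by n to stay in the natural numbers. In the lower bound the
-- pairs of blocks in use form a graph on the ν blocks. It must be triangle-free: for a triangle b,
-- p, q, the block b and the cones over the three corresponding pairs with one common outer set have
-- 2k points in their union and empty intersection. The balanced complete bipartite graph attains
-- the largest number of edges, floor(ν²/4), and each edge counts k times, once for every pair of
-- corresponding points.

private
  variable
    n : ℕ
    A B : Set

-- Counting in lists

∈-remove : ∀ {x : A} {ys} → x ∈ˡ ys →
           ∃ λ zs → length ys ≡ suc (length zs) × (∀ {y} → y ∈ˡ ys → y ≢ x → y ∈ˡ zs)
∈-remove {ys = y ∷ ys} (here refl) = ys , refl , λ { (here eq) ne → contradiction eq ne ; (there p) _ → p }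
∈-remove {ys = y ∷ ys} (there p) with zs , eq , h ← ∈-remove p =
  y ∷ zs , cong suc eq , λ { (here eq) _ → here eq ; (there q) ne → there (h q ne) }

-- The injection is a relation, so the partner of an element may come out of an existence proof and
-- need not be a function of the element.
matching-length≤ : {R : A → B → Set} → ∀ {xs ys} → Unique xs →
                   (∀ {x} → x ∈ˡ xs → ∃ λ y → y ∈ˡ ys × R x y) →
                   (∀ {x x′ y} → x ∈ˡ xs → x′ ∈ˡ xs → R x y → R x′ y → x ≡ x′) →
                   length xs ≤ length ys
matching-length≤ {xs = []} _ _ _ = z≤n
matching-length≤ {R = R} {xs = x ∷ xs} {ys} (x∉ ∷ u) ex inj
  with y , y∈ , r ← ex (here refl)
  with zs , eq , h ← ∈-remove y∈ =
  subst (suc (length xs) ≤_) (sym eq) (s≤s (matching-length≤ {R = R} u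
    (λ {x′} x′∈ → let y′ , y′∈ , r′ = ex (there x′∈) in
      y′ , h y′∈ (λ { refl → All.lookup x∉ x′∈ (inj (here refl) (there x′∈) r r′) }) , r′)
    (λ p q → inj (there p) (there q))))

unique-⊆⇒length≤ : {xs ys : List A} → Unique xs → xs ⊆ˡ ys → length xs ≤ length ys
unique-⊆⇒length≤ u s = matching-length≤ {R = _≡_} u (λ {x} p → x , s p , refl) (λ { _ _ refl refl → refl })

map-unique : {g : A → B} → ∀ {xs} → (∀ {x y} → x ∈ˡ xs → y ∈ˡ xs → g x ≡ g y → x ≡ y) →
             Unique xs → Unique (map g xs)
map-unique inj [] = []
map-unique {g = g} {x ∷ xs} inj (x∉ ∷ u) =
  All.map⁺ (All.tabulate (λ y∈ eq → All.lookup x∉ y∈ (inj (here refl) (there y∈) eq)))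
  ∷ map-unique (λ p q → inj (there p) (there q)) u

count : {P : A → Set} → Decidable P → List A → ℕ
count P? xs = length (filter P? xs)

module _ {P : A → Set} (P? : Decidable P) where

  count-yes : ∀ {x xs} → P x → count P? (x ∷ xs) ≡ suc (count P? xs)
  count-yes p = cong length (List.filter-accept P? p)

  count+count¬ : ∀ xs → length xs ≡ count P? xs + count (¬? ∘ P?) xs
  count+count¬ [] = refl
  count+count¬ (x ∷ xs) with P? x
  ... | yes p = cong suc (count+count¬ xs)
  ... | no ¬p = trans (cong suc (count+count¬ xs)) (sym (+-suc _ _))

  count-++ : ∀ xs ys → count P? (xs ++ ys) ≡ count P? xs + count P? ys
  count-++ xs ys = trans (cong length (List.filter-++ P? xs ys)) (List.length-++ (filter P? xs))

  count-map : (g : B → A) → ∀ xs → count P? (map g xs) ≡ count (P? ∘ g) xs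
  count-map g [] = refl
  count-map g (x ∷ xs) with P? (g x)
  ... | yes p = cong suc (count-map g xs)
  ... | no ¬p = count-map g xs

  ⇒count≡0 : ∀ {xs} → (∀ {x} → x ∈ˡ xs → ¬ P x) → count P? xs ≡ 0
  ⇒count≡0 h = cong length (List.filter-none P? (All.tabulate h))

  count<⇒∃¬ : ∀ {xs} → count P? xs < length xs → ∃ λ x → x ∈ˡ xs × ¬ P x
  count<⇒∃¬ {xs} lt with Any.any? (¬? ∘ P?) xs
  ... | yes a = find a
  ... | no ¬a = contradiction lt (<-irrefl (cong length (List.filter-all P?
                  (All.map (λ {x} ¬¬p → decidable-stable (P? x) ¬¬p) (All.¬Any⇒All¬ xs ¬a)))))

  count-∷ : ∀ {x xs} → count P? xs ≤ count P? (x ∷ xs)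
  count-∷ {x} with P? x
  ... | yes _ = n≤1+n _
  ... | no  _ = ≤-refl

  ∈⇒0<count : ∀ {x xs} → x ∈ˡ xs → P x → 0 < count P? xs
  ∈⇒0<count x∈ p = Mem.∈-length (Mem.∈-filter⁺ P? x∈ p)

count-cover : {P Q R : A → Set} (P? : Decidable P) (Q? : Decidable Q) (R? : Decidable R) →
              ∀ xs → (∀ {x} → x ∈ˡ xs → P x → Q x ⊎ R x) → count P? xs ≤ count Q? xs + count R? xs
count-cover P? Q? R? [] h = z≤n
count-cover P? Q? R? (x ∷ xs) h with ih ← count-cover P? Q? R? xs (h ∘ there) | P? x
... | no  _ = ≤-trans ih (+-mono-≤ (count-∷ Q?) (count-∷ R?))
... | yes p with h (here refl) p
...   | inj₁ q rewrite count-yes Q? {xs = xs} q = s≤s (≤-trans ih (+-monoʳ-≤ _ (count-∷ R?)))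
...   | inj₂ r rewrite count-yes R? {xs = xs} r | +-suc (count Q? (x ∷ xs)) (count R? xs) =
  s≤s (≤-trans ih (+-monoˡ-≤ _ (count-∷ Q?)))

count-mono : {P Q : A → Set} (P? : Decidable P) (Q? : Decidable Q) →
             ∀ xs → (∀ {x} → x ∈ˡ xs → P x → Q x) → count P? xs ≤ count Q? xs
count-mono P? Q? [] h = z≤n
count-mono P? Q? (x ∷ xs) h with ih ← count-mono P? Q? xs (h ∘ there) | P? x | Q? x
... | yes p | yes q = s≤s ih
... | yes p | no ¬q = contradiction (h (here refl) p) ¬q
... | no _  | yes _ = m≤n⇒m≤1+n ih
... | no _  | no _  = ih

+-swap : ∀ a b c → a + (b + c) ≡ b + (a + c)
+-swap = solve-∀

∑ : List A → (A → ℕ) → ℕ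
∑ xs g = sum (map g xs)

∑-mono : ∀ {g h : A → ℕ} xs → (∀ {x} → x ∈ˡ xs → g x ≤ h x) → ∑ xs g ≤ ∑ xs h
∑-mono [] le = z≤n
∑-mono (x ∷ xs) le = +-mono-≤ (le (here refl)) (∑-mono xs (le ∘ there))

∑-+ : ∀ (g h : A → ℕ) xs → ∑ xs (λ x → g x + h x) ≡ ∑ xs g + ∑ xs h
∑-+ g h [] = refl
∑-+ g h (x ∷ xs) rewrite ∑-+ g h xs = shuffle (g x) (h x) (∑ xs g) (∑ xs h)
  where
  shuffle : ∀ a b c d → a + b + (c + d) ≡ a + c + (b + d)
  shuffle = solve-∀

∑-const : ∀ c (xs : List A) → ∑ xs (λ _ → c) ≡ length xs * c
∑-const c [] = refl
∑-const c (x ∷ xs) = cong (c +_) (∑-const c xs)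

∑-cong : ∀ {g h : A → ℕ} xs → (∀ x → g x ≡ h x) → ∑ xs g ≡ ∑ xs h
∑-cong xs eq = cong sum (List.map-cong eq xs)

∑-*ˡ : ∀ c (g : A → ℕ) xs → ∑ xs (λ x → c * g x) ≡ c * ∑ xs g
∑-*ˡ c g [] = sym (*-zeroʳ c)
∑-*ˡ c g (x ∷ xs) = trans (cong (c * g x +_) (∑-*ˡ c g xs)) (sym (*-distribˡ-+ c (g x) _))

∑-bound : ∀ {c} {g : A → ℕ} xs → (∀ {x} → x ∈ˡ xs → g x ≤ c) → ∑ xs g ≤ length xs * c
∑-bound {c = c} xs le = ≤-trans (∑-mono xs le) (≤-reflexive (∑-const c xs))

∑-filter : ∀ {P : A → Set} (P? : Decidable P) (g : A → ℕ) xs → ∑ (filter P? xs) g ≤ ∑ xs g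
∑-filter P? g [] = z≤n
∑-filter P? g (x ∷ xs) with P? x
... | yes _ = +-monoʳ-≤ (g x) (∑-filter P? g xs)
... | no  _ = ≤-trans (∑-filter P? g xs) (m≤n+m _ (g x))

length-concatMap : ∀ (g : A → List B) xs → length (concatMap g xs) ≡ ∑ xs (length ∘ g)
length-concatMap g [] = refl
length-concatMap g (x ∷ xs) = trans (List.length-++ (g x)) (cong (length (g x) +_) (length-concatMap g xs))

length-concatMap-≤ : ∀ {c} (g : A → List B) xs → (∀ {x} → x ∈ˡ xs → length (g x) ≤ c) →
                     length (concatMap g xs) ≤ length xs * c
length-concatMap-≤ g xs le = ≤-trans (≤-reflexive (length-concatMap g xs)) (∑-bound xs le)

∈-concatMap : ∀ (g : A → List B) {x y xs} → x ∈ˡ xs → y ∈ˡ g x → y ∈ˡ concatMap g xs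
∈-concatMap g {y = y} x∈ y∈ = Mem.∈-concatMap⁺ g (Any.map (λ { refl → y∈ }) x∈)

module _ {R : A → B → Set} (R? : ∀ x y → Dec (R x y)) where

  ∑-count-swap : ∀ xs ys → ∑ xs (λ x → count (R? x) ys) ≡ ∑ ys (λ y → count (λ x → R? x y) xs)
  ∑-count-swap [] ys = sym (trans (∑-const 0 ys) (*-zeroʳ (length ys)))
  ∑-count-swap (x ∷ xs) ys =
    trans (cong (count (R? x) ys +_) (∑-count-swap xs ys)) (sym (step ys))
    where
    step : ∀ ys → ∑ ys (λ y → count (λ x → R? x y) (x ∷ xs)) ≡
                  count (R? x) ys + ∑ ys (λ y → count (λ x → R? x y) xs)
    step [] = refl
    step (y ∷ ys) with R? x y
    ... | yes _ = cong suc (trans (cong (b +_) (step ys)) (+-swap b (count (R? x) ys) _))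
      where b = count (λ x → R? x y) xs
    ... | no  _ = trans (cong (b +_) (step ys)) (+-swap b (count (R? x) ys) _)
      where b = count (λ x → R? x y) xs

  doubleCount : ∀ {p q xs ys} → (∀ {x} → x ∈ˡ xs → p ≤ count (R? x) ys) →
                (∀ {y} → y ∈ˡ ys → count (λ x → R? x y) xs ≤ q) → length xs * p ≤ length ys * q
  doubleCount {p} {q} {xs} {ys} lo hi = begin
    length xs * p                        ≡⟨ ∑-const p xs ⟨
    ∑ xs (λ _ → p)                       ≤⟨ ∑-mono xs lo ⟩
    ∑ xs (λ x → count (R? x) ys)         ≡⟨ ∑-count-swap xs ys ⟩
    ∑ ys (λ y → count (λ x → R? x y) xs) ≤⟨ ∑-bound ys hi ⟩
    length ys * q                        ∎
    where open ≤-Reasoning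

-- Tuples

tuples : List A → ℕ → List (List A)
tuples xs zero    = [] ∷ []
tuples xs (suc j) = cartesianProductWith _∷_ xs (tuples xs j)

∈-tuples : ∀ {xs : List A} {p} → p ⊆ˡ xs → p ∈ˡ tuples xs (length p)
∈-tuples {p = []} s = here refl
∈-tuples {p = x ∷ p} s = Mem.∈-cartesianProductWith⁺ _∷_ (s (here refl)) (∈-tuples (s ∘ there))

∈-tuples⇒length : ∀ (xs : List A) j {p} → p ∈ˡ tuples xs j → length p ≡ j
∈-tuples⇒length xs zero (here refl) = refl
∈-tuples⇒length xs (suc j) p∈ with _ , _ , _ , q∈ , refl ← Mem.∈-cartesianProductWith⁻ _∷_ xs (tuples xs j) p∈ =
  cong suc (∈-tuples⇒length xs j q∈)

length-cartesianProductWith : ∀ {T : Set} (g : A → B → T) xs ys →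
                              length (cartesianProductWith g xs ys) ≡ length xs * length ys
length-cartesianProductWith g [] ys = refl
length-cartesianProductWith g (x ∷ xs) ys =
  trans (List.length-++ (map (g x) ys)) (cong₂ _+_ (List.length-map (g x) ys) (length-cartesianProductWith g xs ys))

length-tuples : ∀ (xs : List A) j → length (tuples xs j) ≡ length xs ^ j
length-tuples xs zero = refl
length-tuples xs (suc j) =
  trans (length-cartesianProductWith _∷_ xs (tuples xs j)) (cong (length xs *_) (length-tuples xs j))

tuples-unique : ∀ {xs : List A} → Unique xs → ∀ j → Unique (tuples xs j)
tuples-unique u zero = [] ∷ []
tuples-unique u (suc j) = Unique.cartesianProductWith⁺ _∷_ List.∷-injective u (tuples-unique u j)

count-cartesianProductWith : ∀ {T : Set} {P : T → Set} (P? : Decidable P) (g : A → B → T) xs ys →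
  count P? (cartesianProductWith g xs ys) ≡ ∑ xs (λ x → count (P? ∘ g x) ys)
count-cartesianProductWith P? g [] ys = refl
count-cartesianProductWith P? g (x ∷ xs) ys =
  trans (count-++ P? (map (g x) ys) _)
    (cong₂ _+_ (count-map P? (g x) ys) (count-cartesianProductWith P? g xs ys))

-- Cardinalities of subsets

elems : Subset n → List (Fin n)
elems []          = []
elems (true ∷ S)  = zero ∷ map suc (elems S)
elems (false ∷ S) = map suc (elems S)

∈-elems⁺ : ∀ {S : Subset n} {x} → x ∈ S → x ∈ˡ elems S
∈-elems⁺ {S = true ∷ S}  here      = here refl
∈-elems⁺ {S = true ∷ S}  (there p) = there (Mem.∈-map⁺ suc (∈-elems⁺ p))
∈-elems⁺ {S = false ∷ S} (there p) = Mem.∈-map⁺ suc (∈-elems⁺ p)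

∈-elems⁻ : ∀ {S : Subset n} {x} → x ∈ˡ elems S → x ∈ S
∈-elems⁻ {S = true ∷ S} (here refl) = here
∈-elems⁻ {S = true ∷ S} (there p) with _ , q , refl ← Mem.∈-map⁻ suc p = there (∈-elems⁻ q)
∈-elems⁻ {S = false ∷ S} p with _ , q , refl ← Mem.∈-map⁻ suc p = there (∈-elems⁻ q)

elems-unique : (S : Subset n) → Unique (elems S)
elems-unique []          = []
elems-unique (true ∷ S)  =
  All.tabulate (λ p → case Mem.∈-map⁻ suc p of λ { (_ , _ , refl) () })
  ∷ Unique.map⁺ Finₚ.suc-injective (elems-unique S)
elems-unique (false ∷ S) = Unique.map⁺ Finₚ.suc-injective (elems-unique S)

length-elems : (S : Subset n) → length (elems S) ≡ ∣ S ∣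
length-elems []          = refl
length-elems (true ∷ S)  = cong suc (trans (List.length-map suc (elems S)) (length-elems S))
length-elems (false ∷ S) = trans (List.length-map suc (elems S)) (length-elems S)

fromList : List (Fin n) → Subset n
fromList xs = ⋃ (map ⁅_⁆ xs)

∈-fromList⁺ : ∀ (xs : List (Fin n)) {x} → x ∈ˡ xs → x ∈ fromList xs
∈-fromList⁺ (x ∷ xs) (here refl) = Subset.x∈p∪q⁺ (inj₁ (Subset.x∈⁅x⁆ x))
∈-fromList⁺ (y ∷ xs) (there p) = Subset.x∈p∪q⁺ (inj₂ (∈-fromList⁺ xs p))

∈-fromList⁻ : ∀ (xs : List (Fin n)) {x} → x ∈ fromList xs → x ∈ˡ xs
∈-fromList⁻ [] p = contradiction p Subset.∉⊥
∈-fromList⁻ (y ∷ xs) p with Subset.x∈p∪q⁻ ⁅ y ⁆ _ p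
... | inj₁ q = here (Subset.x∈⁅y⁆⇒x≡y y q)
... | inj₂ q = there (∈-fromList⁻ xs q)

∣∣≤length : ∀ (S : Subset n) xs → (∀ {x} → x ∈ S → x ∈ˡ xs) → ∣ S ∣ ≤ length xs
∣∣≤length S xs h = subst (_≤ length xs) (length-elems S)
  (unique-⊆⇒length≤ (elems-unique S) (h ∘ ∈-elems⁻))

length≤∣∣ : ∀ (S : Subset n) {xs} → Unique xs → (∀ {x} → x ∈ˡ xs → x ∈ S) → length xs ≤ ∣ S ∣
length≤∣∣ S {xs} u h = subst (length xs ≤_) (length-elems S)
  (unique-⊆⇒length≤ u (∈-elems⁺ ∘ h))

∣fromList∣ : ∀ {xs : List (Fin n)} → Unique xs → ∣ fromList xs ∣ ≡ length xs
∣fromList∣ {xs = xs} u = ≤-antisym (∣∣≤length (fromList xs) xs (∈-fromList⁻ xs))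
  (length≤∣∣ (fromList xs) u (∈-fromList⁺ xs))

fromList-elems : (S : Subset n) → fromList (elems S) ≡ S
fromList-elems S = Subset.⊆-antisym (∈-elems⁻ ∘ ∈-fromList⁻ (elems S)) (∈-fromList⁺ (elems S) ∘ ∈-elems⁺)

∣∪∣+∣∩∣ : (p q : Subset n) → ∣ p ∪ q ∣ + ∣ p ∩ q ∣ ≡ ∣ p ∣ + ∣ q ∣
∣∪∣+∣∩∣ [] [] = refl
∣∪∣+∣∩∣ (true ∷ p) (true ∷ q) =
  cong suc (trans (+-suc ∣ p ∪ q ∣ ∣ p ∩ q ∣) (trans (cong suc (∣∪∣+∣∩∣ p q)) (sym (+-suc ∣ p ∣ ∣ q ∣))))
∣∪∣+∣∩∣ (true ∷ p) (false ∷ q) = cong suc (∣∪∣+∣∩∣ p q)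
∣∪∣+∣∩∣ (false ∷ p) (true ∷ q) = trans (cong suc (∣∪∣+∣∩∣ p q)) (sym (+-suc ∣ p ∣ ∣ q ∣))
∣∪∣+∣∩∣ (false ∷ p) (false ∷ q) = ∣∪∣+∣∩∣ p q

∣∪∣≤ : (p q : Subset n) → ∣ p ∪ q ∣ ≤ ∣ p ∣ + ∣ q ∣
∣∪∣≤ p q = ≤-trans (m≤m+n _ _) (≤-reflexive (∣∪∣+∣∩∣ p q))

Empty⇒∣∣≡0 : {p : Subset n} → Empty p → ∣ p ∣ ≡ 0
Empty⇒∣∣≡0 {n} e rewrite Subset.Empty-unique e = Subset.∣⊥∣≡0 n

∣∪∣-disjoint : (p q : Subset n) → Disjoint p q → ∣ p ∪ q ∣ ≡ ∣ p ∣ + ∣ q ∣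
∣∪∣-disjoint p q d = trans (sym (trans (cong (∣ p ∪ q ∣ +_) (Empty⇒∣∣≡0 d)) (+-identityʳ _))) (∣∪∣+∣∩∣ p q)

∣∩∣+∣─∣ : (p q : Subset n) → ∣ p ∩ q ∣ + ∣ p ─ q ∣ ≡ ∣ p ∣
∣∩∣+∣─∣ [] [] = refl
∣∩∣+∣─∣ (true ∷ p) (true ∷ q) = cong suc (∣∩∣+∣─∣ p q)
∣∩∣+∣─∣ (true ∷ p) (false ∷ q) = trans (+-suc ∣ p ∩ q ∣ _) (cong suc (∣∩∣+∣─∣ p q))
∣∩∣+∣─∣ (false ∷ p) (true ∷ q) = ∣∩∣+∣─∣ p q
∣∩∣+∣─∣ (false ∷ p) (false ∷ q) = ∣∩∣+∣─∣ p q

⊆⇒∩≡ : {p q : Subset n} → q ⊆ p → p ∩ q ≡ q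
⊆⇒∩≡ {p = p} {q} s = Subset.⊆-antisym (Subset.p∩q⊆q p q) (λ x∈ → ∈-∩⁺ (s x∈ , x∈))

∣∣+∣─∣ : {p q : Subset n} → q ⊆ p → ∣ q ∣ + ∣ p ─ q ∣ ≡ ∣ p ∣
∣∣+∣─∣ {p = p} {q} s = trans (cong (λ r → ∣ r ∣ + ∣ p ─ q ∣) (sym (⊆⇒∩≡ s))) (∣∩∣+∣─∣ p q)

x∈p─q⇒x∉q : ∀ (p q : Subset n) {x} → x ∈ p ─ q → x ∉ q
x∈p─q⇒x∉q (_ ∷ p) (true ∷ q)  (there h) (there k) = x∈p─q⇒x∉q p q h k
x∈p─q⇒x∉q (_ ∷ p) (false ∷ q) (there h) (there k) = x∈p─q⇒x∉q p q h k

x∈p-y⁻ : ∀ (p : Subset n) y {x} → x ∈ p - y → x ∈ p × x ≢ y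
x∈p-y⁻ p y h = Subset.p─q⊆p p ⁅ y ⁆ h , λ { refl → x∈p─q⇒x∉q p ⁅ y ⁆ h (Subset.x∈⁅x⁆ y) }

-⊆ : ∀ (p : Subset n) y → p - y ⊆ p
-⊆ p y = proj₁ ∘ x∈p-y⁻ p y

∣p-x∣ : ∀ {p : Subset n} {x} → x ∈ p → suc ∣ p - x ∣ ≡ ∣ p ∣
∣p-x∣ {p = p} {x} x∈ = trans (cong (_+ ∣ p - x ∣) (sym (Subset.∣⁅x⁆∣≡1 x)))
  (∣∣+∣─∣ (λ y∈ → subst (_∈ p) (sym (Subset.x∈⁅y⁆⇒x≡y x y∈)) x∈))

⊆∧∣≤∣⇒≡ : {p q : Subset n} → p ⊆ q → ∣ q ∣ ≤ ∣ p ∣ → p ≡ q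
⊆∧∣≤∣⇒≡ {p = p} {q} s le = Subset.⊆-antisym s λ {x} x∈ → decidable-stable (x ∈? p) λ x∉ →
  contradiction (Subset.p⊂q⇒∣p∣<∣q∣ (s , x , x∈ , x∉)) (≤⇒≯ le)

disjoint⁺ : {p q : Subset n} → (∀ {x} → x ∈ p → x ∉ q) → Disjoint p q
disjoint⁺ {p = p} {q} h (x , m) = let x∈p , x∈q = ∈-∩⁻ p q m in h x∈p x∈q

disjoint⁻ : {p q : Subset n} → Disjoint p q → ∀ {x} → x ∈ p → x ∉ q
disjoint⁻ d x∈p x∈q = d (_ , ∈-∩⁺ (x∈p , x∈q))

0<∣∣⇒Nonempty : (p : Subset n) → 0 < ∣ p ∣ → Nonempty p
0<∣∣⇒Nonempty p lt with nonempty? p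
... | yes ne = ne
... | no ¬ne = contradiction (subst (0 <_) (Empty⇒∣∣≡0 ¬ne) lt) λ ()

twoElements : (p : Subset n) → 2 ≤ ∣ p ∣ → ∃₂ λ x y → x ∈ p × y ∈ p × x ≢ y
twoElements p le with x , x∈ ← 0<∣∣⇒Nonempty p (≤-trans (s≤s z≤n) le)
  with y , y∈ ← 0<∣∣⇒Nonempty (p - x) (s≤s⁻¹ (subst (2 ≤_) (sym (∣p-x∣ x∈)) le)) =
  let y∈p , y≢x = x∈p-y⁻ p x y∈ in x , y , x∈ , y∈p , y≢x ∘ sym

∪-least : {p q r : Subset n} → p ⊆ r → q ⊆ r → p ∪ q ⊆ r
∪-least {p = p} {q} s t x∈ with Subset.x∈p∪q⁻ p q x∈
... | inj₁ h = s h
... | inj₂ h = t h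

∈-∪ˡ : {p q : Subset n} → p ⊆ p ∪ q
∈-∪ˡ = Subset.x∈p∪q⁺ ∘ inj₁

∈-∪ʳ : {p q : Subset n} → q ⊆ p ∪ q
∈-∪ʳ = Subset.x∈p∪q⁺ ∘ inj₂

ksubsets : Subset n → ℕ → List (Subset n)
ksubsets []          zero    = [] ∷ []
ksubsets []          (suc j) = []
ksubsets (false ∷ W) j       = map (false ∷_) (ksubsets W j)
ksubsets (true ∷ W)  zero    = map (false ∷_) (ksubsets W zero)
ksubsets (true ∷ W)  (suc j) = map (true ∷_) (ksubsets W j) ++ map (false ∷_) (ksubsets W (suc j))

length-ksubsets : ∀ (W : Subset n) j → length (ksubsets W j) ≡ ∣ W ∣ C j
length-ksubsets []          zero    = refl
length-ksubsets []          (suc j) = refl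
length-ksubsets (false ∷ W) j       = trans (List.length-map _ (ksubsets W j)) (length-ksubsets W j)
length-ksubsets (true ∷ W)  zero    = trans (List.length-map _ (ksubsets W zero)) (length-ksubsets W zero)
length-ksubsets (true ∷ W)  (suc j) =
  trans (List.length-++ (map (true ∷_) (ksubsets W j)))
    (trans (cong₂ _+_ (trans (List.length-map _ (ksubsets W j)) (length-ksubsets W j))
                      (trans (List.length-map _ (ksubsets W (suc j))) (length-ksubsets W (suc j))))
           (nCk+nC[k+1]≡[n+1]C[k+1] ∣ W ∣ j))

∷-injectiveʳ : ∀ {b} {S T : Subset n} → b Vec.∷ S ≡ b ∷ T → S ≡ T
∷-injectiveʳ refl = refl

ksubsets-unique : ∀ (W : Subset n) j → Unique (ksubsets W j)
ksubsets-unique []          zero    = [] ∷ []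
ksubsets-unique []          (suc j) = []
ksubsets-unique (false ∷ W) j       = Unique.map⁺ ∷-injectiveʳ (ksubsets-unique W j)
ksubsets-unique (true ∷ W)  zero    = Unique.map⁺ ∷-injectiveʳ (ksubsets-unique W zero)
ksubsets-unique (true ∷ W)  (suc j) =
  Unique.++⁺ (Unique.map⁺ ∷-injectiveʳ (ksubsets-unique W j))
             (Unique.map⁺ ∷-injectiveʳ (ksubsets-unique W (suc j)))
             λ (p , q) → case (Mem.∈-map⁻ _ p , Mem.∈-map⁻ _ q) of λ { ((_ , _ , refl) , (_ , _ , ())) }

∈-ksubsets⁺ : ∀ {W S : Subset n} → S ⊆ W → S ∈ˡ ksubsets W ∣ S ∣
∈-ksubsets⁺ {W = []} {[]} s = here refl
∈-ksubsets⁺ {W = false ∷ W} {true ∷ S} s = case s here of λ ()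
∈-ksubsets⁺ {W = false ∷ W} {false ∷ S} s = Mem.∈-map⁺ _ (∈-ksubsets⁺ (Subset.drop-∷-⊆ s))
∈-ksubsets⁺ {W = true ∷ W} {true ∷ S} s = Mem.∈-++⁺ˡ (Mem.∈-map⁺ _ (∈-ksubsets⁺ (Subset.drop-∷-⊆ s)))
∈-ksubsets⁺ {W = true ∷ W} {false ∷ S} s with ∣ S ∣ | ∈-ksubsets⁺ {W = W} {S} (Subset.drop-∷-⊆ s)
... | zero  | h = Mem.∈-map⁺ _ h
... | suc j | h = Mem.∈-++⁺ʳ (map (true ∷_) (ksubsets W j)) (Mem.∈-map⁺ _ h)

∈-ksubsets⁻ : ∀ (W : Subset n) j {S} → S ∈ˡ ksubsets W j → S ⊆ W × ∣ S ∣ ≡ j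
∈-ksubsets⁻ [] zero (here refl) = id , refl
∈-ksubsets⁻ (false ∷ W) j p with _ , q , refl ← Mem.∈-map⁻ _ p =
  let s , eq = ∈-ksubsets⁻ W j q in Subset.out⊆ s , eq
∈-ksubsets⁻ (true ∷ W) zero p with _ , q , refl ← Mem.∈-map⁻ _ p =
  let s , eq = ∈-ksubsets⁻ W zero q in Subset.out⊆ s , eq
∈-ksubsets⁻ (true ∷ W) (suc j) p with Mem.∈-++⁻ (map (true ∷_) (ksubsets W j)) p
... | inj₁ q with _ , r , refl ← Mem.∈-map⁻ _ q =
  let s , eq = ∈-ksubsets⁻ W j r in Subset.in⊆in s , cong suc eq
... | inj₂ q with _ , r , refl ← Mem.∈-map⁻ _ q =
  let s , eq = ∈-ksubsets⁻ W (suc j) r in Subset.out⊆ s , eq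

∈-ksubsets : ∀ {W S : Subset n} {j} → S ⊆ W → ∣ S ∣ ≡ j → S ∈ˡ ksubsets W j
∈-ksubsets s refl = ∈-ksubsets⁺ s

-- Cleaning: after removing O(n^(k-2)) members, every set D inside a remaining
-- member E either can be extended to a remaining member avoiding any prescribed
-- t points, or has a small blocking set X D that meets E in a single point.

∣fromList∣≤ : ∀ (xs : List (Fin n)) → ∣ fromList xs ∣ ≤ length xs
∣fromList∣≤ xs = ∣∣≤length (fromList xs) xs (∈-fromList⁻ xs)

length-allFin-tuples : ∀ j → length (tuples (allFin n) j) ≡ n ^ j
length-allFin-tuples {n} j = trans (length-tuples (allFin n) j) (cong (_^ j) (List.length-tabulate id))

∈-allFin-tuples : ∀ {j} {p : List (Fin n)} → length p ≡ j → p ∈ˡ tuples (allFin n) j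
∈-allFin-tuples refl = ∈-tuples (λ {x} _ → Mem.∈-allFin x)

take-length-++ : ∀ (xs ys : List A) → take (length xs) (xs ++ ys) ≡ xs
take-length-++ []       ys = refl
take-length-++ (x ∷ xs) ys = cong (x ∷_) (take-length-++ xs ys)

module Cleaning (t : ℕ) (F : Family n) where

  -- X D ≡ ⊥ encodes that D has no blocking set.
  Blockers : Set
  Blockers = Subset n → Subset n

  -- Excluding this gives every blocked subset of a survivor a unique blocking point. It is rare:
  -- once `D` is known, there are at most t² choices of `z` and `w`, and the remaining points number
  -- k - 2.
  Bad₁ : Blockers → Subset n → Set
  Bad₁ X E = ∃ λ D → D ⊆ E × ∃₂ λ z w → z ∈ E × w ∈ E × z ≢ w × z ∉ D × w ∉ D × z ∈ X D × w ∈ X D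

  -- Two nested blockings: `z` blocks a (k-2)-set, and `w` blocks that set with `z` put back. The
  -- (k-2)-set leaves at most t choices for `z`, and then at most t for `w`.
  Bad₂ : Blockers → Subset n → Set
  Bad₂ X E = ∃₂ λ z w → z ∈ E × w ∈ E × z ≢ w × z ∈ X ((E - w) - z) × w ∈ X (E - w)

  bad₁? : ∀ X → Decidable (Bad₁ X)
  bad₁? X E = anySubset? λ D → (D ⊆? E) ×-dec Finₚ.any? λ z → Finₚ.any? λ w →
    (z ∈? E) ×-dec (w ∈? E) ×-dec ¬? (z Fin.≟ w) ×-dec ¬? (z ∈? D) ×-dec ¬? (w ∈? D) ×-dec (z ∈? X D) ×-dec (w ∈? X D)

  bad₂? : ∀ X → Decidable (Bad₂ X)
  bad₂? X E = Finₚ.any? λ z → Finₚ.any? λ w →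
    (z ∈? E) ×-dec (w ∈? E) ×-dec ¬? (z Fin.≟ w) ×-dec (z ∈? X ((E - w) - z)) ×-dec (w ∈? X (E - w))

  bad? : ∀ X → Decidable (λ E → Bad₁ X E ⊎ Bad₂ X E)
  bad? X E = bad₁? X E ⊎-dec bad₂? X E

  survivors : Blockers → Family n
  survivors X = filter (¬? ∘ bad? X) F

  record Valid (X : Blockers) : Set where
    field
      small    : ∀ D → ∣ X D ∣ ≤ t
      disjoint : ∀ D → Disjoint D (X D)
      blocks   : ∀ D → Nonempty (X D) → ∀ {E} → E ∈ˡ survivors X → D ⊆ E → Nonempty (E ∩ X D)

  Blocks : Family n → Subset n → Subset n → Set
  Blocks G D B = Nonempty B × ∣ B ∣ ≤ t × Disjoint D B × All (λ E → D ⊆ E → Nonempty (E ∩ B)) G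

  blocks? : ∀ G D → Decidable (Blocks G D)
  blocks? G D B = nonempty? B ×-dec (∣ B ∣ ≤? t) ×-dec ¬? (nonempty? (D ∩ B))
    ×-dec All.all? (λ E → (D ⊆? E) →-dec nonempty? (E ∩ B)) G

  record Cleaned : Set where
    field
      X     : Blockers
      valid : Valid X
      free  : ∀ {D E B} → E ∈ˡ survivors X → D ⊆ E → Empty (X D) → ∣ B ∣ ≤ t → Disjoint D B →
              ∃ λ E′ → E′ ∈ˡ survivors X × D ⊆ E′ × Disjoint E′ B

  -- Larger blockers only create more bad members. Blockers assigned earlier thus remain valid when
  -- a new one is assigned.
  survivors-mono : ∀ {X X′} → (∀ D → X D ⊆ X′ D) → survivors X′ ⊆ˡ survivors X
  survivors-mono {X} {X′} s E∈ =
    let m , ¬b = Mem.∈-filter⁻ (¬? ∘ bad? X′) {xs = F} E∈ in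
    Mem.∈-filter⁺ (¬? ∘ bad? X) m λ
      { (inj₁ (D , D⊆ , z , w , a , b , c , d , e , f , g)) →
          ¬b (inj₁ (D , D⊆ , z , w , a , b , c , d , e , s _ f , s _ g))
      ; (inj₂ (z , w , a , b , c , f , g)) → ¬b (inj₂ (z , w , a , b , c , s _ f , s _ g)) }

  assign : Blockers → Subset n → Subset n → Blockers
  assign X D B D′ with D′ ≟ₛ D
  ... | yes _ = B
  ... | no  _ = X D′

  assign-valid : ∀ {X D B} → Valid X → Empty (X D) → Blocks (survivors X) D B → Valid (assign X D B)
  assign-valid {X} {D} {B} v e (ne , le , dis , bl) = record
    { small    = small′
    ; disjoint = disjoint′
    ; blocks   = blocks′ }
    where
    open Valid v
    mono : survivors (assign X D B) ⊆ˡ survivors X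
    mono = survivors-mono go
      where
      go : ∀ D′ → X D′ ⊆ assign X D B D′
      go D′ x∈ with D′ ≟ₛ D
      ... | yes refl = contradiction (_ , x∈) e
      ... | no  _    = x∈
    small′ : ∀ D′ → ∣ assign X D B D′ ∣ ≤ t
    small′ D′ with D′ ≟ₛ D
    ... | yes _ = le
    ... | no  _ = small D′
    disjoint′ : ∀ D′ → Disjoint D′ (assign X D B D′)
    disjoint′ D′ with D′ ≟ₛ D
    ... | yes refl = dis
    ... | no  _ = disjoint D′
    blocks′ : ∀ D′ → Nonempty (assign X D B D′) → ∀ {E} → E ∈ˡ survivors (assign X D B) → D′ ⊆ E →
              Nonempty (E ∩ assign X D B D′)
    blocks′ D′ h E∈ s with D′ ≟ₛ D
    ... | yes refl = All.lookup bl (mono E∈) s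
    ... | no  _ = blocks D′ h (mono E∈) s

  -- `U` lists the sets that may still lack a blocker. Each round gives one of them a blocker and
  -- removes it from `U`, which bounds the number of rounds; once no set in `U` has a candidate, the
  -- absence of candidates is the property `free`.
  cleanFrom : ∀ fuel (U : List (Subset n)) → length U ≤ fuel → ∀ X → Valid X →
              (∀ D → D ∉ˡ U → Nonempty (X D)) → Cleaned
  cleanFrom fuel U le X v out
    with Any.any? (λ D → ¬? (nonempty? (X D)) ×-dec anySubset? (blocks? (survivors X) D)) U
  ... | no ¬a = record { X = X ; valid = v ; free = free }
    where
    free : ∀ {D E B} → E ∈ˡ survivors X → D ⊆ E → Empty (X D) → ∣ B ∣ ≤ t → Disjoint D B →
           ∃ λ E′ → E′ ∈ˡ survivors X × D ⊆ E′ × Disjoint E′ B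
    free {D} {E} {B} E∈ s e b d with nonempty? B
    -- An empty `B` is no candidate for a blocker, but then there is nothing to avoid and `E` itself
    -- serves.
    ... | no ¬ne = E , E∈ , s , disjoint⁺ λ _ x∈B → ¬ne (_ , x∈B)
    ... | yes ne with Any.any? (λ E′ → (D ⊆? E′) ×-dec ¬? (nonempty? (E′ ∩ B))) (survivors X)
    ...   | yes a = find a
    ...   | no ¬b = contradiction (lose D∈U (e , B , ne , b , d ,
              All.map (λ {E′} h s → decidable-stable (nonempty? (E′ ∩ B)) (λ d → h (s , d))) (All.¬Any⇒All¬ _ ¬b))) ¬a
      where
      D∈U : D ∈ˡ U
      D∈U = decidable-stable (DecMem._∈?_ _≟ₛ_ D U) λ D∉ → e (out D D∉)
  cleanFrom zero [] le X v out | yes ()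
  cleanFrom (suc fuel) U le X v out | yes a with D , D∈ , e , B , bl ← find a
    with U′ , eq , h ← ∈-remove D∈ =
    cleanFrom fuel U′ (s≤s⁻¹ (subst (_≤ suc fuel) eq le)) (assign X D B) (assign-valid v e bl) out′
    where
    out′ : ∀ D′ → D′ ∉ˡ U′ → Nonempty (assign X D B D′)
    out′ D′ D′∉ with D′ ≟ₛ D
    ... | yes _ = proj₁ bl
    ... | no ne = out D′ λ D′∈ → D′∉ (h D′∈ ne)

  clean : Cleaned
  -- At the start no set has a blocker, and all subsets, listed by size, are open.
  clean = cleanFrom _ (concatMap (ksubsets ⊤) (upTo (suc n))) ≤-refl (λ _ → ⊥)
    (record { small = λ _ → subst (_≤ t) (sym (Subset.∣⊥∣≡0 n)) z≤n
            ; disjoint = λ D → disjoint⁺ λ _ x∈ → Subset.∉⊥ x∈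
            ; blocks = λ { _ (_ , x∈) → contradiction x∈ Subset.∉⊥ } })
    (λ D D∉ → contradiction (∈-concatMap (ksubsets ⊤) (Mem.∈-upTo⁺ (s≤s (Subset.∣p∣≤n D))) (∈-ksubsets⁺ Subset.⊆⊤))
      D∉)

  module _ {j : ℕ} (X : Blockers) (small : ∀ D → ∣ X D ∣ ≤ t) where

    len : ∀ D → length (elems (X D)) ≤ t
    len D = subst (_≤ t) (sym (length-elems (X D))) (small D)

    insert₂ : List (Fin n) → Fin n → Fin n → Subset n
    insert₂ p z w = fromList (z ∷ w ∷ p)

    blocker : List (Fin n) → List (Fin n)
    blocker p = elems (X (fromList p))

    length-blocker : ∀ p → length (blocker p) ≤ t
    length-blocker p = subst (_≤ t) (sym (length-elems (X (fromList p)))) (small (fromList p))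

    -- `p` lists the points of a member other than `z` and `w`, those of `D` first, so that `D` is
    -- recovered from `p` and the number `i` of its points.
    cover₁-at : List (Fin n) → ℕ → List (Subset n)
    cover₁-at p i = cartesianProductWith (insert₂ p) (blocker (take i p)) (blocker (take i p))

    cover₁ : List (Fin n) → List (Subset n)
    cover₁ p = concatMap (cover₁-at p) (upTo (suc j))

    -- The order of insertion follows `Bad₂`: `z` comes from the blocker of `p`, the other point
    -- from the blocker of `z ∷ p`.
    cover₂-at : List (Fin n) → Fin n → List (Subset n)
    cover₂-at p z = map (insert₂ p z) (blocker (z ∷ p))

    cover₂ : List (Fin n) → List (Subset n)
    cover₂ p = concatMap (cover₂-at p) (blocker p)

    cover : List (Fin n) → List (Subset n)
    cover p = cover₂ p ++ cover₁ p

    length-cover₁ : ∀ p → length (cover₁ p) ≤ suc j * (t * t)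
    length-cover₁ p = ≤-trans (length-concatMap-≤ (cover₁-at p) (upTo (suc j)) λ {i} _ →
        ≤-trans (≤-reflexive (length-cartesianProductWith (insert₂ p) (blocker (take i p)) (blocker (take i p))))
                (*-mono-≤ (length-blocker (take i p)) (length-blocker (take i p))))
      (≤-reflexive (cong (_* (t * t)) (List.length-upTo (suc j))))

    length-cover₂ : ∀ p → length (cover₂ p) ≤ t * t
    length-cover₂ p = ≤-trans (length-concatMap-≤ (cover₂-at p) (blocker p) λ {z} _ →
        ≤-trans (≤-reflexive (List.length-map (insert₂ p z) (blocker (z ∷ p)))) (length-blocker (z ∷ p)))
      (*-monoˡ-≤ t (length-blocker p))

    length-cover : ∀ p → length (cover p) ≤ (2 + j) * (t * t)
    length-cover p = ≤-trans (≤-reflexive (List.length-++ (cover₂ p))) (+-mono-≤ (length-cover₂ p) (length-cover₁ p))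

    bad₁⇒cover : ∀ {E} → ∣ E ∣ ≡ 2 + j → Bad₁ X E → ∃ λ p → length p ≡ j × E ∈ˡ cover₁ p
    bad₁⇒cover {E} ∣E∣ (D , D⊆E , z , w , z∈E , w∈E , z≢w , z∉D , w∉D , z∈X , w∈X) =
      p , length-p , ∈-concatMap (cover₁-at p) (Mem.∈-upTo⁺ (s≤s ∣D∣≤j))
        (subst (_∈ˡ cover₁-at p ∣ D ∣) (sym E≡)
          (Mem.∈-cartesianProductWith⁺ (insert₂ p) (inX z∈X) (inX w∈X)))
      where
      R = ((E - z) - w) ─ D
      p = elems D ++ elems R
      D′ = fromList (take ∣ D ∣ p)
      D′≡D : D′ ≡ D
      D′≡D = trans (cong (λ l → fromList (take l p)) (sym (length-elems D)))
        (trans (cong fromList (take-length-++ (elems D) (elems R))) (fromList-elems D))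
      inX : ∀ {x} → x ∈ X D → x ∈ˡ elems (X D′)
      inX {x} h = ∈-elems⁺ (subst (λ d → x ∈ X d) (sym D′≡D) h)
      w∈E-z : w ∈ E - z
      w∈E-z = x∈p-y⁺ w∈E (z≢w ∘ sym)
      D⊆ : D ⊆ (E - z) - w
      D⊆ x∈ = x∈p-y⁺ (x∈p-y⁺ (D⊆E x∈) λ { refl → z∉D x∈ }) λ { refl → w∉D x∈ }
      ∣D∣+∣R∣ : ∣ D ∣ + ∣ R ∣ ≡ j
      ∣D∣+∣R∣ = trans (∣∣+∣─∣ D⊆) (suc-injective (suc-injective
        (trans (cong suc (∣p-x∣ w∈E-z)) (trans (∣p-x∣ z∈E) ∣E∣))))
      ∣D∣≤j : ∣ D ∣ ≤ j
      ∣D∣≤j = subst (∣ D ∣ ≤_) ∣D∣+∣R∣ (m≤m+n _ _)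
      length-p : length p ≡ j
      length-p = trans (List.length-++ (elems D) {elems R})
        (trans (cong₂ _+_ (length-elems D) (length-elems R)) ∣D∣+∣R∣)
      E≡ : E ≡ fromList (z ∷ w ∷ p)
      E≡ = Subset.⊆-antisym to from
        where
        to : E ⊆ fromList (z ∷ w ∷ p)
        to {x} x∈ with x Fin.≟ z | x Fin.≟ w | x ∈? D
        ... | yes refl | _ | _ = ∈-fromList⁺ (z ∷ w ∷ p) (here refl)
        ... | no _ | yes refl | _ = ∈-fromList⁺ (z ∷ w ∷ p) (there (here refl))
        ... | no _ | no _ | yes h = ∈-fromList⁺ (z ∷ w ∷ p) (there (there (Mem.∈-++⁺ˡ (∈-elems⁺ h))))
        ... | no a | no b | no c = ∈-fromList⁺ (z ∷ w ∷ p) (there (there (Mem.∈-++⁺ʳ (elems D) (∈-elems⁺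
            (x∈p─q⁺ (x∈p-y⁺ (x∈p-y⁺ x∈ a) b) c)))))
        from : fromList (z ∷ w ∷ p) ⊆ E
        from x∈ with ∈-fromList⁻ (z ∷ w ∷ p) x∈
        ... | here refl = z∈E
        ... | there (here refl) = w∈E
        ... | there (there h) with Mem.∈-++⁻ (elems D) h
        ...   | inj₁ h = D⊆E (∈-elems⁻ h)
        ...   | inj₂ h = -⊆ E z (-⊆ (E - z) w (Subset.p─q⊆p ((E - z) - w) D (∈-elems⁻ h)))

    bad₂⇒cover : ∀ {E} → ∣ E ∣ ≡ 2 + j → Bad₂ X E → ∃ λ p → length p ≡ j × E ∈ˡ cover₂ p
    bad₂⇒cover {E} ∣E∣ (z , w , z∈E , w∈E , z≢w , z∈X , w∈X) =
      p , length-p , ∈-concatMap (cover₂-at p)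
        (∈-elems⁺ (subst (λ d → z ∈ X d) (sym (fromList-elems Q)) z∈X))
        (subst (_∈ˡ cover₂-at p z) (sym E≡)
          (Mem.∈-map⁺ (insert₂ p z) (∈-elems⁺ (subst (λ d → w ∈ X d) (sym Q+z) w∈X))))
      where
      Q = (E - w) - z
      p = elems Q
      z∈E-w : z ∈ E - w
      z∈E-w = x∈p-y⁺ z∈E z≢w
      length-p : length p ≡ j
      length-p = trans (length-elems Q) (suc-injective (suc-injective
        (trans (cong suc (∣p-x∣ z∈E-w)) (trans (∣p-x∣ w∈E) ∣E∣))))
      Q+z : fromList (z ∷ p) ≡ E - w
      Q+z = Subset.⊆-antisym from to
        where
        from : fromList (z ∷ p) ⊆ E - w
        from x∈ with ∈-fromList⁻ (z ∷ p) x∈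
        ... | here refl = z∈E-w
        ... | there h = -⊆ (E - w) z (∈-elems⁻ h)
        to : E - w ⊆ fromList (z ∷ p)
        to {x} x∈ with x Fin.≟ z
        ... | yes refl = ∈-fromList⁺ (z ∷ p) (here refl)
        ... | no a = ∈-fromList⁺ (z ∷ p) (there (∈-elems⁺ (x∈p-y⁺ x∈ a)))
      E≡ : E ≡ fromList (z ∷ w ∷ p)
      E≡ = Subset.⊆-antisym to from
        where
        to : E ⊆ fromList (z ∷ w ∷ p)
        to {x} x∈ with x Fin.≟ z | x Fin.≟ w
        ... | yes refl | _ = ∈-fromList⁺ (z ∷ w ∷ p) (here refl)
        ... | no _ | yes refl = ∈-fromList⁺ (z ∷ w ∷ p) (there (here refl))
        ... | no a | no b = ∈-fromList⁺ (z ∷ w ∷ p) (there (there (∈-elems⁺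
            (x∈p-y⁺ (x∈p-y⁺ x∈ b) a))))
        from : fromList (z ∷ w ∷ p) ⊆ E
        from x∈ with ∈-fromList⁻ (z ∷ w ∷ p) x∈
        ... | here refl = z∈E
        ... | there (here refl) = w∈E
        ... | there (there h) = -⊆ E w (-⊆ (E - w) z (∈-elems⁻ h))

    -- Each of the n^j tuples accounts for at most t² bad members of the second kind, and for at
    -- most t² of the first kind at each of the j + 1 possible sizes of `D`.
    removed≤ : Unique F → Uniform (2 + j) F →
               length F ≤ length (survivors X) + n ^ j * ((2 + j) * (t * t))
    removed≤ u unif = begin
      length F                                        ≡⟨ count+count¬ (bad? X) F ⟩
      count (bad? X) F + length (survivors X)         ≡⟨ +-comm (count (bad? X) F) _ ⟩
      length (survivors X) + count (bad? X) F         ≤⟨ +-monoʳ-≤ _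
        (unique-⊆⇒length≤ (Unique.filter⁺ (bad? X) u) sub) ⟩
      length (survivors X) + length (concatMap cover (tuples (allFin n) j))             ≤⟨ +-monoʳ-≤ _
        (length-concatMap-≤ cover (tuples (allFin n) j) (λ {p} _ → length-cover p)) ⟩
      length (survivors X) + length (tuples (allFin n) j) * ((2 + j) * (t * t))
        ≡⟨ cong (λ l → length (survivors X) + l * ((2 + j) * (t * t))) (length-allFin-tuples j) ⟩
      length (survivors X) + n ^ j * ((2 + j) * (t * t)) ∎
      where
      open ≤-Reasoning
      sub : filter (bad? X) F ⊆ˡ concatMap cover (tuples (allFin n) j)
      sub E∈ with Mem.∈-filter⁻ (bad? X) {xs = F} E∈
      ... | m , inj₁ b = let p , l , h = bad₁⇒cover (All.lookup unif m) b in
        ∈-concatMap cover {x = p} (∈-allFin-tuples {p = p} l) (Mem.∈-++⁺ʳ (cover₂ p) h)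
      ... | m , inj₂ b = let p , l , h = bad₂⇒cover (All.lookup unif m) b in
        ∈-concatMap cover {x = p} (∈-allFin-tuples {p = p} l) (Mem.∈-++⁺ˡ h)

-- Exchange: four-set clusters built around one member

no4Cluster : ∀ {k} {F : Family n} → Uniform k F → ClusterFree 4 k F → ∀ {P Q R S} W →
             P ∈ˡ F → Q ∈ˡ F → R ∈ˡ F → S ∈ˡ F →
             P ≢ Q → P ≢ R → P ≢ S → Q ≢ R → Q ≢ S → R ≢ S →
             P ⊆ W → Q ⊆ W → R ⊆ W → S ⊆ W → ∣ W ∣ ≤ 2 * k →
             (∀ {x} → x ∈ P → x ∈ Q → x ∈ R → x ∈ S → False) → False
no4Cluster {F = F} unif cf {P} {Q} {R} {S} W P∈ Q∈ R∈ S∈ pq pr ps qr qs rs P⊆ Q⊆ R⊆ S⊆ ∣W∣ empty =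
  cf (P ∷ Q ∷ R ∷ S ∷ [] ,
      (refl
      , ((pq ∷ pr ∷ ps ∷ []) ∷ (qr ∷ qs ∷ []) ∷ (rs ∷ []) ∷ [] ∷ [])
      , All.lookup unif P∈ ∷ All.lookup unif Q∈ ∷ All.lookup unif R∈ ∷ All.lookup unif S∈ ∷ []
      , ≤-trans (Subset.p⊆q⇒∣p∣≤∣q∣ (∪-least P⊆
        (∪-least Q⊆ (∪-least R⊆ (∪-least S⊆ (λ x∈ → contradiction x∈ Subset.∉⊥)))))) ∣W∣
      , λ (x , x∈) → let x∈P , r₁ = ∈-∩⁻ P _ x∈
                         x∈Q , r₂ = ∈-∩⁻ Q _ r₁
                         x∈R , r₃ = ∈-∩⁻ R _ r₂
                         x∈S , _  = ∈-∩⁻ S _ r₃ in empty x∈P x∈Q x∈R x∈S)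
     , λ { (here refl) → P∈ ; (there (here refl)) → Q∈ ; (there (there (here refl))) → R∈
         ; (there (there (there (here refl)))) → S∈ })

∪─-⊇ : ∀ {V D S : Subset n} → D ⊆ V → S ⊆ V ∪ (S ─ D)
∪─-⊇ {D = D} s {x} x∈ with x ∈? D
... | yes x∈D = ∈-∪ˡ (s x∈D)
... | no  x∉D = ∈-∪ʳ (x∈p─q⁺ x∈ x∉D)

x∈p∖p-y⇒x≡y : ∀ {p : Subset n} {x y} → x ∈ p → x ∉ p - y → x ≡ y
x∈p∖p-y⇒x≡y {x = x} {y} x∈ x∉ with x Fin.≟ y
... | yes eq = eq
... | no ne = contradiction (x∈p-y⁺ x∈ ne) x∉

split─ : ∀ (A D : Subset n) {x} → x ∈ A → x ∈ D ⊎ x ∈ A ─ D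
split─ A D {x} x∈ with x ∈? D
... | yes m = inj₁ m
... | no ¬m = inj₂ (x∈p─q⁺ x∈ ¬m)

∩-distribˡ-minus : ∀ (p q : Subset n) u → p ∩ (q - u) ≡ (p ∩ q) - u
∩-distribˡ-minus p q u = Subset.⊆-antisym
  (λ x∈ → let x∈p , m = ∈-∩⁻ p _ x∈ ; x∈q , x≢u = x∈p-y⁻ q u m in
          x∈p-y⁺ (∈-∩⁺ (x∈p , x∈q)) x≢u)
  (λ x∈ → let m , x≢u = x∈p-y⁻ (p ∩ q) u x∈ ; x∈p , x∈q = ∈-∩⁻ p q m in
          ∈-∩⁺ (x∈p , x∈p-y⁺ x∈q x≢u))

module Exchange {k : ℕ} {F : Family n} (unif : Uniform k F) (cf : ClusterFree 4 k F) where

  card : ∀ {E} → E ∈ˡ F → ∣ E ∣ ≡ k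
  card E∈ = All.lookup unif E∈

  ∣∣+∣∣ : ∀ {E E₂} → E ∈ˡ F → E₂ ∈ˡ F → ∣ E ∣ + ∣ E₂ ∣ ≡ 2 * k
  ∣∣+∣∣ E∈ E₂∈ = trans (cong₂ _+_ (card E∈) (card E₂∈)) (cong (k +_) (sym (+-identityʳ k)))

  -- `A` adds one point to E ∪ E₂ and `B` adds at most |E ∩ E₂| - 1, so the union has at most |E ∪
  -- E₂| + |E ∩ E₂| = 2k points. A common point lies in `E₂` and in B ∩ E, hence can only be `u`,
  -- which `A` omits.
  meetingCluster : ∀ {E E₂ A B u u′} → E ∈ˡ F → E₂ ∈ˡ F → A ∈ˡ F → B ∈ˡ F → E₂ ≢ E →
                   u ∈ E → u ∈ E₂ → u ∉ A → u′ ∈ E → u′ ∈ E₂ → u′ ∉ B → u′ ≢ u →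
                   E - u ⊆ A → E ─ (E₂ - u) ⊆ B → (∀ {x} → x ∈ B → x ∈ E → x ∈ E ─ (E₂ - u)) → False
  meetingCluster {E} {E₂} {A} {B} {u} {u′} E∈ E₂∈ A∈ B∈ E₂≢E u∈E u∈E₂ u∉A u′∈E u′∈E₂ u′∉B u′≢u DA⊆A DB⊆B B∩E =
    no4Cluster unif cf W E∈ E₂∈ A∈ B∈
      (E₂≢E ∘ sym) (λ eq → u∉A (subst (u ∈_) eq u∈E)) (λ eq → u′∉B (subst (u′ ∈_) eq u′∈E))
      (λ eq → u∉A (subst (u ∈_) eq u∈E₂)) (λ eq → u′∉B (subst (u′ ∈_) eq u′∈E₂))
      (λ eq → u∉A (subst (u ∈_) (sym eq) u∈B))
      (∈-∪ˡ ∘ ∈-∪ˡ) (∈-∪ˡ ∘ ∈-∪ʳ) A⊆W B⊆W ∣W∣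
      λ x∈E x∈E₂ x∈A x∈B → x∈p─q⇒x∉q E (E₂ - u) (B∩E x∈B x∈E)
        (x∈p-y⁺ x∈E₂ λ { refl → u∉A x∈A })
    where
    DA DB V W : Subset n
    DA = E - u
    DB = E ─ (E₂ - u)
    V = E ∪ E₂
    W = V ∪ ((A ─ DA) ∪ (B ─ DB))
    u∈B : u ∈ B
    u∈B = DB⊆B (x∈p─q⁺ u∈E λ m → proj₂ (x∈p-y⁻ E₂ u m) refl)
    A⊆W : A ⊆ W
    A⊆W x∈ with split─ A DA x∈
    ... | inj₁ m = ∈-∪ˡ (∈-∪ˡ (-⊆ E u m))
    ... | inj₂ m = ∈-∪ʳ {p = V} (∈-∪ˡ m)
    B⊆W : B ⊆ W
    B⊆W x∈ with split─ B DB x∈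
    ... | inj₁ m = ∈-∪ˡ (∈-∪ˡ (Subset.p─q⊆p E (E₂ - u) m))
    ... | inj₂ m = ∈-∪ʳ {p = V} (∈-∪ʳ {p = A ─ DA} m)
    ∣A─DA∣ : ∣ A ─ DA ∣ ≡ 1
    ∣A─DA∣ = +-cancelˡ-≡ ∣ DA ∣ _ _ (trans (∣∣+∣─∣ DA⊆A) (trans (card A∈) (trans (sym (card E∈))
      (trans (sym (∣p-x∣ u∈E)) (+-comm 1 _)))))
    ∣B─DB∣ : ∣ B ─ DB ∣ ≡ ∣ E ∩ (E₂ - u) ∣
    ∣B─DB∣ = +-cancelˡ-≡ ∣ DB ∣ _ _ (trans (trans (∣∣+∣─∣ DB⊆B) (card B∈))
      (sym (trans (+-comm ∣ DB ∣ _) (trans (∣∩∣+∣─∣ E (E₂ - u)) (card E∈)))))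
    ∣E∩E₂∣ : suc ∣ E ∩ (E₂ - u) ∣ ≡ ∣ E ∩ E₂ ∣
    ∣E∩E₂∣ = trans (cong (λ p → suc ∣ p ∣) (∩-distribˡ-minus E E₂ u)) (∣p-x∣ (∈-∩⁺ (u∈E , u∈E₂)))
    ∣W∣ : ∣ W ∣ ≤ 2 * k
    ∣W∣ = begin
      ∣ W ∣                             ≤⟨ ∣∪∣≤ V _ ⟩
      ∣ V ∣ + ∣ (A ─ DA) ∪ (B ─ DB) ∣   ≤⟨ +-monoʳ-≤ ∣ V ∣ (∣∪∣≤ (A ─ DA) (B ─ DB)) ⟩
      ∣ V ∣ + (∣ A ─ DA ∣ + ∣ B ─ DB ∣) ≡⟨ cong (∣ V ∣ +_) (cong₂ _+_ ∣A─DA∣ ∣B─DB∣) ⟩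
      ∣ V ∣ + suc ∣ E ∩ (E₂ - u) ∣      ≡⟨ cong (∣ V ∣ +_) ∣E∩E₂∣ ⟩
      ∣ V ∣ + ∣ E ∩ E₂ ∣                ≡⟨ ∣∪∣+∣∩∣ E E₂ ⟩
      ∣ E ∣ + ∣ E₂ ∣                    ≡⟨ ∣∣+∣∣ E∈ E₂∈ ⟩
      2 * k                             ∎
      where open ≤-Reasoning

  ∣─∣≡1 : ∀ {E E′ y} → E ∈ˡ F → E′ ∈ˡ F → y ∈ E → E - y ⊆ E′ → ∣ E′ ─ (E - y) ∣ ≡ 1
  ∣─∣≡1 {E} {E′} {y} E∈ E′∈ y∈ s = +-cancelˡ-≡ ∣ E - y ∣ _ _ (trans (∣∣+∣─∣ s) (trans (card E′∈)
    (trans (sym (card E∈)) (trans (sym (∣p-x∣ y∈)) (+-comm 1 _)))))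

  neighbour∌ : ∀ {E E′ y} → E ∈ˡ F → E′ ∈ˡ F → E′ ≢ E → E - y ⊆ E′ → y ∉ E′
  neighbour∌ {E} {E′} {y} E∈ E′∈ ne s y∈ = ne (sym (⊆∧∣≤∣⇒≡ E⊆ (≤-reflexive (trans (card E′∈) (sym (card E∈))))))
    where
    E⊆ : E ⊆ E′
    E⊆ {x} x∈ with x Fin.≟ y
    ... | yes refl = y∈
    ... | no x≢y = s (x∈p-y⁺ x∈ x≢y)

  module TwoNeighbours {E E₁ E₂ y₁ y₂} (4≤k : 4 ≤ k) (E∈ : E ∈ˡ F) (E₁∈ : E₁ ∈ˡ F) (E₂∈ : E₂ ∈ˡ F)
    (E₁≢E : E₁ ≢ E) (E₂≢E : E₂ ≢ E) (y₁∈E : y₁ ∈ E) (y₂∈E : y₂ ∈ E) (y₁≢y₂ : y₁ ≢ y₂)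
    (s₁ : E - y₁ ⊆ E₁) (s₂ : E - y₂ ⊆ E₂) where

    D V : Subset n
    D = fromList (y₁ ∷ y₂ ∷ [])
    V = E ∪ ((E₁ ─ (E - y₁)) ∪ (E₂ ─ (E - y₂)))

    D⊆E : D ⊆ E
    D⊆E x∈ with ∈-fromList⁻ (y₁ ∷ y₂ ∷ []) x∈
    ... | here refl = y₁∈E
    ... | there (here refl) = y₂∈E

    ∉D : ∀ {x} → x ≢ y₁ → x ≢ y₂ → x ∉ D
    ∉D a b m with ∈-fromList⁻ (y₁ ∷ y₂ ∷ []) m
    ... | here eq = a eq
    ... | there (here eq) = b eq

    ∉D⁻ : ∀ {x} → x ∉ D → x ≢ y₁ × x ≢ y₂
    ∉D⁻ x∉ = (λ { refl → x∉ (∈-fromList⁺ (y₁ ∷ y₂ ∷ []) (here refl)) })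
           , (λ { refl → x∉ (∈-fromList⁺ (y₁ ∷ y₂ ∷ []) (there (here refl))) })

    ∣V∣ : ∣ V ∣ ≤ k + 2
    ∣V∣ = ≤-trans (∣∪∣≤ E _) (+-mono-≤ (≤-reflexive (card E∈)) (≤-trans (∣∪∣≤ (E₁ ─ (E - y₁)) _)
      (≤-reflexive (cong₂ _+_ (∣─∣≡1 E∈ E₁∈ y₁∈E s₁) (∣─∣≡1 E∈ E₂∈ y₂∈E s₂)))))

    -- E ∪ E₁ ∪ E₂ has at most k + 2 points and `B` adds k - 2. Since B ∩ E consists of y₁ and y₂, a
    -- common point would be one of these, but `E₁` omits y₁ and `E₂` omits y₂. A third point `u` of
    -- `E` distinguishes `B` from the other sets.
    cluster : ∀ {B} → B ∈ˡ F → D ⊆ B → (∀ {x} → x ∈ B → x ∈ E → x ∈ D) → False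
    cluster {B} B∈ D⊆B B∩E
      with u , m ← 0<∣∣⇒Nonempty ((E - y₁) - y₂) (s≤s⁻¹ (s≤s⁻¹ (subst (3 ≤_)
        (sym (trans (cong suc (∣p-x∣ (x∈p-y⁺ y₂∈E (y₁≢y₂ ∘ sym)))) (trans (∣p-x∣ y₁∈E) (card E∈))))
        (≤-trans (s≤s (s≤s (s≤s z≤n))) 4≤k))))
      with m′ , u≢y₂ ← x∈p-y⁻ (E - y₁) y₂ m
      with u∈E , u≢y₁ ← x∈p-y⁻ E y₁ m′ =
      no4Cluster unif cf W E∈ E₁∈ E₂∈ B∈
        (E₁≢E ∘ sym) (E₂≢E ∘ sym) (λ eq → u∉B (subst (u ∈_) eq u∈E))
        (λ eq → neighbour∌ E∈ E₂∈ E₂≢E s₂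
          (subst (y₂ ∈_) eq (s₁ (x∈p-y⁺ y₂∈E (y₁≢y₂ ∘ sym)))))
        (λ eq → u∉B (subst (u ∈_) eq (s₁ (x∈p-y⁺ u∈E u≢y₁))))
        (λ eq → u∉B (subst (u ∈_) eq (s₂ (x∈p-y⁺ u∈E u≢y₂))))
        (∈-∪ˡ ∘ ∈-∪ˡ) (∈-∪ˡ ∘ E₁⊆V) (∈-∪ˡ ∘ E₂⊆V) (∪─-⊇ (∈-∪ˡ ∘ D⊆E)) ∣W∣
        λ {x} x∈E x∈E₁ x∈E₂ x∈B → ∉D (λ { refl → neighbour∌ E∈ E₁∈ E₁≢E s₁ x∈E₁ })
                                     (λ { refl → neighbour∌ E∈ E₂∈ E₂≢E s₂ x∈E₂ }) (B∩E x∈B x∈E)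
      where
      W : Subset n
      W = V ∪ (B ─ D)
      u∉B : u ∉ B
      u∉B u∈B = ∉D u≢y₁ u≢y₂ (B∩E u∈B u∈E)
      E₁⊆V : E₁ ⊆ V
      E₁⊆V x∈ with split─ E₁ (E - y₁) x∈
      ... | inj₁ m = ∈-∪ˡ (-⊆ E y₁ m)
      ... | inj₂ m = ∈-∪ʳ {p = E} (∈-∪ˡ m)
      E₂⊆V : E₂ ⊆ V
      E₂⊆V x∈ with split─ E₂ (E - y₂) x∈
      ... | inj₁ m = ∈-∪ˡ (-⊆ E y₂ m)
      ... | inj₂ m = ∈-∪ʳ {p = E} (∈-∪ʳ {p = E₁ ─ (E - y₁)} m)
      ∣D∣ : ∣ D ∣ ≡ 2
      ∣D∣ = ∣fromList∣ ((y₁≢y₂ ∷ []) ∷ [] ∷ [])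
      ∣W∣ : ∣ W ∣ ≤ 2 * k
      ∣W∣ = begin
        ∣ W ∣               ≤⟨ ∣∪∣≤ V (B ─ D) ⟩
        ∣ V ∣ + ∣ B ─ D ∣   ≤⟨ +-monoˡ-≤ ∣ B ─ D ∣ ∣V∣ ⟩
        k + 2 + ∣ B ─ D ∣   ≡⟨ +-assoc k 2 _ ⟩
        k + (2 + ∣ B ─ D ∣) ≡⟨ cong (λ d → k + (d + ∣ B ─ D ∣)) (sym ∣D∣) ⟩
        k + (∣ D ∣ + ∣ B ─ D ∣) ≡⟨ cong (k +_) (trans (∣∣+∣─∣ D⊆B) (trans (card B∈) (sym (+-identityʳ k)))) ⟩
        2 * k               ∎
        where open ≤-Reasoning

-- Blocked sets and light points after cleaning

module Local (k : ℕ) (4≤k : 4 ≤ k) (F : Family n) (unif : Uniform k F) (cf : ClusterFree 4 k F)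
             (cl : Cleaning.Cleaned (2 * k) F) where

  open Cleaning (2 * k) F
  open Cleaned cl
  open Valid valid
  open Exchange unif cf

  G : Family n
  G = survivors X

  G⊆F : G ⊆ˡ F
  G⊆F E∈ = proj₁ (Mem.∈-filter⁻ (¬? ∘ bad? X) {xs = F} E∈)

  ¬bad : ∀ {E} → E ∈ˡ G → ¬ (Bad₁ X E ⊎ Bad₂ X E)
  ¬bad E∈ = proj₂ (Mem.∈-filter⁻ (¬? ∘ bad? X) {xs = F} E∈)

  ∣G∣ : ∀ {E} → E ∈ˡ G → ∣ E ∣ ≡ k
  ∣G∣ E∈ = All.lookup unif (G⊆F E∈)

  Light : Subset n → Fin n → Set
  Light E y = Nonempty (X (E - y))

  light? : ∀ E → Decidable (Light E)
  light? E y = nonempty? (X (E - y))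

  -- The blocker meets every survivor above `D`, and a second point of it in `E` would make `E` bad
  -- of the first kind.
  single : ∀ {E D} → E ∈ˡ G → D ⊆ E → Nonempty (X D) →
           ∃ λ z → z ∈ E × z ∈ X D × z ∉ D × (∀ {w} → w ∈ E → w ∈ X D → w ≡ z)
  single {E} {D} E∈ D⊆ ne with z , m ← blocks D ne E∈ D⊆ with z∈E , z∈X ← ∈-∩⁻ E (X D) m =
    z , z∈E , z∈X , notD z∈X , λ {w} w∈E w∈X → decidable-stable (w Fin.≟ z) λ w≢z →
      ¬bad E∈ (inj₁ (D , D⊆ , w , z , w∈E , z∈E , w≢z , notD w∈X , notD z∈X , w∈X , z∈X))
    where
    notD : ∀ {x} → x ∈ X D → x ∉ D
    notD x∈X x∈D = disjoint⁻ (disjoint D) x∈D x∈X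

  -- Were `D′` not blocked, it would extend to a survivor avoiding `X D`; but that survivor also
  -- contains `D`.
  blocked-⊆ : ∀ {E} D D′ → E ∈ˡ G → D ⊆ D′ → D′ ⊆ E → Nonempty (X D) → Disjoint D′ (X D) → Nonempty (X D′)
  blocked-⊆ {E} D D′ E∈ s s′ ne dis = decidable-stable (nonempty? (X D′)) λ e →
    let E′ , E′∈ , D′⊆E′ , d = free E∈ s′ e (small D) dis in d (blocks D ne E′∈ (D′⊆E′ ∘ s))

  lightBlocker : ∀ {E y} → E ∈ˡ G → Light E y → y ∈ X (E - y)
  lightBlocker {E} {y} E∈ l with z , z∈E , z∈X , z∉ , _ ← single E∈ (-⊆ E y) l
    with refl ← x∈p∖p-y⇒x≡y z∈E z∉ = z∈X

  -- Suppose `X D` meets `E` in the single point z. Then E - z avoids `X D`, so it is blocked and z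
  -- is light. Given a second light point z′ outside `D`, the set E - z - z′ is blocked too, and its
  -- blocker meets `E` in z or z′. Either case is a nested blocking, so `E` would be bad of the
  -- second kind.
  unblocked : ∀ {E D} → E ∈ˡ G → D ⊆ E →
              (∀ {z} → z ∈ E → z ∉ D → Light E z → ∃ λ z′ → z′ ∈ E × z′ ∉ D × z′ ≢ z × Light E z′) →
              Empty (X D)
  unblocked {E} {D} E∈ D⊆ h ne with z , z∈E , z∈X , z∉D , uniq ← single E∈ D⊆ ne
    with lz ← blocked-⊆ D (E - z) E∈ (λ x∈ → x∈p-y⁺ (D⊆ x∈) λ { refl → z∉D x∈ }) (-⊆ E z) ne
               (disjoint⁺ λ x∈ x∈X → let x∈E , x≢z = x∈p-y⁻ E z x∈ in x≢z (uniq x∈E x∈X))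
    with z′ , z′∈E , z′∉D , z′≢z , lz′ ← h z∈E z∉D lz
    with nQ ← blocked-⊆ D ((E - z) - z′) E∈
               (λ x∈ → x∈p-y⁺ (x∈p-y⁺ (D⊆ x∈) λ { refl → z∉D x∈ }) λ { refl → z′∉D x∈ })
               (-⊆ E z ∘ -⊆ (E - z) z′) ne
               (disjoint⁺ λ x∈ x∈X → let x∈E , x≢z = x∈p-y⁻ E z (-⊆ (E - z) z′ x∈) in x≢z (uniq x∈E x∈X))
    with w , w∈E , w∈X , w∉Q , _ ← single E∈ (-⊆ E z ∘ -⊆ (E - z) z′) nQ
    with w Fin.≟ z
  ... | yes refl = ¬bad E∈ (inj₂ (z , z′ , z∈E , z′∈E , z′≢z ∘ sym ,
                     subst (λ Q → z ∈ X Q) (Subset.p─x─y≡p─y─x E z z′) w∈X , lightBlocker E∈ lz′))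
  ... | no w≢z with refl ← x∈p∖p-y⇒x≡y (x∈p-y⁺ w∈E w≢z) w∉Q =
    ¬bad E∈ (inj₂ (z′ , z , z′∈E , z∈E , z′≢z , w∈X , lightBlocker E∈ lz))

  -- Freeness is applied to `V ─ D`, the points of `V` that the new member must not pick up.
  extend : ∀ {E D} → E ∈ˡ G → D ⊆ E → Empty (X D) → ∀ V → ∣ V ∣ ≤ 2 * k →
           ∃ λ E′ → E′ ∈ˡ G × D ⊆ E′ × (∀ {x} → x ∈ E′ → x ∈ V → x ∈ D)
  extend {D = D} E∈ s e V le
    with E′ , E′∈ , s′ , d ← free E∈ s e (≤-trans (Subset.∣p─q∣≤∣p∣ V D) le)
      (disjoint⁺ λ x∈D x∈ → x∈p─q⇒x∉q V D x∈ x∈D) =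
    E′ , E′∈ , s′ , λ {x} x∈E′ x∈V → decidable-stable (x ∈? D) λ x∉D →
      disjoint⁻ d x∈E′ (x∈p─q⁺ x∈V x∉D)

  -- A cluster E, E₂, A, B with A ∩ E = E - u and B ∩ E = E ─ (E₂ - u).
  meetingPair : ∀ {E E₂ u u′} → E ∈ˡ G → E₂ ∈ˡ G → E₂ ≢ E → u ∈ E → u ∈ E₂ → ¬ Light E u →
                u′ ∈ E → u′ ∈ E₂ → u′ ≢ u →
                (∀ {z} → z ∈ E → z ∈ E₂ → z ≢ u → Light E z →
                   ∃ λ z′ → z′ ∈ E × z′ ∈ E₂ × z′ ≢ u × z′ ≢ z × Light E z′) → False
  meetingPair {E} {E₂} {u} {u′} E∈ E₂∈ E₂≢E u∈E u∈E₂ ¬lu u′∈E u′∈E₂ u′≢u h =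
    finish (extend E∈ (-⊆ E u) ¬lu E ∣E∣≤2k)
           (extend E∈ (Subset.p─q⊆p E (E₂ - u)) (unblocked E∈ (Subset.p─q⊆p E (E₂ - u)) h′) E ∣E∣≤2k)
    where
    ∣E∣≤2k : ∣ E ∣ ≤ 2 * k
    ∣E∣≤2k = subst (_≤ 2 * k) (sym (∣G∣ E∈)) (m≤m+n k _)
    -- The points of `E` outside `E ─ (E₂ - u)` are those of E ∩ (E₂ - u), so the assumption on
    -- light points is the one that `unblocked` requires.
    h′ : ∀ {z} → z ∈ E → z ∉ E ─ (E₂ - u) → Light E z →
         ∃ λ z′ → z′ ∈ E × z′ ∉ E ─ (E₂ - u) × z′ ≢ z × Light E z′
    h′ {z} z∈E z∉ lz
      with z∈E₂ , z≢u ← x∈p-y⁻ E₂ u (decidable-stable (z ∈? (E₂ - u)) (z∉ ∘ x∈p─q⁺ z∈E))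
      with z′ , z′∈E , z′∈E₂ , z′≢u , z′≢z , lz′ ← h z∈E z∈E₂ z≢u lz =
      z′ , z′∈E , (λ m → x∈p─q⇒x∉q E (E₂ - u) m (x∈p-y⁺ z′∈E₂ z′≢u)) , z′≢z , lz′
    finish : (∃ λ A → A ∈ˡ G × E - u ⊆ A × (∀ {x} → x ∈ A → x ∈ E → x ∈ E - u)) →
             (∃ λ B → B ∈ˡ G × E ─ (E₂ - u) ⊆ B × (∀ {x} → x ∈ B → x ∈ E → x ∈ E ─ (E₂ - u))) → False
    finish (A , A∈ , DA⊆A , A∩E) (B , B∈ , DB⊆B , B∩E) =
      meetingCluster (G⊆F E∈) (G⊆F E₂∈) (G⊆F A∈) (G⊆F B∈) E₂≢E u∈E u∈E₂
        (λ u∈A → proj₂ (x∈p-y⁻ E u (A∩E u∈A u∈E)) refl) u′∈E u′∈E₂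
        (λ u′∈B → x∈p─q⇒x∉q E (E₂ - u) (B∩E u′∈B u′∈E) (x∈p-y⁺ u′∈E₂ u′≢u)) u′≢u
        DA⊆A DB⊆B B∩E

  -- A cluster E, E₁, E₂, B with B ∩ E = {y₁, y₂}.
  twoNeighbours : ∀ {E E₁ E₂ y₁ y₂} → E ∈ˡ G → E₁ ∈ˡ G → E₂ ∈ˡ G → E₁ ≢ E → E₂ ≢ E →
                  y₁ ∈ E → y₂ ∈ E → y₁ ≢ y₂ → E - y₁ ⊆ E₁ → E - y₂ ⊆ E₂ →
                  (∀ {z} → z ∈ E → z ≢ y₁ → z ≢ y₂ → Light E z →
                     ∃ λ z′ → z′ ∈ E × z′ ≢ y₁ × z′ ≢ y₂ × z′ ≢ z × Light E z′) → False
  twoNeighbours {E} {y₁ = y₁} {y₂} E∈ E₁∈ E₂∈ E₁≢E E₂≢E y₁∈E y₂∈E y₁≢y₂ s₁ s₂ h =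
    finish (extend E∈ T.D⊆E (unblocked E∈ T.D⊆E h′) E (subst (_≤ 2 * k) (sym (∣G∣ E∈)) (m≤m+n k _)))
    where
    module T = TwoNeighbours 4≤k (G⊆F E∈) (G⊆F E₁∈) (G⊆F E₂∈) E₁≢E E₂≢E y₁∈E y₂∈E y₁≢y₂ s₁ s₂
    h′ : ∀ {z} → z ∈ E → z ∉ T.D → Light E z → ∃ λ z′ → z′ ∈ E × z′ ∉ T.D × z′ ≢ z × Light E z′
    h′ z∈E z∉ lz with a , b ← T.∉D⁻ z∉ with z′ , z′∈E , a′ , b′ , c , l ← h z∈E a b lz =
      z′ , z′∈E , T.∉D a′ b′ , c , l
    finish : (∃ λ B → B ∈ˡ G × T.D ⊆ B × (∀ {x} → x ∈ B → x ∈ E → x ∈ T.D)) → False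
    finish (B , B∈ , D⊆B , B∩E) = T.cluster (G⊆F B∈) D⊆B B∩E

-- Members with a single light point

module Centers (k : ℕ) (4≤k : 4 ≤ k) (F : Family n) (unif : Uniform k F) (cf : ClusterFree 4 k F)
               (cl : Cleaning.Cleaned (2 * k) F) where

  open Cleaning (2 * k) F
  open Cleaned cl
  open Valid valid
  open Exchange unif cf
  open Local k 4≤k F unif cf cl public

  Own : Subset n → Fin n → Set
  Own E y = ∀ {E′} → E′ ∈ˡ G → E - y ⊆ E′ → E′ ≡ E

  OnlyLight : Subset n → Fin n → Set
  OnlyLight E y = ∀ v → v ∈ E → v ≢ y → ¬ Light E v

  Center : Subset n → Fin n → Set
  Center E y = y ∈ E × Light E y × Own E y × OnlyLight E y

  SecondLight : Subset n → Set
  SecondLight E = ∃₂ λ y y′ → y ∈ E × y′ ∈ E × y ≢ y′ × Light E y × Light E y′ × Own E y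

  abstract
    own⊎neighbour : ∀ E y → Own E y ⊎ ∃ λ E′ → E′ ∈ˡ G × E - y ⊆ E′ × E′ ≢ E
    own⊎neighbour E y with Any.any? (λ E′ → ((E - y) ⊆? E′) ×-dec ¬? (E′ ≟ₛ E)) G
    ... | yes a = inj₂ (find a)
    ... | no ¬a = inj₁ λ {E′} E′∈ s → decidable-stable (E′ ≟ₛ E) λ ne → ¬a (lose E′∈ (s , ne))

    own? : ∀ E y → Dec (Own E y)
    own? E y with own⊎neighbour E y
    ... | inj₁ o = yes o
    ... | inj₂ (E′ , E′∈ , s , ne) = no λ o → ne (o E′∈ s)

    center? : ∀ E y → Dec (Center E y)
    center? E y = (y ∈? E) ×-dec light? E y ×-dec own? E y ×-dec
      Finₚ.all? λ v → (v ∈? E) →-dec (¬? (v Fin.≟ y) →-dec ¬? (light? E v))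

    -- E ∩ E₂ contains no light point because it omits `y`. Hence `u` is not light, and the
    -- condition on light points in `meetingPair` is vacuous.
    onlyLight-meeting : ∀ {E E₂ y u u′} → E ∈ˡ G → OnlyLight E y → E₂ ∈ˡ G → E₂ ≢ E → y ∉ E₂ →
                        u ∈ E → u ∈ E₂ → u′ ∈ E → u′ ∈ E₂ → u ≢ u′ → False
    onlyLight-meeting E∈ ol E₂∈ ne y∉ u∈E u∈E₂ u′∈E u′∈E₂ u≢u′ =
      meetingPair E∈ E₂∈ ne u∈E u∈E₂ (ol _ u∈E λ { refl → y∉ u∈E₂ }) u′∈E u′∈E₂ (u≢u′ ∘ sym)
        λ z∈E z∈E₂ _ lz → ⊥-elim (ol _ z∈E (λ { refl → y∉ z∈E₂ }) lz)

    onlyLight-⊇ : ∀ {E E₂ y} → E ∈ˡ G → y ∈ E → OnlyLight E y → E₂ ∈ˡ G → E₂ ≢ E → E - y ⊆ E₂ → y ∉ E₂ → False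
    onlyLight-⊇ {E} {E₂} {y} E∈ y∈ ol E₂∈ ne s y∉ =
      let u , u′ , u∈ , u′∈ , u≢u′ = two in
      onlyLight-meeting E∈ ol E₂∈ ne y∉ (-⊆ E y u∈) (s u∈) (-⊆ E y u′∈) (s u′∈) u≢u′
      where
      two : ∃₂ λ u u′ → u ∈ E - y × u′ ∈ E - y × u ≢ u′
      two = twoElements (E - y) (s≤s⁻¹ (subst (3 ≤_) (sym (trans (∣p-x∣ y∈) (∣G∣ E∈)))
        (≤-trans (s≤s (s≤s (s≤s z≤n))) 4≤k)))

    -- Without light points, any `E - y` extends to another member avoiding `y`. The two share at
    -- least two points and nothing in `E` is light, which already yields a cluster.
    someLight : ∀ {E} → E ∈ˡ G → ∃ λ y → y ∈ E × Light E y
    someLight {E} E∈ = decidable-stable (Finₚ.any? λ y → (y ∈? E) ×-dec light? E y) λ none →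
      noLight none (0<∣∣⇒Nonempty E (subst (0 <_) (sym (∣G∣ E∈)) (≤-trans (s≤s z≤n) 4≤k)))
      where
      noLight : ¬ (∃ λ y → y ∈ E × Light E y) → Nonempty E → False
      noLight none (y , y∈) = finish (extend E∈ (-⊆ E y) (λ l → none (y , y∈ , l)) ⁅ y ⁆
          (subst (_≤ 2 * k) (sym (Subset.∣⁅x⁆∣≡1 y)) (≤-trans (≤-trans (s≤s z≤n) 4≤k) (m≤m+n k _))))
        where
        finish : (∃ λ E₂ → E₂ ∈ˡ G × E - y ⊆ E₂ × (∀ {x} → x ∈ E₂ → x ∈ ⁅ y ⁆ → x ∈ E - y)) → False
        finish (E₂ , E₂∈ , s , avoid) =
          onlyLight-⊇ E∈ y∈ (λ v v∈ _ l → none (v , v∈ , l)) E₂∈ (λ { refl → y∉ y∈ }) s y∉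
          where
          y∉ : y ∉ E₂
          y∉ h = proj₂ (x∈p-y⁻ E y (avoid h (Subset.x∈⁅x⁆ y))) refl

    -- With exactly two, or at least four, light points, no light point outside the pair y₁, y₂ is
    -- alone there, so the pair is unblocked and `twoNeighbours` applies. With exactly three, y₃ is
    -- alone; but k ≥ 4 leaves a point `u` that is not light, and `E₁` contains both y₂ and y₃, so
    -- `meetingPair` applies to `E` and `E₁`.
    twoLights : ∀ {E y₁ y₂} → E ∈ˡ G → y₁ ∈ E → y₂ ∈ E → y₁ ≢ y₂ → Light E y₁ → Light E y₂ →
                (∃ λ E₁ → E₁ ∈ˡ G × E - y₁ ⊆ E₁ × E₁ ≢ E) → (∃ λ E₂ → E₂ ∈ˡ G × E - y₂ ⊆ E₂ × E₂ ≢ E) → False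
    twoLights {E} {y₁} {y₂} E∈ y₁∈ y₂∈ y₁≢y₂ l₁ l₂ (E₁ , E₁∈ , s₁ , ne₁) (E₂ , E₂∈ , s₂ , ne₂)
      with Finₚ.any? (λ y → (y ∈? E) ×-dec ¬? (y Fin.≟ y₁) ×-dec ¬? (y Fin.≟ y₂) ×-dec light? E y)
    ... | no none = twoNeighbours E∈ E₁∈ E₂∈ ne₁ ne₂ y₁∈ y₂∈ y₁≢y₂ s₁ s₂
                      λ z∈ a b lz → ⊥-elim (none (_ , z∈ , a , b , lz))
    ... | yes (y₃ , y₃∈ , y₃≢y₁ , y₃≢y₂ , l₃)
      with Finₚ.any? (λ y → (y ∈? E) ×-dec ¬? (y Fin.≟ y₁) ×-dec ¬? (y Fin.≟ y₂) ×-dec ¬?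
        (y Fin.≟ y₃) ×-dec light? E y)
    ... | yes (y₄ , y₄∈ , y₄≢y₁ , y₄≢y₂ , y₄≢y₃ , l₄) =
      twoNeighbours E∈ E₁∈ E₂∈ ne₁ ne₂ y₁∈ y₂∈ y₁≢y₂ s₁ s₂ other
      where
      other : ∀ {z} → z ∈ E → z ≢ y₁ → z ≢ y₂ → Light E z →
              ∃ λ z′ → z′ ∈ E × z′ ≢ y₁ × z′ ≢ y₂ × z′ ≢ z × Light E z′
      other {z} _ _ _ _ with z Fin.≟ y₃
      ... | yes refl = y₄ , y₄∈ , y₄≢y₁ , y₄≢y₂ , y₄≢y₃ , l₄
      ... | no z≢y₃ = y₃ , y₃∈ , y₃≢y₁ , y₃≢y₂ , z≢y₃ ∘ sym , l₃
    ... | no none =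
      let u , u∈E , u≢y₁ , u≢y₂ , u≢y₃ = outside in
      meetingPair E∈ E₁∈ ne₁ u∈E (s₁ (x∈p-y⁺ u∈E u≢y₁))
        (λ lu → none (u , u∈E , u≢y₁ , u≢y₂ , u≢y₃ , lu))
        y₂∈ (s₁ (x∈p-y⁺ y₂∈ (y₁≢y₂ ∘ sym))) (u≢y₂ ∘ sym)
        (other u≢y₂ u≢y₃)
      where
      outside : ∃ λ u → u ∈ E × u ≢ y₁ × u ≢ y₂ × u ≢ y₃
      outside =
        let u , m₃ = 0<∣∣⇒Nonempty (((E - y₁) - y₂) - y₃) (s≤s⁻¹ (s≤s⁻¹ (s≤s⁻¹ (subst (4 ≤_)
              (sym (trans (cong (2 +_) (∣p-x∣ (x∈p-y⁺ (x∈p-y⁺ y₃∈ y₃≢y₁) y₃≢y₂)))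
                (trans (cong suc (∣p-x∣ (x∈p-y⁺ y₂∈ (y₁≢y₂ ∘ sym)))) (trans (∣p-x∣ y₁∈) (∣G∣ E∈))))) 4≤k))))
            m₂ , a₃ = x∈p-y⁻ ((E - y₁) - y₂) y₃ m₃
            m₁ , a₂ = x∈p-y⁻ (E - y₁) y₂ m₂
            m , a₁ = x∈p-y⁻ E y₁ m₁
        in u , m , a₁ , a₂ , a₃
      other : ∀ {u} → u ≢ y₂ → u ≢ y₃ → ∀ {z} → z ∈ E → z ∈ E₁ → z ≢ u → Light E z →
              ∃ λ z′ → z′ ∈ E × z′ ∈ E₁ × z′ ≢ u × z′ ≢ z × Light E z′
      other u≢y₂ u≢y₃ {z} z∈E z∈E₁ z≢u lz with z Fin.≟ y₂
      ... | yes refl = y₃ , y₃∈ , s₁ (x∈p-y⁺ y₃∈ y₃≢y₁) , u≢y₃ ∘ sym , y₃≢y₂ , l₃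
      ... | no z≢y₂ = y₂ , y₂∈ , s₁ (x∈p-y⁺ y₂∈ (y₁≢y₂ ∘ sym)) , u≢y₂ ∘ sym , z≢y₂ ∘ sym , l₂

    -- Of two light points, at least one is own by `twoLights`. If there is only one light point,
    -- another member above `E - y₁` would omit y₁ and so lead to a cluster.
    classify : ∀ {E} → E ∈ˡ G → ∃ (Center E) ⊎ SecondLight E
    classify {E} E∈ = go (someLight E∈)
      where
      go : (∃ λ y → y ∈ E × Light E y) → ∃ (Center E) ⊎ SecondLight E
      go (y₁ , y₁∈ , l₁) with own⊎neighbour E y₁ | Finₚ.any? (λ y → (y ∈? E) ×-dec ¬? (y Fin.≟ y₁) ×-dec light? E y)
      ... | inj₁ o | no none = inj₁ (y₁ , y₁∈ , l₁ , o , λ v v∈ ne lv → none (v , v∈ , ne , lv))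
      ... | inj₂ (E₂ , E₂∈ , s , ne) | no none =
        ⊥-elim (onlyLight-⊇ E∈ y₁∈ (λ v v∈ ne lv → none (v , v∈ , ne , lv)) E₂∈ ne s
                 (neighbour∌ (G⊆F E∈) (G⊆F E₂∈) ne s))
      ... | inj₁ o | yes (y₂ , y₂∈ , y₂≢y₁ , l₂) = inj₂ (y₁ , y₂ , y₁∈ , y₂∈ , y₂≢y₁ ∘ sym , l₁ , l₂ , o)
      ... | inj₂ nb | yes (y₂ , y₂∈ , y₂≢y₁ , l₂) with own⊎neighbour E y₂
      ...   | inj₁ o = inj₂ (y₂ , y₁ , y₂∈ , y₁∈ , y₂≢y₁ , l₂ , l₁ , o)
      ...   | inj₂ nb₂ = ⊥-elim (twoLights E∈ y₁∈ y₂∈ (y₂≢y₁ ∘ sym) l₁ l₂ nb nb₂)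

    -- If one of two different centers were missing from the other set, the k - 2 ≥ 2 points of `Q`
    -- would be enough for a cluster. If both sets contain both centers, each set is `Q` with these
    -- two points; so `E` and `E′` coincide and have two light points.
    sameCenter : ∀ {E E′ y y′ Q} → E ∈ˡ G → E′ ∈ˡ G → Center E y → Center E′ y′ →
                 Q ⊆ E → Q ⊆ E′ → y ∉ Q → y′ ∉ Q → 2 + ∣ Q ∣ ≡ k → y ≡ y′
    sameCenter {E} {E′} {y} {y′} {Q} E∈ E′∈ (y∈ , l , o , ol) (y′∈ , l′ , o′ , ol′) Q⊆E Q⊆E′ y∉Q y′∉Q ∣Q∣ =
      decidable-stable (y Fin.≟ y′) contra
      where
      two : ∃₂ λ u u′ → u ∈ Q × u′ ∈ Q × u ≢ u′
      two = twoElements Q (s≤s⁻¹ (s≤s⁻¹ (subst (4 ≤_) (sym ∣Q∣) 4≤k)))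
      contra : y ≢ y′ → False
      contra y≢y′ with y ∈? E′ | y′ ∈? E
      ... | no y∉ | _ = let u , u′ , u∈ , u′∈ , ne = two in
        onlyLight-meeting E∈ ol E′∈ (λ eq → y∉ (subst (y ∈_) (sym eq) y∈)) y∉ (Q⊆E u∈) (Q⊆E′ u∈) (Q⊆E u′∈)
          (Q⊆E′ u′∈) ne
      ... | yes _ | no y′∉ = let u , u′ , u∈ , u′∈ , ne = two in
        onlyLight-meeting E′∈ ol′ E∈ (λ eq → y′∉ (subst (y′ ∈_) (sym eq) y′∈)) y′∉ (Q⊆E′ u∈) (Q⊆E u∈) (Q⊆E′ u′∈)
          (Q⊆E u′∈) ne
      ... | yes y∈E′ | yes y′∈E = ol y′ y′∈E (y≢y′ ∘ sym)
        (subst (λ S → Light S y′) (trans (sym (all E′∈ Q⊆E′ y∈E′ y′∈)) (all E∈ Q⊆E y∈ y′∈E)) l′)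
        where
        V : Subset n
        V = fromList (y ∷ y′ ∷ []) ∪ Q
        ∣V∣ : ∣ V ∣ ≡ k
        ∣V∣ = trans (∣∪∣-disjoint _ Q (disjoint⁺ {p = fromList (y ∷ y′ ∷ [])} λ m →
          case ∈-fromList⁻ (y ∷ y′ ∷ []) m of λ
                { (here refl) → y∉Q ; (there (here refl)) → y′∉Q }))
          (trans (cong (_+ ∣ Q ∣) (∣fromList∣ ((y≢y′ ∷ []) ∷ [] ∷ []))) ∣Q∣)
        all : ∀ {S} → S ∈ˡ G → Q ⊆ S → y ∈ S → y′ ∈ S → V ≡ S
        all S∈ s a b = ⊆∧∣≤∣⇒≡ (∪-least {p = fromList (y ∷ y′ ∷ [])} (λ m → case ∈-fromList⁻ (y ∷ y′ ∷ []) m of λ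
                { (here refl) → a ; (there (here refl)) → b }) s) (≤-reflexive (trans (∣G∣ S∈) (sym ∣V∣)))

-- Counting (k-1)-sets: own, unowned and coloured

module Shadow (j : ℕ) (2≤j : 2 ≤ j) (F : Family n) (unif : Uniform (2 + j) F) (uniq : Unique F)
              (cf : ClusterFree 4 (2 + j) F) (cl : Cleaning.Cleaned (2 * (2 + j)) F) where

  k t : ℕ
  k = 2 + j
  t = 2 * k

  open Cleaning t F
  open Cleaned cl
  open Valid valid
  open Exchange unif cf
  open Centers k (s≤s (s≤s 2≤j)) F unif cf cl public

  K : List (Subset n)
  K = ksubsets ⊤ (suc j)

  length-K : length K ≡ n C suc j
  length-K = trans (length-ksubsets (⊤ {n}) (suc j)) (cong (_C suc j) (Subset.∣⊤∣≡n n))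

  G-unique : Unique G
  G-unique = Unique.filter⁺ (¬? ∘ bad? X) uniq

  ∈K : ∀ {E y} → E ∈ˡ G → y ∈ E → E - y ∈ˡ K
  ∈K E∈ y∈ = ∈-ksubsets Subset.⊆⊤ (suc-injective (trans (∣p-x∣ y∈) (∣G∣ E∈)))

  someOwn : ∀ {E} → E ∈ˡ G → ∃ λ y → y ∈ E × Own E y
  someOwn E∈ with classify E∈
  ... | inj₁ (y , y∈ , _ , o , _) = y , y∈ , o
  ... | inj₂ (y , _ , y∈ , _ , _ , _ , _ , o) = y , y∈ , o

  -- The default `E` occurs only outside `G`, since every member of `G` has an own subset.
  ownSubset : Subset n → Subset n
  ownSubset E with Finₚ.any? (λ y → (y ∈? E) ×-dec own? E y)
  ... | yes (y , _) = E - y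
  ... | no _        = E

  ownSubset-spec : ∀ {E} → E ∈ˡ G → ∃ λ y → y ∈ E × Own E y × ownSubset E ≡ E - y
  ownSubset-spec {E} E∈ with Finₚ.any? (λ y → (y ∈? E) ×-dec own? E y)
  ... | yes (y , y∈ , o) = y , y∈ , o , refl
  ... | no none          = contradiction (someOwn E∈) none

  ownSubset-injective : ∀ {E E′} → E ∈ˡ G → E′ ∈ˡ G → ownSubset E ⊆ E′ → E′ ≡ E
  ownSubset-injective E∈ E′∈ s =
    let y , _ , o , eq = ownSubset-spec E∈ in o E′∈ λ {x} x∈ → s (subst (x ∈_) (sym eq) x∈)

  ownSubset⊆ : ∀ {E} → E ∈ˡ G → ownSubset E ⊆ E
  ownSubset⊆ {E} E∈ {x} x∈ = let y , _ , _ , eq = ownSubset-spec E∈ in -⊆ E y (subst (x ∈_) eq x∈)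

  hasCenter? : Decidable (λ E → ∃ (Center E))
  hasCenter? E = Finₚ.any? (center? E)

  G₁ G₂ : Family n
  G₁ = filter hasCenter? G
  G₂ = filter (¬? ∘ hasCenter?) G

  G₁⊆G : G₁ ⊆ˡ G
  G₁⊆G E∈ = proj₁ (Mem.∈-filter⁻ hasCenter? {xs = G} E∈)

  unowned? : Decidable (_∉ˡ map ownSubset G)
  unowned? D = ¬? (DecMem._∈?_ _≟ₛ_ D (map ownSubset G))

  unownedK : List (Subset n)
  unownedK = filter unowned? K

  G+unowned≤ : length G + length unownedK ≤ length K
  G+unowned≤ = subst (_≤ length K)
    (trans (List.length-++ (map ownSubset G)) (cong (_+ length unownedK) (List.length-map ownSubset G)))
    (unique-⊆⇒length≤
      (Unique.++⁺ (map-unique (λ E∈ E′∈ eq → sym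
        (ownSubset-injective E∈ E′∈ (λ {x} x∈ → ownSubset⊆ E′∈ (subst (x ∈_) eq x∈)))) G-unique)
        (Unique.filter⁺ unowned? (ksubsets-unique ⊤ (suc j)))
        λ (p , q) → proj₂ (Mem.∈-filter⁻ unowned? {xs = K} q) p)
      λ {D} m → [ owned , (λ q → proj₁ (Mem.∈-filter⁻ unowned? {xs = K} q)) ]′ (Mem.∈-++⁻ (map ownSubset G) m))
    where
    owned : ∀ {D} → D ∈ˡ map ownSubset G → D ∈ˡ K
    owned m = let E , E∈ , D≡ = Mem.∈-map⁻ ownSubset m ; y , y∈ , _ , eq = ownSubset-spec E∈ in
      subst (_∈ˡ K) (sym (trans D≡ eq)) (∈K E∈ y∈)

  LightIn : Subset n → Subset n → Set
  LightIn E D = D ⊆ E × Nonempty (X D)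

  lightIn? : ∀ E D → Dec (LightIn E D)
  lightIn? E D = (D ⊆? E) ×-dec nonempty? (X D)

  -- Two light points give two blocked faces of `E`, and at most one of them is the face selected by
  -- `ownSubset`. No other member can have selected the remaining face, since a member containing a
  -- selected face is the one that selected it.
  lightUnowned : ∀ {E} → E ∈ˡ G₂ → ∃ λ D → D ∈ˡ unownedK × LightIn E D
  lightUnowned {E} E∈G₂ = go (classify E∈)
    where
    E∈ : E ∈ˡ G
    E∈ = proj₁ (Mem.∈-filter⁻ (¬? ∘ hasCenter?) {xs = G} E∈G₂)
    other : ∀ {y y*} → y ∈ E → Light E y → ownSubset E ≡ E - y* → y ≢ y* → ∃ λ D → D ∈ˡ unownedK × LightIn E D
    other {y} {y*} y∈ l eq y≢y* = E - y , Mem.∈-filter⁺ unowned? (∈K E∈ y∈) unowned , -⊆ E y , l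
      where
      notOwned : ∀ {E″} → E″ ∈ˡ G → E - y ≡ ownSubset E″ → False
      notOwned {E″} E″∈ D≡ = proj₂ (x∈p-y⁻ E y (subst (y ∈_)
          (trans (sym eq) (trans (cong ownSubset E≡E″) (sym D≡))) (x∈p-y⁺ y∈ y≢y*))) refl
        where
        E≡E″ : E ≡ E″
        E≡E″ = ownSubset-injective E″∈ E∈ (λ {x} x∈ → -⊆ E y (subst (x ∈_) (sym D≡) x∈))
      unowned : E - y ∉ˡ map ownSubset G
      unowned m = let E″ , E″∈ , D≡ = Mem.∈-map⁻ ownSubset m in notOwned E″∈ D≡
    second : ∀ {y y′ y*} → Dec (y ≡ y*) → y ∈ E → y′ ∈ E → y ≢ y′ → Light E y → Light E y′ → ownSubset E ≡ E - y* →
             ∃ λ D → D ∈ˡ unownedK × LightIn E D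
    second (no y≢y*)  y∈ y′∈ y≢y′ l l′ eq = other y∈ l eq y≢y*
    second (yes refl) y∈ y′∈ y≢y′ l l′ eq = other y′∈ l′ eq (y≢y′ ∘ sym)
    go : ∃ (Center E) ⊎ SecondLight E → ∃ λ D → D ∈ˡ unownedK × LightIn E D
    go (inj₁ c) = contradiction c (proj₂ (Mem.∈-filter⁻ (¬? ∘ hasCenter?) {xs = G} E∈G₂))
    go (inj₂ (y , y′ , y∈ , y′∈ , y≢y′ , l , l′ , _)) =
      let y* , _ , _ , eq = ownSubset-spec E∈ in second (y Fin.≟ y*) y∈ y′∈ y≢y′ l l′ eq

  -- A member above the (k-1)-set `D` adds a single point, and for a blocked `D` this point lies in
  -- `X D`.
  lightIn-degree : ∀ {D} → D ∈ˡ K → count (λ E → lightIn? E D) G₂ ≤ t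
  lightIn-degree {D} D∈ = begin
    count (λ E → lightIn? E D) G₂               ≤⟨ unique-⊆⇒length≤
      (Unique.filter⁺ _ (Unique.filter⁺ _ G-unique)) sub ⟩
    length (map (λ z → ⁅ z ⁆ ∪ D) (elems (X D))) ≡⟨ List.length-map _ (elems (X D)) ⟩
    length (elems (X D))                        ≡⟨ length-elems (X D) ⟩
    ∣ X D ∣                                     ≤⟨ small D ⟩
    t                                           ∎
    where
    open ≤-Reasoning
    sub : filter (λ E → lightIn? E D) G₂ ⊆ˡ map (λ z → ⁅ z ⁆ ∪ D) (elems (X D))
    sub {E} m =
      let E∈G₂ , D⊆E , ne = Mem.∈-filter⁻ (λ E → lightIn? E D) {xs = G₂} m
          E∈ = proj₁ (Mem.∈-filter⁻ (¬? ∘ hasCenter?) {xs = G} E∈G₂)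
          z , z∈E , z∈X , z∉D , _ = single E∈ D⊆E ne
      in subst (_∈ˡ map (λ z → ⁅ z ⁆ ∪ D) (elems (X D))) (E≡ E∈ D⊆E z∈E z∉D)
           (Mem.∈-map⁺ (λ z → ⁅ z ⁆ ∪ D) (∈-elems⁺ z∈X))
      where
      E≡ : ∀ {z} → E ∈ˡ G → D ⊆ E → z ∈ E → z ∉ D → ⁅ z ⁆ ∪ D ≡ E
      E≡ {z} E∈ D⊆E z∈E z∉D = ⊆∧∣≤∣⇒≡
          (∪-least {p = ⁅ z ⁆} (λ x∈ → subst (_∈ E) (sym (Subset.x∈⁅y⁆⇒x≡y z x∈)) z∈E) D⊆E)
          (≤-reflexive (trans (∣G∣ E∈) (sym (trans (∣∪∣-disjoint ⁅ z ⁆ D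
            (disjoint⁺ {p = ⁅ z ⁆} λ x∈ → subst (_∉ D) (sym (Subset.x∈⁅y⁆⇒x≡y z x∈)) z∉D))
            (cong₂ _+_ (Subset.∣⁅x⁆∣≡1 z) (proj₂ (∈-ksubsets⁻ ⊤ (suc j) D∈)))))))

  ∣G₂∣≤ : length G₂ ≤ length unownedK * t
  ∣G₂∣≤ = subst (_≤ length unownedK * t) (*-identityʳ (length G₂))
    (doubleCount lightIn? (λ {E} E∈ → let D , D∈ , l = lightUnowned E∈ in ∈⇒0<count (lightIn? E) D∈ l)
      (λ D∈ → lightIn-degree (proj₁ (Mem.∈-filter⁻ unowned? {xs = K} D∈))))

  CenteredOn : Subset n → Subset n → Set
  CenteredOn E T = ∃ λ y → Center E y × T ≡ E - y

  coloured? : Decidable (λ T → Any (λ E → CenteredOn E T) G)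
  coloured? T = Any.any? (λ E → Finₚ.any? λ y → center? E y ×-dec (T ≟ₛ (E - y))) G

  ∣G₁∣≤ : length G₁ ≤ count coloured? K
  ∣G₁∣≤ = matching-length≤ {R = CenteredOn} (Unique.filter⁺ hasCenter? G-unique)
    (λ {E} E∈ → let E∈G , y , c = Mem.∈-filter⁻ hasCenter? {xs = G} E∈ in
      E - y , Mem.∈-filter⁺ coloured? (∈K E∈G (proj₁ c)) (lose E∈G (y , c , refl)) , y , c , refl)
    λ { {E} E∈ E′∈ (y , c , refl) (y′ , c′ , eq) →
        sym (proj₁ (proj₂ (proj₂ c)) (G₁⊆G E′∈) (λ {x} x∈ → -⊆ _ y′ (subst (x ∈_) eq x∈))) }

  -- A deficiency `M` of `G` leaves at most M unowned sets, so `G₂` has at most M t members. Members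
  -- of `G₁` colour different sets, so the uncoloured sets number at most |G₂| + M.
  uncoloured≤ : ∀ {M} → length K ≤ length G + M → count (¬? ∘ coloured?) K ≤ M * suc t
  uncoloured≤ {M} le = +-cancelˡ-≤ (length G₁) _ _ (begin
    length G₁ + count (¬? ∘ coloured?) K            ≤⟨ +-monoˡ-≤ _ ∣G₁∣≤ ⟩
    count coloured? K + count (¬? ∘ coloured?) K    ≡⟨ count+count¬ coloured? K ⟨
    length K                                        ≤⟨ le ⟩
    length G + M                                    ≡⟨ cong (_+ M) (count+count¬ hasCenter? G) ⟩
    length G₁ + length G₂ + M                       ≡⟨ +-assoc (length G₁) _ _ ⟩
    length G₁ + (length G₂ + M)                     ≤⟨ +-monoʳ-≤ (length G₁) (begin
      length G₂ + M            ≤⟨ +-monoˡ-≤ M ∣G₂∣≤ ⟩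
      length unownedK * t + M  ≤⟨ +-monoˡ-≤ M (*-monoˡ-≤ t (+-cancelˡ-≤ (length G) _ _ (≤-trans G+unowned≤ le))) ⟩
      M * t + M                ≡⟨ +-comm (M * t) M ⟩
      M + M * t                ≡⟨ *-suc M t ⟨
      M * suc t                ∎) ⟩
    length G₁ + M * suc t                           ∎)
    where open ≤-Reasoning

-- Almost all tuples: colourings and union bounds

count-tuples : ∀ {P : List (Fin n) → Set} (P? : Decidable P) j →
               count P? (tuples (allFin n) (suc j)) ≡ ∑ (allFin n) (λ a → count (P? ∘ (a ∷_)) (tuples (allFin n) j))
count-tuples {n} P? j = count-cartesianProductWith P? _∷_ (allFin n) (tuples (allFin n) j)

length-allFin : ∀ n → length (allFin n) ≡ n
length-allFin n = List.length-tabulate id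

∑-allFin-const : ∀ n c → ∑ (allFin n) (λ _ → c) ≡ n * c
∑-allFin-const n c = trans (∑-const c (allFin n)) (cong (_* c) (length-allFin n))

∃-below-average : ∀ {c} (g : Fin n → ℕ) → 0 < n → ∑ (allFin n) g ≤ n * c → ∃ λ a → g a ≤ c
∃-below-average {n} {c} g 0<n le with Finₚ.any? (λ a → g a ≤? c)
... | yes h = h
... | no ¬h = contradiction (begin-strict
    n * c                        <⟨ *-monoʳ-< n {{>-nonZero 0<n}} (n<1+n c) ⟩
    n * suc c                    ≡⟨ ∑-allFin-const n (suc c) ⟨
    ∑ (allFin n) (λ _ → suc c)   ≤⟨ ∑-mono (allFin n) (λ {a} _ → ≰⇒> λ l → ¬h (a , l)) ⟩
    ∑ (allFin n) g               ≤⟨ le ⟩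
    n * c                        ∎) (<-irrefl refl)
  where open ≤-Reasoning

-- If tuples differing in a single coordinate never get different colours and
-- almost all tuples are coloured, then a slice with few uncoloured tuples is
-- almost monochromatic by induction, and lines through it spread its colour.
monochromatic : ∀ j {Col : List (Fin n) → Fin n → Set} (col? : ∀ p y → Dec (Col p y)) {c} → c < n →
  (∀ u {a b} v {y y′} → length (u ++ a ∷ v) ≡ j → Col (u ++ a ∷ v) y → Col (u ++ b ∷ v) y′ → y ≡ y′) →
  n * count (λ p → ¬? (Finₚ.any? (col? p))) (tuples (allFin n) j) ≤ c * n ^ j →
  ∃ λ y → n * count (λ p → ¬? (col? p y)) (tuples (allFin n) j) ≤ j * c * n ^ j
-- The only tuple is `[]`. As c < n, the bound on uncoloured tuples does not allow it to be one.
monochromatic {n} zero {Col} col? {c} c<n line few with Finₚ.any? (col? [])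
... | yes (y , h) = y , ≤-trans (≤-reflexive (trans (cong (n *_)
        (⇒count≡0 (λ p → ¬? (col? p y)) {xs = [] ∷ []} (λ { (here refl) nc → nc h }))) (*-zeroʳ n))) z≤n
... | no none = contradiction (≤-trans (≤-reflexive (sym (*-identityʳ n)))
  (≤-trans few (≤-reflexive (*-identityʳ c)))) (<⇒≱ c<n)
monochromatic {n} (suc j) {Col} col? {c} c<n line few =
  spread (∃-below-average (λ a → n * missing a) 0<n (begin
    ∑ (allFin n) (λ a → n * missing a)      ≡⟨ ∑-*ˡ n missing (allFin n) ⟩
    n * ∑ (allFin n) missing                ≡⟨ cong (n *_) (count-tuples missing? j) ⟨
    n * count missing? (tuples (allFin n) (suc j)) ≤⟨ few ⟩
    c * (n * n ^ j)                         ≡⟨ *-swap c n (n ^ j) ⟩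
    n * (c * n ^ j)                         ∎))
  where
  open ≤-Reasoning
  *-swap : ∀ a b c → a * (b * c) ≡ b * (a * c)
  *-swap = solve-∀
  0<n : 0 < n
  0<n = ≤-<-trans z≤n c<n
  missing? : Decidable (λ p → ¬ ∃ (Col p))
  missing? p = ¬? (Finₚ.any? (col? p))
  missing : Fin n → ℕ
  missing a = count (λ q → missing? (a ∷ q)) (tuples (allFin n) j)
  off : Fin n → Fin n → ℕ
  off y a = count (λ q → ¬? (col? (a ∷ q) y)) (tuples (allFin n) j)
  spread : (∃ λ a → n * missing a ≤ c * n ^ j) →
           ∃ λ y → n * count (λ p → ¬? (col? p y)) (tuples (allFin n) (suc j)) ≤ suc j * c * n ^ suc j
  spread (a , le) = let y , h = monochromatic j (λ q → col? (a ∷ q)) c<n (λ u v l → line (a ∷ u) v (cong suc l)) le in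
    y , bound y h
    where
    -- If `b ∷ q` has a colour other than `y`, then `a ∷ q`, which differs from it in one
    -- coordinate, cannot have the colour `y`.
    offLine : ∀ y b → off y b ≤ missing b + off y a
    offLine y b = count-cover (λ q → ¬? (col? (b ∷ q) y)) (λ q → missing? (b ∷ q)) (λ q → ¬? (col? (a ∷ q) y))
      (tuples (allFin n) j) λ {q} q∈ nc → step q q∈ nc (Finₚ.any? (col? (b ∷ q)))
      where
      step : ∀ q → q ∈ˡ tuples (allFin n) j → ¬ Col (b ∷ q) y → Dec (∃ (Col (b ∷ q))) →
             ¬ ∃ (Col (b ∷ q)) ⊎ ¬ Col (a ∷ q) y
      step q q∈ nc (no none) = inj₁ none
      step q q∈ nc (yes (y′ , h)) = inj₂ λ h′ → nc (subst (Col (b ∷ q))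
        (line [] q (cong suc (∈-tuples⇒length (allFin n) j q∈)) h h′) h)
    bound : ∀ y → n * off y a ≤ j * c * n ^ j →
            n * count (λ p → ¬? (col? p y)) (tuples (allFin n) (suc j)) ≤ suc j * c * n ^ suc j
    bound y h = begin
      n * count (λ p → ¬? (col? p y)) (tuples (allFin n) (suc j)) ≡⟨ cong (n *_)
        (count-tuples (λ p → ¬? (col? p y)) j) ⟩
      n * ∑ (allFin n) (off y)                                    ≤⟨ *-monoʳ-≤ n
        (∑-mono (allFin n) (λ {b} _ → offLine y b)) ⟩
      n * ∑ (allFin n) (λ b → missing b + off y a)                ≡⟨ cong (n *_)
        (∑-+ missing (λ _ → off y a) (allFin n)) ⟩
      n * (∑ (allFin n) missing + ∑ (allFin n) (λ _ → off y a))   ≡⟨ cong₂ (λ u v → n * (u + v))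
        (sym (count-tuples missing? j)) (∑-allFin-const n (off y a)) ⟩
      n * (count missing? (tuples (allFin n) (suc j)) + n * off y a) ≡⟨ *-distribˡ-+ n _ _ ⟩
      n * count missing? (tuples (allFin n) (suc j)) + n * (n * off y a) ≤⟨ +-mono-≤ few (*-monoʳ-≤ n h) ⟩
      c * (n * n ^ j) + n * (j * c * n ^ j)                       ≡⟨ collect j c n (n ^ j) ⟩
      suc j * c * n ^ suc j                                       ∎
      where
      collect : ∀ j c n m → c * (n * m) + n * (j * c * m) ≡ suc j * c * (n * m)
      collect = solve-∀

_∈ˡ?_ : (x : Fin n) (xs : List (Fin n)) → Dec (x ∈ˡ xs)
_∈ˡ?_ = DecMem._∈?_ Fin._≟_

uniqueTuple? : Decidable (Unique {A = Fin n})
uniqueTuple? = Defs.unique? Fin._≟_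

count-∈ : (q : List (Fin n)) → count (_∈ˡ? q) (allFin n) ≤ length q
count-∈ {n} q = unique-⊆⇒length≤ (Unique.filter⁺ (_∈ˡ? q) (Unique.allFin⁺ n))
  (λ m → proj₂ (Mem.∈-filter⁻ (_∈ˡ? q) {xs = allFin n} m))

-- A union bound over the j coordinates: given the entries behind it, each coordinate is to blame
-- for at most c of its n values.
causedByCoordinate≤ : ∀ {P : List (Fin n) → Set} (P? : Decidable P) {R : Fin n → List (Fin n) → Set}
                      (R? : ∀ a q → Dec (R a q)) → ¬ P [] → (∀ a q → P (a ∷ q) → R a q ⊎ P q) →
                      ∀ {c} j → (∀ q → length q < j → count (λ a → R? a q) (allFin n) ≤ c) →
                      n * count P? (tuples (allFin n) j) ≤ j * c * n ^ j
causedByCoordinate≤ {n} P? R? ¬P[] split zero _ =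
  ≤-reflexive (trans (cong (n *_) (⇒count≡0 P? {xs = [] ∷ []} λ { (here refl) → ¬P[] })) (*-zeroʳ n))
causedByCoordinate≤ {n} P? R? ¬P[] split {c} (suc j) few = begin
  n * count P? (tuples (allFin n) (suc j))
    ≡⟨ cong (n *_) (count-tuples P? j) ⟩
  n * ∑ (allFin n) (λ a → count (λ q → P? (a ∷ q)) ts)
    ≤⟨ *-monoʳ-≤ n (∑-mono (allFin n) (λ {a} _ → count-cover (λ q → P? (a ∷ q)) (R? a) P? ts (λ {q} _ → split a q))) ⟩
  n * ∑ (allFin n) (λ a → count (R? a) ts + count P? ts)
    ≡⟨ cong (n *_) (∑-+ (λ a → count (R? a) ts) (λ _ → count P? ts) (allFin n)) ⟩
  n * (∑ (allFin n) (λ a → count (R? a) ts) + ∑ (allFin n) (λ _ → count P? ts))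
    ≡⟨ cong₂ (λ u v → n * (u + v)) (∑-count-swap R? (allFin n) ts) (∑-allFin-const n _) ⟩
  n * (∑ ts (λ q → count (λ a → R? a q) (allFin n)) + n * count P? ts)
    ≤⟨ *-monoʳ-≤ n (+-mono-≤ (∑-bound ts (λ {q} q∈ → few q (s≤s (≤-reflexive (∈-tuples⇒length (allFin n) j q∈)))))
         (causedByCoordinate≤ P? R? ¬P[] split j (λ q lt → few q (m≤n⇒m≤1+n lt)))) ⟩
  n * (length ts * c + j * c * n ^ j)
    ≡⟨ cong (λ l → n * (l * c + j * c * n ^ j)) (length-allFin-tuples j) ⟩
  n * (n ^ j * c + j * c * n ^ j)
    ≡⟨ collect j c n (n ^ j) ⟩
  suc j * c * n ^ suc j ∎
  where
  open ≤-Reasoning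
  ts = tuples (allFin n) j
  collect : ∀ j c n m → n * (m * c + j * c * m) ≡ suc j * c * (n * m)
  collect = solve-∀

repeating≤ : ∀ n j → n * count (¬? ∘ uniqueTuple?) (tuples (allFin n) j) ≤ j * j * n ^ j
repeating≤ n j = causedByCoordinate≤ (¬? ∘ uniqueTuple?) _∈ˡ?_ (λ nu → nu []) split j
  (λ q lt → ≤-trans (count-∈ q) (<⇒≤ lt))
  where
  split : ∀ a q → ¬ Unique (a ∷ q) → a ∈ˡ q ⊎ ¬ Unique q
  split a q nu with a ∈ˡ? q
  ... | yes m = inj₁ m
  ... | no ¬m = inj₂ λ u → nu (All.tabulate (λ b∈ eq → ¬m (subst (_∈ˡ q) (sym eq) b∈)) ∷ u)

meeting≤ : ∀ (E : Subset n) j → n * count (Any.any? (_∈? E)) (tuples (allFin n) j) ≤ j * ∣ E ∣ * n ^ j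
meeting≤ {n} E j = causedByCoordinate≤ (Any.any? (_∈? E)) (λ a _ → a ∈? E) (λ ())
  (λ { a q (here a∈) → inj₁ a∈ ; a q (there m) → inj₂ m }) j
  (λ _ _ → length≤∣∣ E (Unique.filter⁺ (_∈? E) (Unique.allFin⁺ n))
             (λ m → proj₂ (Mem.∈-filter⁻ (_∈? E) {xs = allFin n} m)))

spans? : (L : Family n) → Decidable (λ p → fromList p ∈ˡ L)
spans? L p = DecMem._∈?_ _≟ₛ_ (fromList p) L

-- A tuple that spans a j-set has all of its entries there, which leaves j^j possibilities.
spanning≤ : ∀ j (L : Family n) → (∀ {T} → T ∈ˡ L → ∣ T ∣ ≡ j) →
            count (spans? L) (tuples (allFin n) j) ≤ length L * j ^ j
spanning≤ {n} j L card = ≤-trans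
  (unique-⊆⇒length≤ (Unique.filter⁺ (spans? L) (tuples-unique (Unique.allFin⁺ n) j))
    (λ {p} m → let p∈ , T∈ = Mem.∈-filter⁻ (spans? L) {xs = tuples (allFin n) j} m in
      ∈-concatMap orderings T∈ (subst (λ l → p ∈ˡ tuples (elems (fromList p)) l) (∈-tuples⇒length (allFin n) j p∈)
        (∈-tuples (∈-elems⁺ ∘ ∈-fromList⁺ p)))))
  (length-concatMap-≤ orderings L λ {T} T∈ → ≤-reflexive (trans (length-tuples (elems T) j)
    (cong (_^ j) (trans (length-elems T) (card T∈)))))
  where
  orderings : Subset n → List (List (Fin n))
  orderings T = tuples (elems T) j

Unique-dropMiddle : ∀ (u : List A) {a v} → Unique (u ++ a ∷ v) → Unique (u ++ v)
Unique-dropMiddle [] (_ ∷ h) = h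
Unique-dropMiddle (x ∷ u) {a} {v} (x∉ ∷ h) =
  All.tabulate (λ m → All.lookup x∉ (weaken m)) ∷ Unique-dropMiddle u h
  where
  weaken : ∀ {y} → y ∈ˡ u ++ v → y ∈ˡ u ++ a ∷ v
  weaken m = [ Mem.∈-++⁺ˡ , Mem.∈-++⁺ʳ u ∘ there ]′ (Mem.∈-++⁻ u m)

-- Stability: one point serves almost all (k-1)-sets

module Star (F : Family n) where

  Star : List (Fin n) → Fin n → Set
  Star p x = Unique (x ∷ p) × fromList (x ∷ p) ∈ˡ F

  star? : ∀ p x → Dec (Star p x)
  star? p x = uniqueTuple? (x ∷ p) ×-dec DecMem._∈?_ _≟ₛ_ (fromList (x ∷ p)) F

-- The first summand is for tuples with a repeated point, the second for tuples spanning an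
-- uncoloured set. In the latter, `(2 + j) * (t * t)` is the loss in cleaning, `c` the assumed
-- deficiency, `suc t` the factor of `uncoloured≤`, and the power counts the tuples over one set.
stabilityConst : (j c : ℕ) → ℕ
stabilityConst j c = suc j * suc j + ((2 + j) * (t * t) + c) * suc t * suc j ^ suc j
  where t = 2 * (2 + j)

module _ (j : ℕ) (2≤j : 2 ≤ j) (F : Family n) (unif : Uniform (2 + j) F) (uniq : Unique F)
         (cf : ClusterFree 4 (2 + j) F) {c₀ : ℕ} (large : n C suc j ≤ length F + n ^ j * c₀) where

  private
    open Shadow j 2≤j F unif uniq cf (Cleaning.clean (2 * (2 + j)) F)

    Col : List (Fin n) → Fin n → Set
    Col p y = Unique (y ∷ p) × fromList (y ∷ p) ∈ˡ G × Center (fromList (y ∷ p)) y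

    col? : ∀ p y → Dec (Col p y)
    col? p y = uniqueTuple? (y ∷ p) ×-dec DecMem._∈?_ _≟ₛ_ (fromList (y ∷ p)) G ×-dec center? (fromList (y ∷ p)) y

    line : ∀ u {a b} v {y y′} → length (u ++ a ∷ v) ≡ suc j → Col (u ++ a ∷ v) y → Col (u ++ b ∷ v) y′ → y ≡ y′
    line u {a} {b} v {y} {y′} len (y∉ ∷ up , E∈ , ctr) (y′∉ ∷ _ , E′∈ , ctr′) =
      sameCenter {Q = fromList (u ++ v)} E∈ E′∈ ctr ctr′ (inside a) (inside b) (notIn y∉) (notIn y′∉)
        (cong (2 +_) (trans (∣fromList∣ (Unique-dropMiddle u up))
          (suc-injective (trans (sym (List.length-++-sucʳ u a v)) len))))
      where
      weaken : ∀ {a x} → x ∈ˡ u ++ v → x ∈ˡ u ++ a ∷ v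
      weaken m = [ Mem.∈-++⁺ˡ , Mem.∈-++⁺ʳ u ∘ there ]′ (Mem.∈-++⁻ u m)
      inside : ∀ a {y} → fromList (u ++ v) ⊆ fromList (y ∷ u ++ a ∷ v)
      inside a {y} x∈ = ∈-fromList⁺ (y ∷ u ++ a ∷ v) (there (weaken (∈-fromList⁻ (u ++ v) x∈)))
      notIn : ∀ {a y} → All (y ≢_) (u ++ a ∷ v) → y ∉ fromList (u ++ v)
      notIn y∉ y∈ = All.lookup y∉ (weaken (∈-fromList⁻ (u ++ v) y∈)) refl

    uncolouredK : Family n
    uncolouredK = filter (¬? ∘ coloured?) K

    fromUncoloured? : Decidable (λ p → fromList p ∈ˡ uncolouredK)
    fromUncoloured? = spans? uncolouredK

    uncolouredTuples : count fromUncoloured? (tuples (allFin n) (suc j)) ≤ length uncolouredK * suc j ^ suc j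
    uncolouredTuples = spanning≤ (suc j) uncolouredK λ T∈ →
      proj₂ (∈-ksubsets⁻ ⊤ (suc j) (proj₁ (Mem.∈-filter⁻ (¬? ∘ coloured?) {xs = K} T∈)))

    missing⇒ : ∀ {p} → p ∈ˡ tuples (allFin n) (suc j) → ¬ ∃ (Col p) → ¬ Unique p ⊎ fromList p ∈ˡ uncolouredK
    missing⇒ {p} p∈ none = go (uniqueTuple? p)
      where
      go : Dec (Unique p) → ¬ Unique p ⊎ fromList p ∈ˡ uncolouredK
      go (no nu) = inj₁ nu
      go (yes u) = inj₂ (Mem.∈-filter⁺ (¬? ∘ coloured?)
          (∈-ksubsets Subset.⊆⊤ (trans (∣fromList∣ u) (∈-tuples⇒length (allFin n) (suc j) p∈)))
          λ a → let E , E∈ , y , ctr , eq = find a in none (y , colour E∈ ctr eq))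
        where
        colour : ∀ {E y} → E ∈ˡ G → Center E y → fromList p ≡ E - y → Col p y
        colour {E} {y} E∈ ctr eq = All.tabulate (λ { m refl → y∉ m }) ∷ u , subst (_∈ˡ G) E≡ E∈ ,
          subst (λ S → Center S y) E≡ ctr
          where
          y∉ : y ∉ˡ p
          y∉ m = proj₂ (x∈p-y⁻ E y (subst (y ∈_) eq (∈-fromList⁺ p m))) refl
          E≡ : E ≡ fromList (y ∷ p)
          E≡ = Subset.⊆-antisym
            (λ {x} x∈ → case x Fin.≟ y of λ
              { (yes refl) → ∈-fromList⁺ (y ∷ p) (here refl)
              ; (no ne) → ∈-fromList⁺ (y ∷ p) (there (∈-fromList⁻ p (subst (x ∈_) (sym eq) (x∈p-y⁺ x∈ ne)))) })
            (λ {x} x∈ → case ∈-fromList⁻ (y ∷ p) x∈ of λ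
              { (here refl) → proj₁ ctr
              ; (there m) → -⊆ E y (subst (x ∈_) eq (∈-fromList⁺ p m)) })

    c₁ : ℕ
    c₁ = (2 + j) * (t * t)

    large′ : length K ≤ length G + n ^ j * (c₁ + c₀)
    large′ = begin
      length K                               ≡⟨ length-K ⟩
      n C suc j                              ≤⟨ large ⟩
      length F + n ^ j * c₀                  ≤⟨ +-monoˡ-≤ (n ^ j * c₀) (Cleaning.removed≤ t F X small uniq unif) ⟩
      length G + n ^ j * c₁ + n ^ j * c₀     ≡⟨ trans (+-assoc (length G) _ _)
        (cong (length G +_) (sym (*-distribˡ-+ (n ^ j) c₁ c₀))) ⟩
      length G + n ^ j * (c₁ + c₀)           ∎
      where
      open ≤-Reasoning
      open Cleaning.Cleaned (Cleaning.clean (2 * (2 + j)) F)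
      open Cleaning.Valid valid

    fewMissing : n * count (λ p → ¬? (Finₚ.any? (col? p)))
      (tuples (allFin n) (suc j)) ≤ stabilityConst j c₀ * n ^ suc j
    fewMissing = begin
      n * count (λ p → ¬? (Finₚ.any? (col? p))) (tuples (allFin n) (suc j))
        ≤⟨ *-monoʳ-≤ n (count-cover (λ p → ¬? (Finₚ.any? (col? p))) (¬? ∘ uniqueTuple?) fromUncoloured?
          (tuples (allFin n) (suc j)) missing⇒) ⟩
      n * (count (¬? ∘ uniqueTuple?) (tuples (allFin n) (suc j)) + count fromUncoloured? (tuples (allFin n) (suc j)))
        ≡⟨ *-distribˡ-+ n _ _ ⟩
      n * count (¬? ∘ uniqueTuple?) (tuples (allFin n) (suc j)) + n * count fromUncoloured?
        (tuples (allFin n) (suc j))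
        ≤⟨ +-mono-≤ (repeating≤ n (suc j)) (*-monoʳ-≤ n
          (≤-trans uncolouredTuples (*-monoˡ-≤ (suc j ^ suc j) (uncoloured≤ large′)))) ⟩
      suc j * suc j * n ^ suc j + n * (n ^ j * (c₁ + c₀) * suc t * suc j ^ suc j)
        ≡⟨ collect (suc j * suc j) n (n ^ j) (c₁ + c₀) (suc t) (suc j ^ suc j) ⟩
      stabilityConst j c₀ * n ^ suc j ∎
      where
      open ≤-Reasoning
      collect : ∀ a n m b c d → a * (n * m) + n * (m * b * c * d) ≡ (a + b * c * d) * (n * m)
      collect = solve-∀

    stable : stabilityConst j c₀ < n → ∃ λ x →
             n * count (λ p → ¬? (Star.star? F p x)) (tuples (allFin n) (suc j)) ≤ suc j * stabilityConst j c₀ * n ^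
               suc j
    stable c<n = let x , le = monochromatic (suc j) col? c<n line fewMissing in
      x , ≤-trans (*-monoʳ-≤ n (count-mono (λ p → ¬? (Star.star? F p x)) (λ p → ¬? (col? p x))
        (tuples (allFin n) (suc j)) (λ _ ns (u , E∈ , _) → ns (u , G⊆F E∈)))) le

  stableCenter : suc j * stabilityConst j c₀ < n → ∃ λ x →
                 n * count (λ p → ¬? (Star.star? F p x)) (tuples (allFin n) (suc j)) ≤ suc j * stabilityConst j c₀ * n
                   ^ suc j
  stableCenter lt = stable (≤-<-trans (m≤m+n _ _) lt)

-- The constant depends neither on n nor on `F`, so the threshold for n can be fixed before the
-- family is given.
StabilityBound : (j c₀ c : ℕ) → Set
StabilityBound j c₀ c = ∀ {n} (F : Family n) → Uniform (2 + j) F → Unique F → ClusterFree 4 (2 + j) F →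
  n C suc j ≤ length F + n ^ j * c₀ → c < n →
  ∃ λ x → n * count (λ p → ¬? (Star.star? F p x)) (tuples (allFin n) (suc j)) ≤ c * n ^ suc j

abstract
  stability : ∀ j c₀ → 2 ≤ j → ∃ (StabilityBound j c₀)
  stability j c₀ 2≤j = suc j * stabilityConst j c₀ , λ F unif uniq cf large → stableCenter j 2≤j F unif uniq cf large

-- Members that avoid the center

module AvoidingCenter (i : ℕ) (F : Family n) (unif : Uniform (3 + i) F) (uniq : Unique F)
                      (cf : ClusterFree 4 (3 + i) F) (x : Fin n) {c : ℕ}
                      (few : n * count (λ p → ¬? (Star.star? F p x)) (tuples (allFin n) (2 + i)) ≤ c * n ^ (2 + i))
                      (large : 8 * ((2 + i) * (2 + i) + (1 + i) * (3 + i)) ≤ n) where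

  open Star F

  private
    k : ℕ
    k = 3 + i

    0<n : 0 < n
    0<n = ≤-trans (s≤s z≤n) large

    instance
      n≢0 = >-nonZero 0<n

    m : Fin n → ℕ
    m a = count (λ q → ¬? (star? (a ∷ q) x)) (tuples (allFin n) (1 + i))

    ∑m : ∑ (allFin n) m ≤ c * n ^ (1 + i)
    ∑m = *-cancelˡ-≤ n (begin
      n * ∑ (allFin n) m                                         ≡⟨ cong (n *_)
        (count-tuples (λ p → ¬? (star? p x)) (1 + i)) ⟨
      n * count (λ p → ¬? (star? p x)) (tuples (allFin n) (2 + i)) ≤⟨ few ⟩
      c * (n * n ^ (1 + i))                                      ≡⟨ *-swap c n (n ^ (1 + i)) ⟩
      n * (c * n ^ (1 + i))                                      ∎)
      where
      open ≤-Reasoning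
      *-swap : ∀ a b c → a * (b * c) ≡ b * (a * c)
      *-swap = solve-∀

    -- The factor 8 leaves room for four events of proportion at most 1/8: three failures of
    -- membership involving good points, and the joint event of a repeated point or contact with
    -- `E`. Half of the tuples then still lead to the cluster.
    Good : Fin n → Set
    Good a = 8 * m a ≤ n ^ (1 + i)

    good? : Decidable Good
    good? a = 8 * m a ≤? n ^ (1 + i)

    bads : List (Fin n)
    bads = filter (¬? ∘ good?) (allFin n)

    -- Markov's inequality for `m`, whose average over all points is at most c n^i.
    length-bads : length bads ≤ 8 * c
    length-bads = *-cancelʳ-≤ (length bads) (8 * c) (n ^ (1 + i)) {{m^n≢0 n (1 + i)}} (begin
      length bads * n ^ (1 + i)                    ≡⟨ ∑-const (n ^ (1 + i)) bads ⟨
      ∑ bads (λ _ → n ^ (1 + i))                   ≤⟨ ∑-mono bads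
        (λ b∈ → <⇒≤ (≰⇒> (proj₂ (Mem.∈-filter⁻ (¬? ∘ good?) {xs = allFin n} b∈)))) ⟩
      ∑ bads (λ a → 8 * m a)                       ≡⟨ ∑-*ˡ 8 m bads ⟩
      8 * ∑ bads m                                 ≤⟨ *-monoʳ-≤ 8 (∑-filter (¬? ∘ good?) m (allFin n)) ⟩
      8 * ∑ (allFin n) m                           ≤⟨ *-monoʳ-≤ 8 ∑m ⟩
      8 * (c * n ^ (1 + i))                        ≡⟨ *-assoc 8 c (n ^ (1 + i)) ⟨
      8 * c * n ^ (1 + i)                          ∎)
      where open ≤-Reasoning

    -- The cluster E, x a₁ r q, x a₂ r q, x a₁ r′ q.
    starCluster : ∀ {E a₁ a₂ r r′ q} → E ∈ˡ F → x ∉ E → a₁ ∈ E → a₂ ∈ E → a₁ ≢ a₂ → length q ≡ i →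
                  Star (a₁ ∷ r ∷ q) x → Star (a₂ ∷ r ∷ q) x → Star (a₁ ∷ r′ ∷ q) x →
                  r ≢ r′ → (∀ {y} → y ∈ˡ r ∷ q → y ∉ E) → False
    starCluster {E} {a₁} {a₂} {r} {r′} {q} E∈ x∉ a₁∈ a₂∈ a₁≢a₂ len
      ((x∉₁ ∷ a₁∉ ∷ r∉q ∷ _) , S₁∈) (_ , S₂∈) (_ , S₃∈) r≢r′ avoid =
      no4Cluster unif cf W E∈ S₁∈ S₂∈ S₃∈
        (λ eq → x∉ (subst (x ∈_) (sym eq) (∈-fromList⁺ s₁ (here refl))))
        (λ eq → x∉ (subst (x ∈_) (sym eq) (∈-fromList⁺ s₂ (here refl))))
        (λ eq → x∉ (subst (x ∈_) (sym eq) (∈-fromList⁺ s₃ (here refl))))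
        (λ eq → a₁∉S₂ (subst (a₁ ∈_) eq (∈-fromList⁺ s₁ (there (here refl)))))
        (λ eq → r∉S₃ (subst (r ∈_) eq (∈-fromList⁺ s₁ (there (there (here refl))))))
        (λ eq → a₁∉S₂ (subst (a₁ ∈_) (sym eq) (∈-fromList⁺ s₃ (there (here refl)))))
        ∈-∪ʳ
        (λ y∈ → sub₁ (∈-fromList⁻ s₁ y∈)) (λ y∈ → sub₂ (∈-fromList⁻ s₂ y∈)) (λ y∈ → sub₃ (∈-fromList⁻ s₃ y∈))
        ∣W∣ λ y∈E y∈S₁ y∈S₂ _ → common y∈E (∈-fromList⁻ s₁ y∈S₁) y∈S₂
      where
      s₁ s₂ s₃ w : List (Fin n)
      s₁ = x ∷ a₁ ∷ r ∷ q
      s₂ = x ∷ a₂ ∷ r ∷ q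
      s₃ = x ∷ a₁ ∷ r′ ∷ q
      w = x ∷ r ∷ r′ ∷ q
      W : Subset n
      W = fromList w ∪ E
      a₁∉S₂ : a₁ ∉ fromList s₂
      a₁∉S₂ h with ∈-fromList⁻ s₂ h
      ... | here refl = x∉ a₁∈
      ... | there (here eq) = a₁≢a₂ eq
      ... | there (there m) = All.lookup a₁∉ m refl
      r∉S₃ : r ∉ fromList s₃
      r∉S₃ h with ∈-fromList⁻ s₃ h
      ... | here eq = All.lookup x∉₁ (there (here refl)) (sym eq)
      ... | there (here eq) = All.lookup a₁∉ (here refl) (sym eq)
      ... | there (there (here eq)) = r≢r′ eq
      ... | there (there (there m)) = All.lookup r∉q m refl
      inW : ∀ {y} → y ∈ˡ w → y ∈ W
      inW h = ∈-∪ˡ (∈-fromList⁺ w h)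
      sub₁ : ∀ {y} → y ∈ˡ s₁ → y ∈ W
      sub₁ (here eq) = inW (here eq)
      sub₁ (there (here refl)) = ∈-∪ʳ {p = fromList w} a₁∈
      sub₁ (there (there (here eq))) = inW (there (here eq))
      sub₁ (there (there (there h))) = inW (there (there (there h)))
      sub₂ : ∀ {y} → y ∈ˡ s₂ → y ∈ W
      sub₂ (here eq) = inW (here eq)
      sub₂ (there (here refl)) = ∈-∪ʳ {p = fromList w} a₂∈
      sub₂ (there (there (here eq))) = inW (there (here eq))
      sub₂ (there (there (there h))) = inW (there (there (there h)))
      sub₃ : ∀ {y} → y ∈ˡ s₃ → y ∈ W
      sub₃ (here eq) = inW (here eq)
      sub₃ (there (here refl)) = ∈-∪ʳ {p = fromList w} a₁∈
      sub₃ (there (there h)) = inW (there (there h))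
      common : ∀ {y} → y ∈ E → y ∈ˡ s₁ → y ∈ fromList s₂ → False
      common y∈E (here refl) _ = x∉ y∈E
      common y∈E (there (here refl)) h = a₁∉S₂ h
      common y∈E (there (there h)) _ = avoid h y∈E
      ∣W∣ : ∣ W ∣ ≤ 2 * k
      ∣W∣ = begin
        ∣ W ∣                  ≤⟨ ∣∪∣≤ (fromList w) E ⟩
        ∣ fromList w ∣ + ∣ E ∣ ≤⟨ +-mono-≤ (∣fromList∣≤ w) (≤-reflexive (All.lookup unif E∈)) ⟩
        3 + length q + k       ≡⟨ cong (λ l → 3 + l + k) len ⟩
        k + k                  ≡⟨ cong (k +_) (sym (+-identityʳ k)) ⟩
        2 * k                  ∎
        where open ≤-Reasoning

    module _ {E a₁ a₂} (E∈ : E ∈ˡ F) (x∉ : x ∉ E) (a₁∈ : a₁ ∈ E) (a₂∈ : a₂ ∈ E) (a₁≢a₂ : a₁ ≢ a₂)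
             (g₁ : Good a₁) (g₂ : Good a₂) where

      -- The choices of r′ ∷ r ∷ q that do not lead to the cluster above.
      ev₁? : Decidable (λ s → ¬ Star (a₁ ∷ drop 1 s) x)
      ev₁? s = ¬? (star? (a₁ ∷ drop 1 s) x)

      ev₂? : Decidable (λ s → ¬ Star (a₂ ∷ drop 1 s) x)
      ev₂? s = ¬? (star? (a₂ ∷ drop 1 s) x)

      ev₃? : Decidable (λ s → ¬ Star (a₁ ∷ take 1 s ++ drop 2 s) x)
      ev₃? s = ¬? (star? (a₁ ∷ take 1 s ++ drop 2 s) x)

      ev₅? : Decidable (λ s → Any (_∈ E) (drop 1 s))
      ev₅? s = Any.any? (_∈? E) (drop 1 s)

      ev₄₅? : Decidable (λ s → ¬ Unique s ⊎ Any (_∈ E) (drop 1 s))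
      ev₄₅? s = ¬? (uniqueTuple? s) ⊎-dec ev₅? s

      ev₃₋₅? = λ s → ev₃? s ⊎-dec ev₄₅? s
      ev₂₋₅? = λ s → ev₂? s ⊎-dec ev₃₋₅? s
      ev? = λ s → ev₁? s ⊎-dec ev₂₋₅? s

      ts : List (List (Fin n))
      ts = tuples (allFin n) (2 + i)

      count-drop : ∀ {P : List (Fin n) → Set} (P? : Decidable P) →
                   count (λ s → P? (drop 1 s)) ts ≡ n * count P? (tuples (allFin n) (1 + i))
      count-drop P? = trans (count-tuples (λ s → P? (drop 1 s)) (1 + i)) (∑-allFin-const n _)

      count₃ : count ev₃? ts ≡ n * m a₁
      count₃ = trans (count-tuples ev₃? (1 + i)) (trans
        (∑-cong (allFin n) (λ r′ → trans (count-tuples (λ p → ev₃? (r′ ∷ p)) i) (∑-allFin-const n _)))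
        (trans (∑-*ˡ n (λ r′ → count (λ q → ¬? (star? (a₁ ∷ r′ ∷ q) x)) (tuples (allFin n) i)) (allFin n))
               (cong (n *_) (sym (count-tuples (λ q → ¬? (star? (a₁ ∷ q) x)) i)))))

      count₄ : count (¬? ∘ uniqueTuple?) ts ≤ (2 + i) * (2 + i) * n ^ (1 + i)
      count₄ = *-cancelˡ-≤ n (≤-trans (repeating≤ n (2 + i))
        (≤-reflexive (*-swap ((2 + i) * (2 + i)) n (n ^ (1 + i)))))
        where
        *-swap : ∀ a b c → a * (b * c) ≡ b * (a * c)
        *-swap = solve-∀

      count₅ : count ev₅? ts ≤ (1 + i) * k * n ^ (1 + i)
      count₅ = ≤-trans (≤-reflexive (count-drop (Any.any? (_∈? E))))
        (≤-trans (meeting≤ E (1 + i)) (≤-reflexive (cong (λ l → (1 + i) * l * n ^ (1 + i)) (All.lookup unif E∈))))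

      count-ev : 8 * count ev? ts ≤ 4 * n ^ (2 + i)
      count-ev = begin
        8 * count ev? ts
          ≤⟨ *-monoʳ-≤ 8 (≤-trans (count-cover ev? ev₁? ev₂₋₅? ts (λ _ → id))
               (+-mono-≤ (≤-reflexive (count-drop (λ q → ¬? (star? (a₁ ∷ q) x))))
                 (≤-trans (count-cover ev₂₋₅? ev₂? ev₃₋₅? ts (λ _ → id))
               (+-mono-≤ (≤-reflexive (count-drop (λ q → ¬? (star? (a₂ ∷ q) x))))
                 (≤-trans (count-cover ev₃₋₅? ev₃? ev₄₅? ts (λ _ → id))
               (+-mono-≤ (≤-reflexive count₃) (≤-trans (count-cover ev₄₅? (¬? ∘ uniqueTuple?) ev₅? ts (λ _ → id))
               (+-mono-≤ count₄ count₅)))))))) ⟩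
        8 * (n * m a₁ + (n * m a₂ + (n * m a₁ + (c₄ * n ^ (1 + i) + c₅ * n ^ (1 + i)))))
          ≡⟨ collect n (m a₁) (m a₂) c₄ c₅ (n ^ (1 + i)) ⟩
        n * (8 * m a₁) + (n * (8 * m a₂) + (n * (8 * m a₁) + 8 * (c₄ + c₅) * n ^ (1 + i)))
          ≤⟨ +-mono-≤ (*-monoʳ-≤ n g₁) (+-mono-≤ (*-monoʳ-≤ n g₂)
            (+-mono-≤ (*-monoʳ-≤ n g₁) (*-monoˡ-≤ (n ^ (1 + i)) large))) ⟩
        n * n ^ (1 + i) + (n * n ^ (1 + i) + (n * n ^ (1 + i) + n * n ^ (1 + i)))
          ≡⟨ cong (λ z → u + (u + (u + z))) (sym (+-identityʳ u)) ⟩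
        4 * n ^ (2 + i) ∎
        where
        open ≤-Reasoning
        u = n * n ^ (1 + i)
        c₄ = (2 + i) * (2 + i)
        c₅ = (1 + i) * k
        collect : ∀ n a b c d m → 8 * (n * a + (n * b + (n * a + (c * m + d * m)))) ≡
                                  n * (8 * a) + (n * (8 * b) + (n * (8 * a) + 8 * (c + d) * m))
        collect = solve-∀

      fewEvents : count ev? ts < length ts
      fewEvents = *-cancelˡ-< 8 _ _ (≤-<-trans count-ev
        (subst (λ l → 4 * n ^ (2 + i) < 8 * l) (sym (length-allFin-tuples {n} (2 + i)))
          (*-monoˡ-< (n ^ (2 + i)) {{m^n≢0 n (2 + i)}} {4} {8} (s≤s (s≤s (s≤s (s≤s (s≤s z≤n))))))))

      twoGoods : False
      twoGoods = let s , s∈ , h = count<⇒∃¬ ev? {xs = ts} fewEvents in finish s (∈-tuples⇒length (allFin n) (2 + i) s∈) h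
        where
        stable : ∀ p → ¬ ¬ Star p x → Star p x
        stable p = decidable-stable (star? p x)
        finish : ∀ s → length s ≡ 2 + i →
                 ¬ ((¬ Star (a₁ ∷ drop 1 s) x) ⊎ (¬ Star (a₂ ∷ drop 1 s) x) ⊎ (¬ Star (a₁ ∷ take 1 s ++ drop 2 s) x) ⊎
                    (¬ Unique s) ⊎ Any (_∈ E) (drop 1 s)) → False
        finish (r′ ∷ r ∷ q) len h = starCluster E∈ x∉ a₁∈ a₂∈ a₁≢a₂ (suc-injective (suc-injective len))
          (stable _ (h ∘ inj₁)) (stable _ (h ∘ inj₂ ∘ inj₁)) (stable _ (h ∘ inj₂ ∘ inj₂ ∘ inj₁))
          (λ eq → h (inj₂ (inj₂ (inj₂ (inj₁ λ { ((r′∉ ∷ _) ∷ _) → r′∉ (sym eq) })))))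
          (λ y∈ y∈E → h (inj₂ (inj₂ (inj₂ (inj₂ (lose y∈ y∈E))))))

    -- Two good points in `E` would give the cluster. So `b` is the only good point of `E`, or
    -- arbitrary if there is none.
    mostlyBad : ∀ {E} → E ∈ˡ F → x ∉ E → ∃ λ b → b ∈ E × (∀ {a} → a ∈ E - b → a ∈ˡ bads)
    mostlyBad {E} E∈ x∉ = go (Finₚ.any? (λ a → (a ∈? E) ×-dec good? a))
      where
      toBads : ∀ {a} → ¬ Good a → a ∈ˡ bads
      toBads {a} ng = Mem.∈-filter⁺ (¬? ∘ good?) (Mem.∈-allFin a) ng
      go : Dec (∃ λ a → a ∈ E × Good a) → ∃ λ b → b ∈ E × (∀ {a} → a ∈ E - b → a ∈ˡ bads)
      go (yes (b , b∈ , g)) = b , b∈ , λ {a} a∈ → let a∈E , a≢b = x∈p-y⁻ E b a∈ in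
        toBads λ g′ → twoGoods E∈ x∉ a∈E b∈ a≢b g′ g
      go (no none) = let b , b∈ = 0<∣∣⇒Nonempty E (subst (0 <_) (sym (All.lookup unif E∈)) (s≤s z≤n)) in
        b , b∈ , λ {a} a∈ → toBads λ g′ → none (a , -⊆ E b a∈ , g′)

    avoid? : Decidable (λ E → x ∉ E)
    avoid? E = ¬? (x ∈? E)

  abstract
    -- A member avoiding `x` is determined by its exceptional point, with n choices, and k - 1
    -- points taken from a set of bad points whose size does not depend on n.
    avoidingCenter≤ : count avoid? F ≤ n * (8 * c) ^ (2 + i)
    avoidingCenter≤ = begin
      count avoid? F  ≤⟨ unique-⊆⇒length≤ (Unique.filter⁺ avoid? uniq) sub ⟩
      length (cartesianProductWith cons (allFin n) (tuples bads (2 + i)))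
        ≡⟨ trans (length-cartesianProductWith cons (allFin n) (tuples bads (2 + i)))
          (cong₂ _*_ (length-allFin n) (length-tuples bads (2 + i))) ⟩
      n * length bads ^ (2 + i) ≤⟨ *-monoʳ-≤ n (^-monoˡ-≤ (2 + i) length-bads) ⟩
      n * (8 * c) ^ (2 + i) ∎
      where
      open ≤-Reasoning
      cons : Fin n → List (Fin n) → Subset n
      cons b p = fromList (b ∷ p)
      sub : filter avoid? F ⊆ˡ cartesianProductWith cons (allFin n) (tuples bads (2 + i))
      sub {E} h =
        let E∈ , x∉ = Mem.∈-filter⁻ avoid? {xs = F} h
            b , b∈ , toBads = mostlyBad E∈ x∉
            len = trans (length-elems (E - b)) (suc-injective (trans (∣p-x∣ b∈) (All.lookup unif E∈)))
        in subst (_∈ˡ cartesianProductWith cons (allFin n) (tuples bads (2 + i))) (E≡ b∈)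
             (Mem.∈-cartesianProductWith⁺ cons (Mem.∈-allFin b)
               (subst (λ l → elems (E - b) ∈ˡ tuples bads l) len (∈-tuples {p = elems (E - b)} (toBads ∘ ∈-elems⁻))))
        where
        E≡ : ∀ {b} → b ∈ E → fromList (b ∷ elems (E - b)) ≡ E
        E≡ {b} b∈ = Subset.⊆-antisym
          (λ m → case ∈-fromList⁻ (b ∷ elems (E - b)) m of λ { (here refl) → b∈ ; (there h) → -⊆ E b (∈-elems⁻ h) })
          (λ {y} y∈ → case y Fin.≟ b of λ
            { (yes refl) → ∈-fromList⁺ (b ∷ elems (E - b)) (here refl)
            ; (no ne) → ∈-fromList⁺ (b ∷ elems (E - b)) (there (∈-elems⁺ (x∈p-y⁺ y∈ ne))) })

-- Members through the center

∈-∪⁻ : ∀ {p q : Subset n} {x} → x ∈ p ∪ q → x ∈ p ⊎ x ∈ q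
∈-∪⁻ {p = p} {q} = Subset.x∈p∪q⁻ p q

remove-missing : ∀ {R T : Subset n} → R ⊆ T → suc ∣ R ∣ ≡ ∣ T ∣ → ∃ λ v → v ∈ T × R ≡ T - v
remove-missing {R = R} {T} s eq = v , v∈T , ⊆∧∣≤∣⇒≡
    (λ {x} x∈ → x∈p-y⁺ (s x∈) λ { refl → x∈p─q⇒x∉q T R v∈ x∈ })
    (≤-reflexive (suc-injective (trans (∣p-x∣ v∈T) (sym eq))))
  where
  ne : Nonempty (T ─ R)
  ne = 0<∣∣⇒Nonempty (T ─ R) (subst (0 <_) (sym
    (+-cancelˡ-≡ ∣ R ∣ _ _ (trans (∣∣+∣─∣ s) (trans (sym eq) (+-comm 1 ∣ R ∣))))) (s≤s z≤n))
  v = proj₁ ne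
  v∈ = proj₂ ne
  v∈T : v ∈ T
  v∈T = Subset.p─q⊆p T R v∈

module Siblings {R R′ : Subset n} {r m} (r∈ : r ∈ R) (∣R∣ : ∣ R ∣ ≡ m) (∣R′∣ : ∣ R′ ∣ ≡ m)
                (s : R - r ⊆ R′) (ne : R′ ≢ R) where

  r∉ : r ∉ R′
  r∉ h = ne (sym (⊆∧∣≤∣⇒≡ R⊆ (≤-reflexive (trans ∣R′∣ (sym ∣R∣)))))
    where
    R⊆ : R ⊆ R′
    R⊆ {x} x∈ with x Fin.≟ r
    ... | yes refl = h
    ... | no x≢r = s (x∈p-y⁺ x∈ x≢r)

  ∣R∪R′∣ : ∣ R ∪ R′ ∣ ≡ suc m
  ∣R∪R′∣ = +-cancelʳ-≡ ∣ R ∩ R′ ∣ _ _ (trans (∣∪∣+∣∩∣ R R′)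
      (trans (cong₂ _+_ ∣R∣ (trans ∣R′∣ (trans (sym ∣R∣) (sym (∣p-x∣ r∈)))))
        (trans (+-suc m _) (cong (λ p → suc m + ∣ p ∣) R-r≡))))
    where
    R-r≡ : R - r ≡ R ∩ R′
    R-r≡ = Subset.⊆-antisym
      (λ x∈ → ∈-∩⁺ (-⊆ R r x∈ , s x∈))
      (λ {x} x∈ → let x∈R , x∈R′ = ∈-∩⁻ R R′ x∈ in
        x∈p-y⁺ x∈R λ { refl → r∉ x∈R′ })

module FinalCount (i : ℕ) (F : Family n) (unif : Uniform (3 + i) F) (uniq : Unique F)
                  (cf : ClusterFree 4 (3 + i) F) (x : Fin n) (U : Subset n) (x∉U : x ∉ U)
                  (covered : ∀ {a} → a ∈ U → ∃ λ A → A ∈ˡ F × a ∈ A × A ⊆ U) where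

  private
    k : ℕ
    k = 3 + i

    Z : Subset n
    Z = ∁ (⁅ x ⁆ ∪ U)

    x∉Z : x ∉ Z
    x∉Z h = Subset.x∈∁p⇒x∉p h (∈-∪ˡ (Subset.x∈⁅x⁆ x))

    Z∌U : ∀ {a} → a ∈ U → a ∉ Z
    Z∌U a∈ h = Subset.x∈∁p⇒x∉p h (∈-∪ʳ a∈)

    ∈Z : ∀ {y} → y ≢ x → y ∉ U → y ∈ Z
    ∈Z ne nu = Subset.x∉p⇒x∈∁p λ h → [ (λ m → ne (Subset.x∈⁅y⁆⇒x≡y x m)) , nu ]′ (∈-∪⁻ h)

    infixr 6 _◂_
    _◂_ : Fin n → Subset n → Subset n
    a ◂ R = ⁅ a ⁆ ∪ R

    ∈-◂ : ∀ {a R} → a ∈ a ◂ R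
    ∈-◂ {a} = ∈-∪ˡ (Subset.x∈⁅x⁆ a)

    ∈-◂⁻ : ∀ {a R y} → y ∈ a ◂ R → y ≡ a ⊎ y ∈ R
    ∈-◂⁻ {a} h = Sum.map₁ (Subset.x∈⁅y⁆⇒x≡y a) (∈-∪⁻ h)

    ◂-remove : ∀ {E a} → a ∈ E → a ◂ (E - a) ≡ E
    ◂-remove {E} {a} a∈ = Subset.⊆-antisym
      (λ h → [ (λ { refl → a∈ }) , -⊆ E a ]′ (∈-◂⁻ h))
      (λ {y} y∈ → case y Fin.≟ a of λ
        { (yes refl) → ∈-◂ ; (no ne) → ∈-∪ʳ {p = ⁅ a ⁆} (x∈p-y⁺ y∈ ne) })

    inF? : Decidable (_∈ˡ F)
    inF? E = DecMem._∈?_ _≟ₛ_ E F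

    full? : Decidable (λ T → x ◂ T ∈ˡ F)
    full? T = inF? (x ◂ T)

    Ts present missing : List (Subset n)
    Ts = ksubsets Z (2 + i)
    present = filter full? Ts
    missing = filter (¬? ∘ full?) Ts

    link? : ∀ a → Decidable (λ R → x ◂ a ◂ R ∈ˡ F)
    link? a R = inF? (x ◂ a ◂ R)

    link : Fin n → List (Subset n)
    link a = filter (link? a) (ksubsets Z (1 + i))

    ∈-link⁻ : ∀ {a R} → R ∈ˡ link a → R ⊆ Z × ∣ R ∣ ≡ 1 + i × x ◂ a ◂ R ∈ˡ F
    ∈-link⁻ {a} m = let m′ , h = Mem.∈-filter⁻ (link? a) {xs = ksubsets Z (1 + i)} m
                        s , c = ∈-ksubsets⁻ Z (1 + i) m′ in s , c , h

    link-unique : ∀ a → Unique (link a)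
    link-unique a = Unique.filter⁺ (link? a) (ksubsets-unique Z (1 + i))

    -- The cluster A, x T, x a R, x a R′ with T = R ∪ R′ and a ∈ A ⊆ U.
    unionMissing : ∀ {a R R′ r} → a ∈ U → R ∈ˡ link a → R′ ∈ˡ link a → r ∈ R → R - r ⊆ R′ → R′ ≢ R →
                   R ∪ R′ ∈ˡ missing
    unionMissing {a} {R} {R′} {r} a∈U R∈ R′∈ r∈ s ne with R⊆Z , ∣R∣ , S₂∈ ← ∈-link⁻ R∈ | R′⊆Z , ∣R′∣ ,
      S₃∈ ← ∈-link⁻ R′∈ =
      Mem.∈-filter⁺ (¬? ∘ full?) (∈-ksubsets T⊆Z (Siblings.∣R∪R′∣ r∈ ∣R∣ ∣R′∣ s ne)) noCluster
      where
      T : Subset n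
      T = R ∪ R′
      T⊆Z : T ⊆ Z
      T⊆Z = ∪-least R⊆Z R′⊆Z
      a≢x : a ≢ x
      a≢x refl = x∉U a∈U
      a∉T : a ∉ T
      a∉T h = Z∌U a∈U (T⊆Z h)
      S⊆ : ∀ {R″} → R″ ⊆ Z → x ◂ a ◂ R ≡ x ◂ a ◂ R″ → R ⊆ R″
      S⊆ {R″} s″ eq {y} y∈ with ∈-◂⁻ (subst (y ∈_) eq (∈-∪ʳ {p = ⁅ x ⁆} (∈-∪ʳ {p = ⁅ a ⁆} y∈)))
      ... | inj₁ refl = contradiction (R⊆Z y∈) x∉Z
      ... | inj₂ h with ∈-◂⁻ h
      ...   | inj₁ refl = contradiction (R⊆Z y∈) (Z∌U a∈U)
      ...   | inj₂ h = h
      noCluster : x ◂ T ∉ˡ F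
      noCluster S₁∈ with A , A∈ , a∈A , A⊆U ← covered a∈U =
        no4Cluster unif cf W A∈ S₁∈ S₂∈ S₃∈
          (λ eq → x∉U (A⊆U (subst (x ∈_) (sym eq) ∈-◂)))
          (λ eq → x∉U (A⊆U (subst (x ∈_) (sym eq) ∈-◂)))
          (λ eq → x∉U (A⊆U (subst (x ∈_) (sym eq) ∈-◂)))
          (λ eq → a∉S₁ (subst (a ∈_) (sym eq) (∈-∪ʳ {p = ⁅ x ⁆} ∈-◂)))
          (λ eq → a∉S₁ (subst (a ∈_) (sym eq) (∈-∪ʳ {p = ⁅ x ⁆} ∈-◂)))
          (λ eq → ne (sym (⊆∧∣≤∣⇒≡ (S⊆ R′⊆Z eq) (≤-reflexive (trans ∣R′∣ (sym ∣R∣))))))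
          ∈-∪ˡ (∈-∪ʳ {p = A})
          (sub ∈-∪ˡ) (sub (∈-∪ʳ {p = R}))
          (≤-trans (∣∪∣≤ A (x ◂ T)) (≤-reflexive (trans (cong₂ _+_ (All.lookup unif A∈) (All.lookup unif S₁∈))
            (cong (k +_) (sym (+-identityʳ k))))))
          λ y∈A y∈S₁ _ _ → [ (λ { refl → x∉U (A⊆U y∈A) }) , (λ m → Z∌U (A⊆U y∈A) (T⊆Z m)) ]′ (∈-◂⁻ y∈S₁)
        where
        W : Subset n
        W = A ∪ (x ◂ T)
        a∉S₁ : a ∉ x ◂ T
        a∉S₁ h = [ a≢x , a∉T ]′ (∈-◂⁻ h)
        sub : ∀ {R″} → R″ ⊆ T → x ◂ a ◂ R″ ⊆ W
        sub s″ h = [ (λ { refl → ∈-∪ʳ {p = A} ∈-◂ })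
                   , (λ h′ → [ (λ { refl → ∈-∪ˡ a∈A }) , (λ m → ∈-∪ʳ {p = A} (∈-∪ʳ {p = ⁅ x ⁆} (s″ m))) ]′ (∈-◂⁻ h′))
                     ]′ (∈-◂⁻ h)

    module Link (a : Fin n) (a∈U : a ∈ U) (h : ℕ) where

      above : Subset n → List (Subset n)
      above Q = filter (Q ⊆?_) (link a)

      -- A poor set is charged to a face `R - r` with few extensions in the link; there are at most
      -- n^i faces and `h` extensions of each. A rich set instead produces many missing sets, by its
      -- unions with the other sets above one of its faces.
      poor? : Decidable (λ R → ∃ λ r → r ∈ R × length (above (R - r)) ≤ h)
      poor? R = Finₚ.any? λ r → (r ∈? R) ×-dec (length (above (R - r)) ≤? h)

      poor rich : List (Subset n)
      poor = filter poor? (link a)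
      rich = filter (¬? ∘ poor?) (link a)

      extensions : List (Fin n) → List (Subset n)
      extensions p with length (above (fromList p)) ≤? h
      ... | yes _ = above (fromList p)
      ... | no  _ = []

      length-extensions : ∀ p → length (extensions p) ≤ h
      length-extensions p with length (above (fromList p)) ≤? h
      ... | yes le = le
      ... | no  _  = z≤n

      ∈-extensions : ∀ {p R} → length (above (fromList p)) ≤ h → R ∈ˡ above (fromList p) → R ∈ˡ extensions p
      ∈-extensions {p} le m with length (above (fromList p)) ≤? h
      ... | yes _ = m
      ... | no ¬le = contradiction le ¬le

      poor≤ : length poor ≤ n ^ i * h
      poor≤ = subst (λ l → length poor ≤ l * h) (length-allFin-tuples i)
        (≤-trans (unique-⊆⇒length≤ (Unique.filter⁺ poor? (link-unique a)) sub)
          (length-concatMap-≤ extensions (tuples (allFin n) i) (λ {p} _ → length-extensions p)))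
        where
        sub : poor ⊆ˡ concatMap extensions (tuples (allFin n) i)
        sub {R} m =
          let R∈ , r , r∈ , le = Mem.∈-filter⁻ poor? {xs = link a} m
              _ , ∣R∣ , _ = ∈-link⁻ R∈
              len = trans (length-elems (R - r)) (suc-injective (trans (∣p-x∣ r∈) ∣R∣))
              Q≡ = sym (fromList-elems (R - r))
          in ∈-concatMap extensions (∈-allFin-tuples {p = elems (R - r)} len)
               (∈-extensions {elems (R - r)} (subst (λ Q → length (above Q) ≤ h) Q≡ le)
                 (subst (λ Q → R ∈ˡ above Q) Q≡ (Mem.∈-filter⁺ ((R - r) ⊆?_) R∈ (-⊆ R r))))

      -- More than `h` sets of the link lie above a face of `R`, and one of them is `R`. On the
      -- others the union with `R` is injective: they share `R - r`, omit `r`, and keep their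
      -- remaining point in the union.
      richDegree : ∀ {R} → R ∈ˡ rich → h ≤ count (R ⊆?_) missing
      richDegree {R} m = go (0<∣∣⇒Nonempty R (subst (0 <_) (sym ∣R∣) (s≤s z≤n)))
        where
        R∈ : R ∈ˡ link a
        R∈ = proj₁ (Mem.∈-filter⁻ (¬? ∘ poor?) {xs = link a} m)
        ∣R∣ : ∣ R ∣ ≡ 1 + i
        ∣R∣ = proj₁ (proj₂ (∈-link⁻ R∈))
        other? : Decidable (_≢ R)
        other? R′ = ¬? (R′ ≟ₛ R)
        go : Nonempty R → h ≤ count (R ⊆?_) missing
        go (r , r∈) = ≤-trans (s≤s⁻¹ (begin
            suc h                                          ≤⟨ ≰⇒>
              (λ le → proj₂ (Mem.∈-filter⁻ (¬? ∘ poor?) {xs = link a} m) (r , r∈ , le)) ⟩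
            length (above (R - r))                         ≡⟨ count+count¬ (_≟ₛ R) (above (R - r)) ⟩
            count (_≟ₛ R) (above (R - r)) + length others  ≤⟨ +-monoˡ-≤ (length others)
              (unique-⊆⇒length≤ {ys = R ∷ []}
                (Unique.filter⁺ (_≟ₛ R) (Unique.filter⁺ ((R - r) ⊆?_) (link-unique a)))
                (λ q → here (proj₂ (Mem.∈-filter⁻ (_≟ₛ R) {xs = above (R - r)} q)))) ⟩
            suc (length others)                            ∎))
          (matching-length≤ {R = λ R′ T → T ≡ R ∪ R′}
            (Unique.filter⁺ other? (Unique.filter⁺ ((R - r) ⊆?_) (link-unique a)))
            (λ {R′} q → let R′∈ , s , ne = other q in
              R ∪ R′ , Mem.∈-filter⁺ (R ⊆?_) (unionMissing a∈U R∈ R′∈ r∈ s ne) ∈-∪ˡ , refl)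
            (λ { {R′} {R″} q q′ refl eq → injective q q′ eq }))
          where
          open ≤-Reasoning
          others : List (Subset n)
          others = filter other? (above (R - r))
          other : ∀ {R′} → R′ ∈ˡ others → R′ ∈ˡ link a × R - r ⊆ R′ × R′ ≢ R
          other q = let q′ , ne = Mem.∈-filter⁻ other? {xs = above (R - r)} q
                        R′∈ , s = Mem.∈-filter⁻ ((R - r) ⊆?_) {xs = link a} q′ in R′∈ , s , ne
          injective : ∀ {R′ R″} → R′ ∈ˡ others → R″ ∈ˡ others → R ∪ R′ ≡ R ∪ R″ → R′ ≡ R″
          injective {R′} {R″} q q′ eq with R′∈ , s , ne ← other q | R″∈ , s′ , _ ← other q′
            with ∣R′∣ ← proj₁ (proj₂ (∈-link⁻ R′∈)) | ∣R″∣ ← proj₁ (proj₂ (∈-link⁻ R″∈)) =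
            ⊆∧∣≤∣⇒≡ sub (≤-reflexive (trans ∣R″∣ (sym ∣R′∣)))
            where
            sub : R′ ⊆ R″
            sub {y} y∈ with y ∈? R
            ... | yes y∈R = s′ (x∈p-y⁺ y∈R λ { refl → Siblings.r∉ r∈ ∣R∣ ∣R′∣ s ne y∈ })
            ... | no  y∉R with ∈-∪⁻ {p = R} (subst (y ∈_) eq (∈-∪ʳ {p = R} y∈))
            ...   | inj₁ m = contradiction m y∉R
            ...   | inj₂ m = m

      missingDegree : ∀ {T} → T ∈ˡ missing → count (_⊆? T) rich ≤ 2 + i
      missingDegree {T} T∈ = ≤-trans
        (unique-⊆⇒length≤ (Unique.filter⁺ (_⊆? T) (Unique.filter⁺ (¬? ∘ poor?) (link-unique a))) sub)
        (≤-reflexive (trans (List.length-map (T -_) (elems T)) (trans (length-elems T) ∣T∣)))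
        where
        ∣T∣ : ∣ T ∣ ≡ 2 + i
        ∣T∣ = proj₂ (∈-ksubsets⁻ Z (2 + i) (proj₁ (Mem.∈-filter⁻ (¬? ∘ full?) {xs = Ts} T∈)))
        sub : filter (_⊆? T) rich ⊆ˡ map (T -_) (elems T)
        sub {R} m =
          let R∈ , s = Mem.∈-filter⁻ (_⊆? T) {xs = rich} m
              ∣R∣ = proj₁ (proj₂ (∈-link⁻ (proj₁ (Mem.∈-filter⁻ (¬? ∘ poor?) {xs = link a} R∈))))
              v , v∈ , eq = remove-missing {R = R} {T} s (trans (cong suc ∣R∣) (sym ∣T∣))
          in subst (_∈ˡ map (T -_) (elems T)) (sym eq) (Mem.∈-map⁺ (T -_) (∈-elems⁺ v∈))

      rich≤ : length rich * h ≤ length missing * (2 + i)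
      rich≤ = doubleCount _⊆?_ richDegree missingDegree

      link≤ : h * length (link a) ≤ length missing * (2 + i) + h * (n ^ i * h)
      link≤ = begin
        h * length (link a)                    ≡⟨ cong (h *_) (count+count¬ poor? (link a)) ⟩
        h * (length poor + length rich)        ≡⟨ trans (*-distribˡ-+ h _ _) (+-comm (h * length poor) _) ⟩
        h * length rich + h * length poor      ≡⟨ cong (_+ h * length poor) (*-comm h _) ⟩
        length rich * h + h * length poor      ≤⟨ +-mono-≤ rich≤ (*-monoʳ-≤ h poor≤) ⟩
        length missing * (2 + i) + h * (n ^ i * h) ∎
        where open ≤-Reasoning

    -- Summed over `U`, the links are charged to |U| (2 + i) copies of the missing sets, divided by
    -- the threshold. The choice of `h` leaves at most one copy, as many as `through≤` can pay for.
    h : ℕ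
    h = suc ((2 + i) * ∣ U ∣)

    links≤ : ∑ (elems U) (length ∘ link) ≤ length missing + n ^ i * (∣ U ∣ * h)
    links≤ = *-cancelˡ-≤ h (begin
      h * ∑ (elems U) (length ∘ link)           ≡⟨ ∑-*ˡ h (length ∘ link) (elems U) ⟨
      ∑ (elems U) (λ a → h * length (link a))   ≤⟨ ∑-bound (elems U) (λ {a} a∈ → Link.link≤ a (∈-elems⁻ a∈) h) ⟩
      length (elems U) * (length missing * (2 + i) + h * (n ^ i * h)) ≡⟨ cong
        (_* (length missing * (2 + i) + h * (n ^ i * h))) (length-elems U) ⟩
      -- One spare copy of the missing sets raises their coefficient from (2 + i) |U| to exactly
      -- `h`.
      ∣ U ∣ * (length missing * (2 + i) + h * (n ^ i * h))   ≤⟨ m≤m+n _ (length missing) ⟩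
      ∣ U ∣ * (length missing * (2 + i) + h * (n ^ i * h)) + length missing ≡⟨ collect ∣ U ∣ (length missing) i
        (n ^ i) ⟩
      h * (length missing + n ^ i * (∣ U ∣ * h)) ∎)
      where
      open ≤-Reasoning
      collect : ∀ u l i m → u * (l * (2 + i) + suc ((2 + i) * u) * (m * suc ((2 + i) * u))) + l ≡
                            suc ((2 + i) * u) * (l + m * (u * suc ((2 + i) * u)))
      collect = solve-∀

    through? : Decidable (x ∈_)
    through? E = x ∈? E

    through : Family n
    through = filter through? F

    none? : Decidable (λ E → Disjoint E U)
    none? E = ¬? (nonempty? (E ∩ U))

    twice? : Decidable (λ E → ∃₂ λ a b → a ∈ E × b ∈ E × a ≢ b × a ∈ U × b ∈ U)
    twice? E = Finₚ.any? λ a → Finₚ.any? λ b →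
      (a ∈? E) ×-dec (b ∈? E) ×-dec ¬? (a Fin.≟ b) ×-dec (a ∈? U) ×-dec (b ∈? U)

    once? : Decidable (λ E → ∃ λ a → a ∈ E × a ∈ U × Disjoint (E - a) U)
    once? E = Finₚ.any? λ a → (a ∈? E) ×-dec (a ∈? U) ×-dec ¬? (nonempty? ((E - a) ∩ U))

    ∈-through⁻ : ∀ {E} → E ∈ˡ through → E ∈ˡ F × x ∈ E
    ∈-through⁻ = Mem.∈-filter⁻ through? {xs = F}

    through-unique : Unique through
    through-unique = Unique.filter⁺ through? uniq

    none≤ : count none? through ≤ length present
    none≤ = ≤-trans (unique-⊆⇒length≤ (Unique.filter⁺ none? through-unique) sub)
      (≤-reflexive (List.length-map (x ◂_) present))
      where
      sub : filter none? through ⊆ˡ map (x ◂_) present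
      sub {E} m =
        let m′ , d = Mem.∈-filter⁻ none? {xs = through} m
            E∈ , x∈ = ∈-through⁻ m′
        in subst (_∈ˡ map (x ◂_) present) (◂-remove x∈) (Mem.∈-map⁺ (x ◂_) (Mem.∈-filter⁺ full?
             (∈-ksubsets (λ y∈ → let y∈E , y≢x = x∈p-y⁻ E x y∈ in ∈Z y≢x (disjoint⁻ d y∈E))
               (suc-injective (trans (∣p-x∣ x∈) (All.lookup unif E∈))))
             (subst (_∈ˡ F) (sym (◂-remove x∈)) E∈)))

    linkSets : Fin n → List (Subset n)
    linkSets a = map (λ R → x ◂ a ◂ R) (link a)

    once≤ : count once? through ≤ ∑ (elems U) (length ∘ link)
    once≤ = ≤-trans (unique-⊆⇒length≤ (Unique.filter⁺ once? through-unique) sub)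
      (≤-trans (≤-reflexive (length-concatMap linkSets (elems U)))
               (∑-mono (elems U) (λ {a} _ → ≤-reflexive (List.length-map (λ R → x ◂ a ◂ R) (link a)))))
      where
      sub : filter once? through ⊆ˡ concatMap linkSets (elems U)
      sub {E} m =
        let m′ , a , a∈E , a∈U , d = Mem.∈-filter⁻ once? {xs = through} m
            E∈ , x∈ = ∈-through⁻ m′
            a∈E-x = x∈p-y⁺ a∈E (λ eq → x∉U (subst (_∈ U) eq a∈U))
            E≡ = trans (cong (x ◂_) (◂-remove a∈E-x)) (◂-remove x∈)
        in ∈-concatMap linkSets (∈-elems⁺ a∈U) (subst (_∈ˡ linkSets a) E≡
             (Mem.∈-map⁺ (λ R → x ◂ a ◂ R) (Mem.∈-filter⁺ (link? a)
               (∈-ksubsets (inZ d) (suc-injective (suc-injective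
                 (trans (cong suc (∣p-x∣ a∈E-x)) (trans (∣p-x∣ x∈) (All.lookup unif E∈))))))
               (subst (_∈ˡ F) (sym E≡) E∈))))
        where
        inZ : ∀ {a} → Disjoint (E - a) U → (E - x) - a ⊆ Z
        inZ {a} d y∈ = let y∈′ , y≢a = x∈p-y⁻ (E - x) a y∈ ; y∈E , y≢x = x∈p-y⁻ E x y∈′ in
          ∈Z y≢x (disjoint⁻ d (x∈p-y⁺ y∈E y≢a))

    -- Besides `x` and two points of `U`, such a member has k - 3 = i points.
    twice≤ : count twice? through ≤ n ^ i * (∣ U ∣ * ∣ U ∣)
    twice≤ = begin
      count twice? through  ≤⟨ unique-⊆⇒length≤ (Unique.filter⁺ twice? through-unique) sub ⟩
      length (concatMap sets (tuples (allFin n) i)) ≤⟨ length-concatMap-≤ sets (tuples (allFin n) i)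
        (λ {p} _ → ≤-reflexive
          (trans (length-cartesianProductWith (pair p) (elems U) (elems U))
            (cong₂ _*_ (length-elems U) (length-elems U)))) ⟩
      length (tuples (allFin n) i) * (∣ U ∣ * ∣ U ∣) ≡⟨ cong (_* (∣ U ∣ * ∣ U ∣)) (length-allFin-tuples i) ⟩
      n ^ i * (∣ U ∣ * ∣ U ∣) ∎
      where
      open ≤-Reasoning
      pair : List (Fin n) → Fin n → Fin n → Subset n
      pair p a b = x ◂ a ◂ b ◂ fromList p
      sets : List (Fin n) → List (Subset n)
      sets p = cartesianProductWith (pair p) (elems U) (elems U)
      sub : filter twice? through ⊆ˡ concatMap sets (tuples (allFin n) i)
      sub {E} m =
        let m′ , a , b , a∈E , b∈E , a≢b , a∈U , b∈U = Mem.∈-filter⁻ twice? {xs = through} m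
            E∈ , x∈ = ∈-through⁻ m′
            a∈₁ = x∈p-y⁺ a∈E (λ eq → x∉U (subst (_∈ U) eq a∈U))
            b∈₁ = x∈p-y⁺ b∈E (λ eq → x∉U (subst (_∈ U) eq b∈U))
            b∈₂ = x∈p-y⁺ b∈₁ (a≢b ∘ sym)
            rest = ((E - x) - a) - b
            E≡ = trans (cong (λ S → x ◂ a ◂ b ◂ S) (fromList-elems rest))
                   (trans (cong (λ S → x ◂ a ◂ S) (◂-remove b∈₂)) (trans (cong (x ◂_) (◂-remove a∈₁)) (◂-remove x∈)))
            len = trans (length-elems rest) (suc-injective (suc-injective (suc-injective
                    (trans (cong (2 +_) (∣p-x∣ b∈₂)) (trans (cong suc (∣p-x∣ a∈₁))
                      (trans (∣p-x∣ x∈) (All.lookup unif E∈)))))))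
        in ∈-concatMap sets (∈-allFin-tuples {p = elems rest} len)
             (subst (_∈ˡ sets (elems rest)) E≡ (Mem.∈-cartesianProductWith⁺ (pair (elems rest)) (∈-elems⁺ a∈U)
               (∈-elems⁺ b∈U)))

    cases : ∀ {E} → Disjoint E U ⊎ (∃ λ a → a ∈ E × a ∈ U × Disjoint (E - a) U) ⊎
                    (∃₂ λ a b → a ∈ E × b ∈ E × a ≢ b × a ∈ U × b ∈ U)
    cases {E} with nonempty? (E ∩ U)
    ... | no d = inj₁ d
    ... | yes (a , m) with a∈E , a∈U ← ∈-∩⁻ E U m with nonempty? ((E - a) ∩ U)
    ...   | no d = inj₂ (inj₁ (a , a∈E , a∈U , d))
    ...   | yes (b , m′) = let b∈ , b∈U = ∈-∩⁻ (E - a) U m′ ; b∈E , b≢a = x∈p-y⁻ E a b∈ in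
      inj₂ (inj₂ (a , b , a∈E , b∈E , b≢a ∘ sym , a∈U , b∈U))

    every? : Decidable (λ (E : Subset n) → E ≡ E)
    every? E = yes refl

    -- Members disjoint from `U` correspond to present sets, and those meeting it once are bounded
    -- by the missing sets up to O(n^i). Present and missing sets together are all (k-1)-subsets of
    -- `Z`, whence the exact main term.
    through≤ : length through ≤ ∣ Z ∣ C (2 + i) + n ^ i * (∣ U ∣ * h + ∣ U ∣ * ∣ U ∣)
    through≤ = begin
      length through                                      ≡⟨ cong length
        (List.filter-all every? {through} (All.tabulate (λ _ → refl))) ⟨
      count every? through                                ≤⟨ count-cover every? none? once⊎twice? through
        (λ _ _ → cases) ⟩
      count none? through + count once⊎twice? through     ≤⟨ +-mono-≤ none≤
        (≤-trans (count-cover once⊎twice? once? twice? through (λ _ → id))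
                                                               (+-mono-≤ (≤-trans once≤ links≤) twice≤)) ⟩
      length present + (length missing + n ^ i * (∣ U ∣ * h) + n ^ i * (∣ U ∣ * ∣ U ∣))
        ≡⟨ collect (length present) (length missing) (n ^ i) (∣ U ∣ * h) (∣ U ∣ * ∣ U ∣) ⟩
      length present + length missing + n ^ i * (∣ U ∣ * h + ∣ U ∣ * ∣ U ∣)
        ≡⟨ cong (_+ n ^ i * (∣ U ∣ * h + ∣ U ∣ * ∣ U ∣))
          (trans (sym (count+count¬ full? Ts)) (length-ksubsets Z (2 + i))) ⟩
      ∣ Z ∣ C (2 + i) + n ^ i * (∣ U ∣ * h + ∣ U ∣ * ∣ U ∣) ∎
      where
      open ≤-Reasoning
      once⊎twice? : Decidable (λ E → (∃ λ a → a ∈ E × a ∈ U × Disjoint (E - a) U) ⊎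
                                     (∃₂ λ a b → a ∈ E × b ∈ E × a ≢ b × a ∈ U × b ∈ U))
      once⊎twice? E = once? E ⊎-dec twice? E
      collect : ∀ a b m c d → a + (b + m * c + m * d) ≡ a + b + m * (c + d)
      collect = solve-∀

    ∣Z∣ : ∣ Z ∣ ≡ n ∸ suc ∣ U ∣
    ∣Z∣ = trans (Subset.∣∁p∣≡n∸∣p∣ (⁅ x ⁆ ∪ U)) (cong (n ∸_) (trans (∣∪∣-disjoint ⁅ x ⁆ U
      (disjoint⁺ {p = ⁅ x ⁆} λ m → subst (_∉ U) (sym (Subset.x∈⁅y⁆⇒x≡y x m)) x∉U))
        (cong (_+ ∣ U ∣) (Subset.∣⁅x⁆∣≡1 x))))

  abstract
    throughCenter≤ : count (x ∈?_) F ≤ (n ∸ suc ∣ U ∣) C (2 + i) + n ^ i *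
      (∣ U ∣ * suc ((2 + i) * ∣ U ∣) + ∣ U ∣ * ∣ U ∣)
    throughCenter≤ = subst (λ z → length through ≤ z C (2 + i) + n ^ i * (∣ U ∣ * h + ∣ U ∣ * ∣ U ∣)) ∣Z∣ through≤

-- Binomial coefficients against powers

^-distribʳ-* : ∀ j a b → (a * b) ^ j ≡ a ^ j * b ^ j
^-distribʳ-* zero    a b = refl
^-distribʳ-* (suc j) a b = trans (cong (a * b *_) (^-distribʳ-* j a b)) (interchange a b (a ^ j) (b ^ j))
  where
  interchange : ∀ a b c d → a * b * (c * d) ≡ a * c * (b * d)
  interchange = solve-∀

C≤^ : ∀ n j → n C j ≤ n ^ j
C≤^ n j = begin
  n C j                                     ≡⟨ cong (_C j) (Subset.∣⊤∣≡n n) ⟨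
  ∣ ⊤ {n} ∣ C j                             ≡⟨ length-ksubsets (⊤ {n}) j ⟨
  length (ksubsets (⊤ {n}) j)               ≤⟨ unique-⊆⇒length≤ (ksubsets-unique ⊤ j) sub ⟩
  length (map fromList (tuples (allFin n) j)) ≡⟨ List.length-map fromList (tuples (allFin n) j) ⟩
  length (tuples (allFin n) j)              ≡⟨ length-allFin-tuples j ⟩
  n ^ j                                     ∎
  where
  open ≤-Reasoning
  sub : ksubsets (⊤ {n}) j ⊆ˡ map fromList (tuples (allFin n) j)
  sub {S} m = subst (_∈ˡ map fromList (tuples (allFin n) j)) (fromList-elems S)
    (Mem.∈-map⁺ fromList (∈-allFin-tuples {p = elems S} (trans (length-elems S) (proj₂ (∈-ksubsets⁻ ⊤ j m)))))

-- From n ≥ 2 j² on, at most half of the tuples repeat a point, and each j-set is spanned by at most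
-- j^j of the others.
^≤C : ∀ n j → 2 * (j * j) ≤ n → n ^ j ≤ 2 * (j ^ j * (n C j))
^≤C n zero    le = s≤s z≤n
^≤C n j@(suc _) le = *-cancelˡ-≤ n (+-cancelˡ-≤ (n * n ^ j) _ _ (begin
    n * n ^ j + n * n ^ j                          ≡⟨ double n (n ^ j) ⟩
    2 * (n * n ^ j)                                ≡⟨ cong (λ l → 2 * (n * l)) (length-allFin-tuples {n} j) ⟨
    2 * (n * length ts)                            ≡⟨ cong (λ l → 2 * (n * l)) (count+count¬ uniqueTuple? ts) ⟩
    2 * (n * (count uniqueTuple? ts + count (¬? ∘ uniqueTuple?) ts)) ≡⟨ split n (count uniqueTuple? ts) _ ⟩
    2 * (n * count (¬? ∘ uniqueTuple?) ts) + n * (2 * count uniqueTuple? ts)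
      ≤⟨ +-mono-≤ (≤-trans (*-monoʳ-≤ 2 (repeating≤ n j))
        (≤-trans (≤-reflexive (sym (*-assoc 2 (j * j) _))) (*-monoˡ-≤ (n ^ j) le)))
                  (*-monoʳ-≤ n (*-monoʳ-≤ 2 unique≤)) ⟩
    n * n ^ j + n * (2 * (j ^ j * (n C j)))        ∎))
  where
  open ≤-Reasoning
  instance
    n≢0 = >-nonZero {n} (≤-trans (s≤s z≤n) le)
  ts = tuples (allFin n) j
  double : ∀ n m → n * m + n * m ≡ 2 * (n * m)
  double = solve-∀
  split : ∀ n a b → 2 * (n * (a + b)) ≡ 2 * (n * b) + n * (2 * a)
  split = solve-∀
  unique≤ : count uniqueTuple? ts ≤ j ^ j * (n C j)
  unique≤ = begin
    count uniqueTuple? ts             ≤⟨ count-mono uniqueTuple? (spans? (ksubsets ⊤ j)) ts (λ {p} p∈ u →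
                                           ∈-ksubsets Subset.⊆⊤ (trans (∣fromList∣ u)
                                             (∈-tuples⇒length (allFin n) j p∈))) ⟩
    count (spans? (ksubsets ⊤ j)) ts  ≤⟨ spanning≤ {n} j (ksubsets ⊤ j) (λ T∈ → proj₂ (∈-ksubsets⁻ ⊤ j T∈)) ⟩
    length (ksubsets (⊤ {n}) j) * j ^ j ≡⟨ cong (_* j ^ j)
      (trans (length-ksubsets (⊤ {n}) j) (cong (_C j) (Subset.∣⊤∣≡n n))) ⟩
    (n C j) * j ^ j                   ≡⟨ *-comm (n C j) _ ⟩
    j ^ j * (n C j)                   ∎

-- Pascal's rule, applied z times with every lower term bounded by a power.
C-shift : ∀ m z j → (m + z) C suc j ≤ m C suc j + z * (m + z) ^ j
C-shift m zero j rewrite +-identityʳ m | +-identityʳ (m C suc j) = ≤-refl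
C-shift m (suc z) j rewrite +-suc m z = begin
  suc (m + z) C suc j                                  ≡⟨ nCk+nC[k+1]≡[n+1]C[k+1] (m + z) j ⟨
  (m + z) C j + (m + z) C suc j                        ≤⟨ +-mono-≤ (≤-trans (C≤^ (m + z) j) up) (C-shift m z j) ⟩
  suc (m + z) ^ j + (m C suc j + z * (m + z) ^ j)      ≤⟨ +-monoʳ-≤ (suc (m + z) ^ j)
    (+-monoʳ-≤ (m C suc j) (*-monoʳ-≤ z up)) ⟩
  suc (m + z) ^ j + (m C suc j + z * suc (m + z) ^ j)  ≡⟨ +-swap (suc (m + z) ^ j) (m C suc j) _ ⟩
  m C suc j + suc z * suc (m + z) ^ j                  ∎
  where
  open ≤-Reasoning
  up : (m + z) ^ j ≤ suc (m + z) ^ j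
  up = ^-monoˡ-≤ j (n≤1+n (m + z))

-- Maxima and matchings

greatest-holds : {P : ℕ → Set} (P? : Decidable P) → ∀ b → P (greatest P? b) ⊎ greatest P? b ≡ 0
greatest-holds P? zero = inj₂ refl
greatest-holds P? (suc b) with P? (suc b)
... | yes p = inj₁ p
... | no  _ = greatest-holds P? b

∈-⋃⁺ : ∀ {As : Family n} {A x} → A ∈ˡ As → x ∈ A → x ∈ ⋃ As
∈-⋃⁺ (here refl) x∈ = ∈-∪ˡ x∈
∈-⋃⁺ {As = A ∷ _} (there m) x∈ = ∈-∪ʳ {p = A} (∈-⋃⁺ m x∈)

∈-⋃⁻ : ∀ (As : Family n) {x} → x ∈ ⋃ As → ∃ λ A → A ∈ˡ As × x ∈ A
∈-⋃⁻ [] x∈ = contradiction x∈ Subset.∉⊥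
∈-⋃⁻ (A ∷ As) x∈ with ∈-∪⁻ {p = A} x∈
... | inj₁ h = A , here refl , h
... | inj₂ h = let A′ , m , h′ = ∈-⋃⁻ As h in A′ , there m , h′

∣⋃∣-disjoint : ∀ {k} {As : Family n} → Uniform k As → AllPairs Disjoint As → ∣ ⋃ As ∣ ≡ k * length As
∣⋃∣-disjoint {n} {k} [] [] = trans (Subset.∣⊥∣≡0 n) (sym (*-zeroʳ k))
∣⋃∣-disjoint {k = k} {A ∷ As} (c ∷ cs) (d ∷ ds) =
  trans (∣∪∣-disjoint A (⋃ As) (disjoint⁺ λ x∈A x∈⋃ → let A′ , m , x∈A′ = ∈-⋃⁻ As x∈⋃ in
      disjoint⁻ (All.lookup d m) x∈A x∈A′))
    (trans (cong₂ _+_ c (∣⋃∣-disjoint cs ds)) (sym (*-suc k (length As))))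

disjoint-degree≤1 : ∀ {As : Family n} x → AllPairs Disjoint As → count (x ∈?_) As ≤ 1
disjoint-degree≤1 x [] = z≤n
disjoint-degree≤1 {As = A ∷ As} x (d ∷ ds) with x ∈? A
... | yes x∈ = s≤s (≤-reflexive (⇒count≡0 (x ∈?_) {xs = As} (λ m → disjoint⁻ (All.lookup d m) x∈)))
... | no  _  = disjoint-degree≤1 x ds

-- At most one of the disjoint members contains `x`, so at least ν of them remain when it is
-- removed.
matching-avoiding : ∀ {F : Family n} {ν} x → ν + 1 ≤ matchingNumber F →
                    ∃ λ As → length As ≡ ν × As ⊆ˡ F × AllPairs Disjoint As × x ∉ ⋃ As
matching-avoiding {n} {F} {ν} x le = go (greatest-holds (hasSize? (isMatchingIn? F)) (2 ^ n))
  where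
  avoid? : Decidable (λ A → x ∉ A)
  avoid? A = ¬? (x ∈? A)
  go : HasSize (IsMatchingIn F) (matchingNumber F) ⊎ matchingNumber F ≡ 0 → _
  go (inj₂ eq) = contradiction (subst (ν + 1 ≤_) eq le) (λ h → 1+n≰n (≤-trans (m≤n+m 1 ν) (≤-trans h z≤n)))
  go (inj₁ (ℳ , len , u , ℳ⊆F , dis)) =
    take ν ℳ′ , trans (List.length-take ν ℳ′) (m≤n⇒m⊓n≡m ν≤) , (λ {A} → sub {A}) ,
      AllPairs.take⁺ ν (AllPairs.filter⁺ avoid? dis) ,
    λ x∈ → let A , m , x∈A = ∈-⋃⁻ (take ν ℳ′) x∈ in proj₂ (Mem.∈-filter⁻ avoid? {xs = ℳ} (take⊆ m)) x∈A
    where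
    ℳ′ = filter avoid? ℳ
    take⊆ : take ν ℳ′ ⊆ˡ ℳ′
    take⊆ {A} m = subst (A ∈ˡ_) (List.take++drop≡id ν ℳ′) (Mem.∈-++⁺ˡ m)
    sub : take ν ℳ′ ⊆ˡ F
    sub m = ℳ⊆F (proj₁ (Mem.∈-filter⁻ avoid? {xs = ℳ} (take⊆ m)))
    ν≤ : ν ≤ length ℳ′
    ν≤ = +-cancelˡ-≤ 1 _ _ (begin
      1 + ν                               ≡⟨ +-comm 1 ν ⟩
      ν + 1                               ≤⟨ le ⟩
      matchingNumber F                    ≡⟨ len ⟨
      length ℳ                            ≡⟨ count+count¬ (x ∈?_) ℳ ⟩
      count (x ∈?_) ℳ + length ℳ′         ≤⟨ +-monoˡ-≤ (length ℳ′) (disjoint-degree≤1 x dis) ⟩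
      1 + length ℳ′                       ∎)
      where open ≤-Reasoning

-- Assembling the upper bound

module UpperBound (i′ ν c : ℕ) (stab : StabilityBound (2 + i′) (suc ((4 + i′) * ν)) c) where

  -- `b` and `d` are the factors in the bounds for members avoiding and containing the center, with
  -- |U| = k ν. In `c₂` they are multiplied by the price of replacing n^i by C(m,i), and the last
  -- summand secures the required size of the constant. `N` is the sum of the thresholds for
  -- stability, for `AvoidingCenter` and for that replacement.
  i k z b d c₂ N : ℕ
  i = suc i′
  k = 3 + i
  z = suc (k * ν)
  b = (8 * c) ^ (2 + i)
  d = k * ν * suc ((2 + i) * (k * ν)) + k * ν * (k * ν)
  c₂ = (d + b) * (2 ^ i * (2 * i ^ i)) + k * (ν ^ 2 / 4)
  N = suc c + (8 * ((2 + i) * (2 + i) + (1 + i) * (3 + i)) + (z + (z + 2 * (i * i))))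

  z≤N : z ≤ N
  z≤N = ≤-trans (m≤m+n z _) (≤-trans (m≤n+m _ (8 * ((2 + i) * (2 + i) + (1 + i) * (3 + i)))) (m≤n+m _ (suc c)))

  module _ (m : ℕ) (N≤ : N ≤ m + z) where

    private
      n′ : ℕ
      n′ = m + z

      N₁ : c < n′
      N₁ = ≤-trans (m≤m+n _ _) N≤

      N₂ : 8 * ((2 + i) * (2 + i) + (1 + i) * (3 + i)) ≤ n′
      N₂ = ≤-trans (≤-trans (m≤m+n _ _) (m≤n+m _ (suc c))) N≤

      z+2i²≤m : z + 2 * (i * i) ≤ m
      z+2i²≤m = +-cancelʳ-≤ z _ _ (≤-trans (≤-reflexive (+-comm _ z))
        (≤-trans (≤-trans (m≤n+m _ (8 * ((2 + i) * (2 + i) + (1 + i) * (3 + i)))) (m≤n+m _ (suc c))) N≤))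

      power≤ : n′ ^ i ≤ (2 ^ i * (2 * i ^ i)) * (m C i)
      power≤ = begin
        n′ ^ i                             ≤⟨ ^-monoˡ-≤ i
          (≤-trans (+-monoʳ-≤ m (≤-trans (m≤m+n z _) z+2i²≤m)) (≤-reflexive (cong (m +_) (sym (+-identityʳ m))))) ⟩
        (2 * m) ^ i                        ≡⟨ ^-distribʳ-* i 2 m ⟩
        2 ^ i * m ^ i                      ≤⟨ *-monoʳ-≤ (2 ^ i) (^≤C m i (≤-trans (m≤n+m _ z) z+2i²≤m)) ⟩
        2 ^ i * (2 * (i ^ i * (m C i)))    ≡⟨ regroup (2 ^ i) (i ^ i) (m C i) ⟩
        (2 ^ i * (2 * i ^ i)) * (m C i)    ∎
        where
        open ≤-Reasoning
        regroup : ∀ a b c → a * (2 * (b * c)) ≡ a * (2 * b) * c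
        regroup = solve-∀

    bound : ∀ (F : Family n′) → Unique F → Admissible k 4 ν F → length F ≤ m C (2 + i) + c₂ * (m C i)
    -- A family no larger than the main term needs no argument. For any other, `C-shift` provides
    -- the deficiency bound that stability asks for, with constant `z`.
    bound F u (unif , cf , match) = [ (λ le → ≤-trans le (m≤m+n _ _)) ,
      (λ ge → withCenter (stab F unif u cf (large ge) N₁)) ]′
                                    (≤-total (length F) (m C (2 + i)))
      where
      open ≤-Reasoning
      large : m C (2 + i) ≤ length F → n′ C (2 + i) ≤ length F + n′ ^ (1 + i) * z
      large ge = ≤-trans (C-shift m z (1 + i)) (+-mono-≤ ge (≤-reflexive (*-comm z _)))
      withMatching : ∀ x → n′ * count (λ p → ¬? (Star.star? F p x)) (tuples (allFin n′) (2 + i)) ≤ c * n′ ^ (2 + i) →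
                     (∃ λ As → length As ≡ ν × As ⊆ˡ F × AllPairs Disjoint As × x ∉ ⋃ As) →
                     length F ≤ m C (2 + i) + c₂ * (m C i)
      withMatching x few (As , len , As⊆F , dis , x∉) = begin
        length F                                            ≡⟨ count+count¬ (x ∈?_) F ⟩
        count (x ∈?_) F + count (λ E → ¬? (x ∈? E)) F       ≤⟨ +-mono-≤ through
          (AvoidingCenter.avoidingCenter≤ i F unif u cf x {c} few N₂) ⟩
        m C (2 + i) + n′ ^ i * d + n′ * b                   ≤⟨ +-monoʳ-≤ (m C (2 + i) + n′ ^ i * d)
          (*-monoˡ-≤ b n′≤) ⟩
        m C (2 + i) + n′ ^ i * d + n′ ^ i * b               ≡⟨ trans (+-assoc (m C (2 + i)) _ _)
          (cong (m C (2 + i) +_) (trans (sym (*-distribˡ-+ (n′ ^ i) d b)) (*-comm (n′ ^ i) (d + b)))) ⟩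
        m C (2 + i) + (d + b) * n′ ^ i                      ≤⟨ +-monoʳ-≤ (m C (2 + i)) (*-monoʳ-≤ (d + b) power≤) ⟩
        m C (2 + i) + (d + b) * ((2 ^ i * (2 * i ^ i)) * (m C i)) ≡⟨ cong (m C (2 + i) +_) (*-assoc (d + b) _ _) ⟨
        m C (2 + i) + (d + b) * (2 ^ i * (2 * i ^ i)) * (m C i) ≤⟨ +-monoʳ-≤ (m C (2 + i))
          (*-monoˡ-≤ (m C i) (m≤m+n ((d + b) * (2 ^ i * (2 * i ^ i))) _)) ⟩
        m C (2 + i) + c₂ * (m C i)                          ∎
        where
        U : Subset n′
        U = ⋃ As
        ∣U∣ : ∣ U ∣ ≡ k * ν
        ∣U∣ = trans (∣⋃∣-disjoint (All.tabulate (All.lookup unif ∘ As⊆F)) dis) (cong (k *_) len)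
        covered : ∀ {a} → a ∈ U → ∃ λ A → A ∈ˡ F × a ∈ A × A ⊆ U
        covered a∈ = let A , A∈ , a∈A = ∈-⋃⁻ As a∈ in A , As⊆F A∈ , a∈A , ∈-⋃⁺ A∈
        through : count (x ∈?_) F ≤ m C (2 + i) + n′ ^ i * d
        through = begin
          count (x ∈?_) F ≤⟨ FinalCount.throughCenter≤ i F unif u cf x U x∉ covered ⟩
          (n′ ∸ suc ∣ U ∣) C (2 + i) + n′ ^ i * (∣ U ∣ * suc ((2 + i) * ∣ U ∣) + ∣ U ∣ * ∣ U ∣)
            ≡⟨ cong (λ u → (n′ ∸ suc u) C (2 + i) + n′ ^ i * (u * suc ((2 + i) * u) + u * u)) ∣U∣ ⟩
          (n′ ∸ z) C (2 + i) + n′ ^ i * d ≡⟨ cong (λ l → l C (2 + i) + n′ ^ i * d) (m+n∸n≡m m z) ⟩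
          m C (2 + i) + n′ ^ i * d ∎
        -- This uses k ≥ 4: since i = k - 3 is positive, the linearly many members avoiding the
        -- center are absorbed by n^i.
        n′≤ : n′ ≤ n′ ^ i
        n′≤ = ≤-trans (≤-reflexive (sym (*-identityʳ n′)))
          (*-monoʳ-≤ n′ (m^n>0 n′ {{>-nonZero (≤-<-trans z≤n N₁)}} i′))
      withCenter : (∃ λ x → n′ * count (λ p → ¬? (Star.star? F p x)) (tuples (allFin n′) (2 + i)) ≤ c * n′ ^
        (2 + i)) →
                   length F ≤ m C (2 + i) + c₂ * (m C i)
      withCenter (x , few) = withMatching x few (matching-avoiding x match)

    f≤ : f n′ k 4 ν ≤ m C (2 + i) + c₂ * (m C i)
    f≤ = [ (λ (F , len , u , adm) → subst (_≤ m C (2 + i) + c₂ * (m C i)) len (bound F u adm))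
         , (λ eq → subst (_≤ m C (2 + i) + c₂ * (m C i)) (sym eq) z≤n) ]′
         (greatest-holds (hasSize? (admissible? {n′} k 4 ν)) (2 ^ n′))

upperBound : ∀ i′ ν → let k = 4 + i′ in ∃₂ λ c₂ N → k * (ν ^ 2 / 4) ≤ c₂ ×
             (∀ n → N ≤ n → f n k 4 ν ≤ (n ∸ k * ν ∸ 1) C (k ∸ 1) + c₂ * ((n ∸ k * ν ∸ 1) C (k ∸ 3)))
upperBound i′ ν = withConstant (stability (2 + i′) (suc ((4 + i′) * ν)) (s≤s (s≤s z≤n)))
  where
  k z : ℕ
  k = 4 + i′
  z = suc (k * ν)
  withConstant : ∃ (StabilityBound (2 + i′) z) → ∃₂ λ c₂ N → k * (ν ^ 2 / 4) ≤ c₂ ×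
    (∀ n → N ≤ n → f n k 4 ν ≤ (n ∸ k * ν ∸ 1) C (3 + i′) + c₂ * ((n ∸ k * ν ∸ 1) C suc i′))
  withConstant (c , stab) = c₂ , N , m≤n+m (k * (ν ^ 2 / 4)) ((d + b) * (2 ^ suc i′ * (2 * suc i′ ^ suc i′))) ,
    bounded
    where
    open UpperBound i′ ν c stab using (c₂; N; z≤N; b; d; f≤)
    bounded : ∀ n → N ≤ n → f n k 4 ν ≤ (n ∸ k * ν ∸ 1) C (3 + i′) + c₂ * ((n ∸ k * ν ∸ 1) C suc i′)
    bounded n le = subst (λ m → f n k 4 ν ≤ m C (3 + i′) + c₂ * (m C suc i′)) m≡
      (subst (λ l → f l k 4 ν ≤ (n ∸ z) C (3 + i′) + c₂ * ((n ∸ z) C suc i′)) n≡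
        (f≤ (n ∸ z) (subst (N ≤_) (sym n≡) le)))
      where
      n≡ : n ∸ z + z ≡ n
      n≡ = m∸n+n≡m (≤-trans z≤N le)
      m≡ : n ∸ z ≡ n ∸ k * ν ∸ 1
      m≡ = trans (cong (n ∸_) (+-comm 1 (k * ν))) (sym (∸-+-assoc n (k * ν) 1))

-- Cluster-freeness of disjoint blocks together with sets through one point

module MatchingPlusStar {n k ν : ℕ} (x : Fin n) (A : Fin ν → Subset n) (0<k : 0 < k)
  (x∉A : ∀ i → x ∉ A i) (∣A∣ : ∀ i → ∣ A i ∣ ≡ k) (A-disjoint : ∀ {i j} → i ≢ j → Disjoint (A i) (A j))
  (F : Family n) (kind : ∀ {S} → S ∈ˡ F → x ∈ S ⊎ ∃ λ i → S ≡ A i)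
  (starCluster-⊥ : ∀ i {S₁ S₂ S₃} W → S₁ ∈ˡ F → S₂ ∈ˡ F → S₃ ∈ˡ F → x ∈ S₁ → x ∈ S₂ → x ∈ S₃ →
                   S₁ ≢ S₂ → S₁ ≢ S₃ → S₂ ≢ S₃ → A i ⊆ W → S₁ ⊆ W → S₂ ⊆ W → S₃ ⊆ W → ∣ W ∣ ≤ 2 * k →
                   (∀ {y} → y ∈ A i → y ∈ S₁ → y ∈ S₂ → y ∈ S₃ → False) → False) where

  -- Two blocks have 2k points already, and any further member has a point outside both: `x`, or a
  -- point of a third block.
  twoBlocks-⊥ : ∀ {i j S} W → A i ≢ A j → S ∈ˡ F → S ≢ A i → S ≢ A j → A i ⊆ W → A j ⊆ W → S ⊆ W →
                ∣ W ∣ ≤ 2 * k → False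
  twoBlocks-⊥ {i} {j} {S} W Ai≢Aj S∈ S≢Ai S≢Aj Ai⊆ Aj⊆ S⊆ ∣W∣ = finish (outside (kind S∈))
    where
    outside : x ∈ S ⊎ (∃ λ l → S ≡ A l) → ∃ λ e → e ∈ S × e ∉ A i × e ∉ A j
    outside (inj₁ x∈) = x , x∈ , x∉A i , x∉A j
    outside (inj₂ (l , S≡)) =
      let e , e∈ = 0<∣∣⇒Nonempty (A l) (subst (0 <_) (sym (∣A∣ l)) 0<k) in
      e , subst (e ∈_) (sym S≡) e∈
        , disjoint⁻ (A-disjoint (λ eq → S≢Ai (trans S≡ (cong A eq)))) e∈
        , disjoint⁻ (A-disjoint (λ eq → S≢Aj (trans S≡ (cong A eq)))) e∈
    finish : (∃ λ e → e ∈ S × e ∉ A i × e ∉ A j) → False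
    finish (e , e∈ , e∉i , e∉j) = 1+n≰n (begin
      suc (2 * k)                     ≡⟨ card ⟨
      ∣ ⁅ e ⁆ ∪ (A i ∪ A j) ∣         ≤⟨ Subset.p⊆q⇒∣p∣≤∣q∣ (∪-least {p = ⁅ e ⁆}
                                           (λ m → subst (_∈ W) (sym (Subset.x∈⁅y⁆⇒x≡y e m)) (S⊆ e∈))
                                             (∪-least Ai⊆ Aj⊆)) ⟩
      ∣ W ∣                           ≤⟨ ∣W∣ ⟩
      2 * k                           ∎)
      where
      open ≤-Reasoning
      card : ∣ ⁅ e ⁆ ∪ (A i ∪ A j) ∣ ≡ suc (2 * k)
      card = trans (∣∪∣-disjoint ⁅ e ⁆ (A i ∪ A j) (disjoint⁺ {p = ⁅ e ⁆} λ m h → [ e∉i , e∉j ]′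
               (∈-∪⁻ {p = A i} (subst (_∈ A i ∪ A j) (Subset.x∈⁅y⁆⇒x≡y e m) h))))
        (cong₂ _+_ (Subset.∣⁅x⁆∣≡1 e) (trans (∣∪∣-disjoint (A i) (A j) (A-disjoint (λ eq → Ai≢Aj (cong A eq))))
          (trans (cong₂ _+_ (∣A∣ i) (∣A∣ j)) (cong (k +_) (sym (+-identityʳ k))))))

  withBlock-⊥ : ∀ {i B S₁ S₂ S₃} W → B ≡ A i → S₁ ∈ˡ F → S₂ ∈ˡ F → S₃ ∈ˡ F →
                B ≢ S₁ → B ≢ S₂ → B ≢ S₃ → S₁ ≢ S₂ → S₁ ≢ S₃ → S₂ ≢ S₃ →
                B ⊆ W → S₁ ⊆ W → S₂ ⊆ W → S₃ ⊆ W → ∣ W ∣ ≤ 2 * k →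
                (∀ {y} → y ∈ B → y ∈ S₁ → y ∈ S₂ → y ∈ S₃ → False) → False
  withBlock-⊥ {i} W refl S₁∈ S₂∈ S₃∈ n₁ n₂ n₃ n₁₂ n₁₃ n₂₃ B⊆ S₁⊆ S₂⊆ S₃⊆ ∣W∣ empty
    with kind S₁∈ | kind S₂∈ | kind S₃∈
  ... | inj₂ (j , refl) | _ | _ = twoBlocks-⊥ W n₁ S₂∈ (n₂ ∘ sym) (n₁₂ ∘ sym) B⊆ S₁⊆ S₂⊆ ∣W∣
  ... | inj₁ _ | inj₂ (j , refl) | _ = twoBlocks-⊥ W n₂ S₁∈ (n₁ ∘ sym) n₁₂ B⊆ S₂⊆ S₁⊆ ∣W∣
  ... | inj₁ _ | inj₁ _ | inj₂ (j , refl) = twoBlocks-⊥ W n₃ S₁∈ (n₁ ∘ sym) n₁₃ B⊆ S₃⊆ S₁⊆ ∣W∣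
  ... | inj₁ x₁ | inj₁ x₂ | inj₁ x₃ =
    starCluster-⊥ i W S₁∈ S₂∈ S₃∈ x₁ x₂ x₃ n₁₂ n₁₃ n₂₃ B⊆ S₁⊆ S₂⊆ S₃⊆ ∣W∣ empty

  -- Four sets through `x` have `x` in common, so one member of a cluster is a block, and then the
  -- other three pass through `x`.
  clusterFree : ClusterFree 4 k F
  clusterFree (P ∷ Q ∷ R ∷ S ∷ [] , (refl , ((pq ∷ pr ∷ ps ∷ []) ∷ (qr ∷ qs ∷ []) ∷ (rs ∷ []) ∷ [] ∷ []) , _ , ∣W∣ ,
    empty) , sub)
    = go (kind P∈) (kind Q∈) (kind R∈) (kind S∈)
    where
    W : Subset n
    W = P ∪ (Q ∪ (R ∪ (S ∪ ⊥)))
    P∈ : P ∈ˡ F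
    P∈ = sub (here refl)
    Q∈ : Q ∈ˡ F
    Q∈ = sub (there (here refl))
    R∈ : R ∈ˡ F
    R∈ = sub (there (there (here refl)))
    S∈ : S ∈ˡ F
    S∈ = sub (there (there (there (here refl))))
    P⊆ : P ⊆ W
    P⊆ = ∈-∪ˡ
    Q⊆ : Q ⊆ W
    Q⊆ = ∈-∪ʳ {p = P} ∘ ∈-∪ˡ
    R⊆ : R ⊆ W
    R⊆ = ∈-∪ʳ {p = P} ∘ ∈-∪ʳ {p = Q} ∘ ∈-∪ˡ
    S⊆ : S ⊆ W
    S⊆ = ∈-∪ʳ {p = P} ∘ ∈-∪ʳ {p = Q} ∘ ∈-∪ʳ {p = R} ∘ ∈-∪ˡ
    common : ∀ {y} → y ∈ P → y ∈ Q → y ∈ R → y ∈ S → False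
    common a b c d = empty (_ , ∈-∩⁺ (a , ∈-∩⁺ (b , ∈-∩⁺ (c , ∈-∩⁺ (d , Subset.∈⊤)))))
    go : x ∈ P ⊎ (∃ λ i → P ≡ A i) → x ∈ Q ⊎ (∃ λ i → Q ≡ A i) → x ∈ R ⊎ (∃ λ i → R ≡ A i) →
         x ∈ S ⊎ (∃ λ i → S ≡ A i) → False
    go (inj₂ (i , eq)) _ _ _ =
      withBlock-⊥ W eq Q∈ R∈ S∈ pq pr ps qr qs rs P⊆ Q⊆ R⊆ S⊆ ∣W∣ common
    go (inj₁ _) (inj₂ (i , eq)) _ _ =
      withBlock-⊥ W eq P∈ R∈ S∈ (pq ∘ sym) qr qs pr ps rs Q⊆ P⊆ R⊆ S⊆ ∣W∣ λ b a c d → common a b c d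
    go (inj₁ _) (inj₁ _) (inj₂ (i , eq)) _ =
      withBlock-⊥ W eq P∈ Q∈ S∈ (pr ∘ sym) (qr ∘ sym) rs pq ps qs R⊆ P⊆ Q⊆ S⊆ ∣W∣ λ c a b d → common a b c d
    go (inj₁ _) (inj₁ _) (inj₁ _) (inj₂ (i , eq)) =
      withBlock-⊥ W eq P∈ Q∈ R∈ (ps ∘ sym) (qs ∘ sym) (rs ∘ sym) pq pr qr S⊆ P⊆ Q⊆ R⊆ ∣W∣ λ d a b c → common a b c d
    go (inj₁ a) (inj₁ b) (inj₁ c) (inj₁ d) = common a b c d

-- Subsets of a disjoint union

∣++∣ : ∀ {a b} (P : Subset a) (R : Subset b) → ∣ P Vec.++ R ∣ ≡ ∣ P ∣ + ∣ R ∣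
∣++∣ []          R = refl
∣++∣ (true ∷ P)  R = cong suc (∣++∣ P R)
∣++∣ (false ∷ P) R = ∣++∣ P R

∈-++ˡ⁺ : ∀ {a b} {P : Subset a} {R : Subset b} {y} → y ∈ P → y Fin.↑ˡ b ∈ P Vec.++ R
∈-++ˡ⁺ here      = here
∈-++ˡ⁺ (there h) = there (∈-++ˡ⁺ h)

∈-++ˡ⁻ : ∀ {a b} (P : Subset a) {R : Subset b} {y} → y Fin.↑ˡ b ∈ P Vec.++ R → y ∈ P
∈-++ˡ⁻ (_ ∷ P) {y = zero}  here      = here
∈-++ˡ⁻ (_ ∷ P) {y = suc y} (there h) = there (∈-++ˡ⁻ P h)

∈-++ʳ⁺ : ∀ {a b} (P : Subset a) {R : Subset b} {y} → y ∈ R → a Fin.↑ʳ y ∈ P Vec.++ R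
∈-++ʳ⁺ []      h = h
∈-++ʳ⁺ (_ ∷ P) h = there (∈-++ʳ⁺ P h)

∈-++ʳ⁻ : ∀ {a b} (P : Subset a) {R : Subset b} {y} → a Fin.↑ʳ y ∈ P Vec.++ R → y ∈ R
∈-++ʳ⁻ []      h         = h
∈-++ʳ⁻ (_ ∷ P) (there h) = ∈-++ʳ⁻ P h

module Apex (a m : ℕ) where

  apex : Fin (a + suc m)
  apex = a Fin.↑ʳ zero

  coned : Subset a → Subset m → Subset (a + suc m)
  coned P R = P Vec.++ true ∷ R

  base : Subset a → Subset (a + suc m)
  base P = P Vec.++ false ∷ ⊥

  apex∈ : ∀ P R → apex ∈ coned P R
  apex∈ P R = ∈-++ʳ⁺ P here

  apex∉ : ∀ P → apex ∉ base P
  apex∉ P h = case ∈-++ʳ⁻ P h of λ ()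

  ∣coned∣ : ∀ P R → ∣ coned P R ∣ ≡ ∣ P ∣ + suc ∣ R ∣
  ∣coned∣ P R = ∣++∣ P (true ∷ R)

  ∣base∣ : ∀ P → ∣ base P ∣ ≡ ∣ P ∣
  ∣base∣ P = trans (∣++∣ P (false ∷ ⊥)) (trans (cong (∣ P ∣ +_) (Subset.∣⊥∣≡0 m)) (+-identityʳ ∣ P ∣))

  base-disjoint : ∀ {P Q} → Disjoint P Q → Disjoint (base P) (base Q)
  base-disjoint {P} {Q} d = disjoint⁺ λ {y} → go (Fin.splitAt a y) (Finₚ.join-splitAt a (suc m) y)
    where
    go : ∀ {y} s → Fin.join a (suc m) s ≡ y → y ∈ base P → y ∉ base Q
    go (inj₁ y) refl h h′ = disjoint⁻ d (∈-++ˡ⁻ P h) (∈-++ˡ⁻ Q h′)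
    go (inj₂ zero) refl h _ = apex∉ P h
    go (inj₂ (suc y)) refl h _ = case ∈-++ʳ⁻ P h of λ { (there m) → Subset.∉⊥ m }

  coned-injective : ∀ {P P′ R R′} → coned P R ≡ coned P′ R′ → P ≡ P′ × R ≡ R′
  coned-injective {P} {P′} eq = Vec.++-injectiveˡ P P′ eq , ∷-injectiveʳ (Vec.++-injectiveʳ P P′ eq)

  coned≢base : ∀ {P Q R} → coned P R ≢ base Q
  coned≢base {P} {Q} {R} eq = apex∉ Q (subst (apex ∈_) eq (apex∈ P R))

  -- As W has at most 2k points, parts X and Y of its traces on either side of the
  -- apex that account for 2k - 1 points are the whole traces.
  record Split (k : ℕ) (W : Subset (a + suc m)) : Set where
    field
      lower     : Subset a
      upper     : Subset m
      coned⊆    : ∀ {P R} → coned P R ⊆ W → P ⊆ lower × R ⊆ upper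
      base⊆     : ∀ {P} → base P ⊆ W → P ⊆ lower
      lower≡    : ∀ {X Y} → X ⊆ lower → Y ⊆ upper → ∣ X ∣ + suc ∣ Y ∣ ≡ 2 * k → X ≡ lower
      upper≡    : ∀ {X Y} → X ⊆ lower → Y ⊆ upper → ∣ X ∣ + suc ∣ Y ∣ ≡ 2 * k → Y ≡ upper

  split : ∀ {k} W → apex ∈ W → ∣ W ∣ ≤ 2 * k → Split k W
  split {k} W ap ∣W∣ with Vec.splitAt a W
  ... | W₁ , false ∷ W₂ , refl = contradiction (∈-++ʳ⁻ W₁ ap) λ ()
  ... | W₁ , true ∷ W₂ , refl = record
    { lower = W₁
    ; upper = W₂
    ; coned⊆ = λ {P} s → (λ y∈ → ∈-++ˡ⁻ W₁ (s (∈-++ˡ⁺ y∈))) ,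
      (λ y∈ → drop-there (∈-++ʳ⁻ W₁ (s (∈-++ʳ⁺ P (there y∈)))))
    ; base⊆ = λ s y∈ → ∈-++ˡ⁻ W₁ (s (∈-++ˡ⁺ y∈))
    ; lower≡ = λ {X} {Y} s s′ eq → ⊆∧∣≤∣⇒≡ s (+-cancelʳ-≤ (suc ∣ Y ∣) _ _
        (≤-trans (+-monoʳ-≤ ∣ W₁ ∣ (s≤s (Subset.p⊆q⇒∣p∣≤∣q∣ s′))) (≤-trans total (≤-reflexive (sym eq)))))
    ; upper≡ = λ {X} {Y} s s′ eq → ⊆∧∣≤∣⇒≡ s′ (s≤s⁻¹ (+-cancelˡ-≤ ∣ X ∣ _ _
        (≤-trans (+-monoˡ-≤ (suc ∣ W₂ ∣) (Subset.p⊆q⇒∣p∣≤∣q∣ s)) (≤-trans total (≤-reflexive (sym eq))))))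
    }
    where
    drop-there : ∀ {y : Fin m} → suc y ∈ true Vec.∷ W₂ → y ∈ W₂
    drop-there (there h) = h
    total : ∣ W₁ ∣ + suc ∣ W₂ ∣ ≤ 2 * k
    total = subst (_≤ 2 * k) (∣++∣ W₁ (true ∷ W₂)) ∣W∣

≤-split : ∀ {a b c d} → a ≤ c → b ≤ d → a + b ≡ c + d → c ≤ a × d ≤ b
≤-split {a} {b} {c} {d} a≤c b≤d eq =
    +-cancelʳ-≤ d c a (≤-trans (≤-reflexive (sym eq)) (+-monoʳ-≤ a b≤d))
  , +-cancelˡ-≤ c d b (≤-trans (≤-reflexive (sym eq)) (+-monoˡ-≤ b a≤c))

-- The members are ν disjoint blocks, the cones over the (k-1)-sets avoiding all
-- blocks, and the cones over two corresponding points of a left and a right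
-- block together with a (k-3)-set avoiding all blocks.
module BlockConstruction (i l r m : ℕ) where

  private
    ν k : ℕ
    ν = l + r
    k = 3 + i

  open Apex (k * ν) m

  side : Fin ν → Bool
  side p = [ (λ _ → false) , (λ _ → true) ]′ (Fin.splitAt l p)

  abstract
    point : Fin ν → Fin k → Fin (k * ν)
    point p t = combine t p

    point-injective : ∀ {p q t u} → point p t ≡ point q u → p ≡ q × t ≡ u
    point-injective {p} {q} {t} {u} eq = let t≡ , p≡ = Finₚ.combine-injective t p u q eq in p≡ , t≡

  block : Fin ν → Subset (k * ν)
  block p = fromList (map (point p) (allFin k))

  point∈block : ∀ p t → point p t ∈ block p
  point∈block p t = ∈-fromList⁺ (map (point p) (allFin k)) (Mem.∈-map⁺ (point p) (Mem.∈-allFin t))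

  ∈block : ∀ {p q t} → point q t ∈ block p → q ≡ p
  ∈block {p} h with _ , _ , eq ← Mem.∈-map⁻ (point p) (∈-fromList⁻ (map (point p) (allFin k)) h) =
    proj₁ (point-injective eq)

  block⁻ : ∀ {p y} → y ∈ block p → ∃ λ t → y ≡ point p t
  block⁻ {p} h = let t , _ , eq = Mem.∈-map⁻ (point p) (∈-fromList⁻ (map (point p) (allFin k)) h) in t , eq

  ∣block∣ : ∀ p → ∣ block p ∣ ≡ k
  ∣block∣ p = trans (∣fromList∣ (Unique.map⁺ (proj₂ ∘ point-injective {p} {p}) (Unique.allFin⁺ k)))
    (trans (List.length-map (point p) (allFin k)) (length-allFin k))

  block-disjoint : ∀ {p q} → p ≢ q → Disjoint (block p) (block q)
  block-disjoint {p} {q} p≢q = disjoint⁺ λ h h′ → let t , eq = block⁻ h in p≢q (∈block (subst (_∈ block q) eq h′))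

  pair : Fin ν → Fin ν → Fin k → Subset (k * ν)
  pair p q t = fromList (point p t ∷ point q t ∷ [])

  pairˡ : ∀ p q t → point p t ∈ pair p q t
  pairˡ p q t = ∈-fromList⁺ (point p t ∷ point q t ∷ []) (here refl)

  pairʳ : ∀ p q t → point q t ∈ pair p q t
  pairʳ p q t = ∈-fromList⁺ (point p t ∷ point q t ∷ []) (there (here refl))

  pair⁻ : ∀ {p q t y} → y ∈ pair p q t → y ≡ point p t ⊎ y ≡ point q t
  pair⁻ {p} {q} {t} h with ∈-fromList⁻ (point p t ∷ point q t ∷ []) h
  ... | here eq = inj₁ eq
  ... | there (here eq) = inj₂ eq

  pair-comm : ∀ p q t → pair p q t ≡ pair q p t
  pair-comm p q t = Subset.⊆-antisym (swap p q) (swap q p)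
    where
    swap : ∀ p q → pair p q t ⊆ pair q p t
    swap p q h = [ (λ { refl → pairʳ q p t }) , (λ { refl → pairˡ q p t }) ]′ (pair⁻ {p} {q} h)

  ∣pair∣ : ∀ {p q t} → p ≢ q → ∣ pair p q t ∣ ≡ 2
  ∣pair∣ p≢q = ∣fromList∣ (((λ eq → p≢q (proj₁ (point-injective eq))) ∷ []) ∷ [] ∷ [])

  side-≢ : ∀ {p q} → side p ≢ side q → p ≢ q
  side-≢ ne refl = ne refl

  Shape : Subset (k * ν + suc m) → Set
  Shape S = (∃ λ R → ∣ R ∣ ≡ 2 + i × S ≡ coned ⊥ R)
          ⊎ (∃₂ λ p q → ∃₂ λ t R → side p ≢ side q × ∣ R ∣ ≡ i × S ≡ coned (pair p q t) R)

  Meets : Fin ν → Subset (k * ν + suc m) → Set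
  Meets b S = ∃₂ λ q t → ∃ λ R → side b ≢ side q × ∣ R ∣ ≡ i × S ≡ coned (pair b q t) R

  -- The last condition says that `P` has at most one point in blocks opposite to `b`. It holds
  -- because the ends of a pair lie on different sides, and it forces sets meeting `b` inside the
  -- same 2k points to share their partner.
  Misses : Fin ν → Subset (k * ν + suc m) → Set
  Misses b S = ∃₂ λ P R → S ≡ coned P R × ∣ P ∣ + ∣ R ∣ ≡ 2 + i × Disjoint P (block b) × (Empty P ⊎ ∣ R ∣ ≡ i) ×
    (∀ {q q′ t t′} → side b ≢ side q → side b ≢ side q′ → point q t ∈ P → point q′ t′ ∈ P → q ≡ q′ × t ≡ t′)

  meets⊎misses : ∀ b {S} → Shape S → Meets b S ⊎ Misses b S
  meets⊎misses b (inj₁ (R , ∣R∣ , eq)) = inj₂ (⊥ , R , eq , trans (cong (_+ ∣ R ∣) (Subset.∣⊥∣≡0 (k * ν))) ∣R∣ ,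
    disjoint⁺ (λ h → contradiction h Subset.∉⊥) , inj₁ (λ (_ , h) → Subset.∉⊥ h) , λ _ _ h →
      contradiction h Subset.∉⊥)
  meets⊎misses b (inj₂ (p , q , t , R , ne , ∣R∣ , eq)) with b Fin.≟ p | b Fin.≟ q
  ... | yes refl | _ = inj₁ (q , t , R , ne , ∣R∣ , eq)
  ... | no _ | yes refl = inj₁ (p , t , R , ne ∘ sym , ∣R∣ , trans eq (cong (λ P → coned P R) (pair-comm p q t)))
  ... | no b≢p | no b≢q = inj₂ (pair p q t , R , eq , cong₂ _+_ (∣pair∣ (side-≢ ne)) ∣R∣ ,
      disjoint⁺ (λ h h′ → [ (λ { refl → b≢p (sym (∈block h′)) }) ,
        (λ { refl → b≢q (sym (∈block h′)) }) ]′ (pair⁻ {p} {q} h)) ,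
      inj₂ ∣R∣ , λ {q₁} {q₂} a a′ h h′ → same a a′ (pair⁻ {p} {q} h) (pair⁻ {p} {q} h′))
    where
    -- There are only two sides, so the ends of a pair cannot both be opposite to `b`. This is where
    -- the bipartition rules out triangles of blocks.
    threeSides : ∀ (x y z : Bool) → x ≢ y → x ≢ z → y ≢ z → False
    threeSides false false _ a _ _ = a refl
    threeSides false true false _ b _ = b refl
    threeSides false true true _ _ c = c refl
    threeSides true true _ a _ _ = a refl
    threeSides true false true _ b _ = b refl
    threeSides true false false _ _ c = c refl
    same : ∀ {q₁ q₂ t₁ t₂} → side b ≢ side q₁ → side b ≢ side q₂ →
           point q₁ t₁ ≡ point p t ⊎ point q₁ t₁ ≡ point q t → point q₂ t₂ ≡ point p t ⊎ point q₂ t₂ ≡ point q t →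
           q₁ ≡ q₂ × t₁ ≡ t₂
    same _ _ (inj₁ e) (inj₁ e′) = point-injective (trans e (sym e′))
    same _ _ (inj₂ e) (inj₂ e′) = point-injective (trans e (sym e′))
    same a a′ (inj₁ e) (inj₂ e′) with refl , _ ← point-injective e | refl , _ ← point-injective e′ =
      ⊥-elim (threeSides (side b) (side p) (side q) a a′ ne)
    same a a′ (inj₂ e) (inj₁ e′) with refl , _ ← point-injective e | refl , _ ← point-injective e′ =
      ⊥-elim (threeSides (side b) (side p) (side q) a′ a ne)

  k+k : ∀ {j} → j ≡ k → k + j ≡ 2 * k
  k+k refl = cong (k +_) (sym (+-identityʳ k))

  module _ (b : Fin ν) {W} (ws : Split k W) (block⊆ : base (block b) ⊆ W) where

    open Split ws

    meets⊆ : ∀ {S} → S ⊆ W → (mt : Meets b S) → point (proj₁ mt) (proj₁ (proj₂ mt)) ∈ lower ×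
      proj₁ (proj₂ (proj₂ mt)) ⊆ upper
    meets⊆ s (q , t , R , _ , _ , refl) = let P⊆ , R⊆ = coned⊆ {pair b q t} {R} s in P⊆ (pairʳ b q t) , R⊆

    -- The block and `S₁` are disjoint and have 2k points together, so they fill `W`. Another set
    -- missing the block then lies in `S₁` and equals it. Two sets meeting the block have their
    -- partners at the only opposite point of `S₁` and the same upper part as `S₁`, so they
    -- coincide.
    missing-⊥ : ∀ {S₁ S₂ S₃} → Misses b S₁ → Meets b S₂ ⊎ Misses b S₂ → Meets b S₃ ⊎ Misses b S₃ →
                S₁ ⊆ W → S₂ ⊆ W → S₃ ⊆ W → S₁ ≢ S₂ → S₁ ≢ S₃ → S₂ ≢ S₃ → False
    missing-⊥ {S₁} {S₂} {S₃} (P₁ , R₁ , refl , card , dis , small , unq) v₂ v₃ s₁ s₂ s₃ n₁₂ n₁₃ n₂₃ = go v₂ v₃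
      where
      P₁⊆ : P₁ ⊆ lower
      P₁⊆ = proj₁ (coned⊆ {P₁} {R₁} s₁)
      R₁⊆ : R₁ ⊆ upper
      R₁⊆ = proj₂ (coned⊆ {P₁} {R₁} s₁)
      X⊆ : block b ∪ P₁ ⊆ lower
      X⊆ = ∪-least {p = block b} (base⊆ block⊆) P₁⊆
      total : ∣ block b ∪ P₁ ∣ + suc ∣ R₁ ∣ ≡ 2 * k
      total = trans (cong (_+ suc ∣ R₁ ∣) (trans (∣∪∣-disjoint (block b) P₁ (disjoint⁺ λ h h′ → disjoint⁻ dis h′ h))
        (cong (_+ ∣ P₁ ∣) (∣block∣ b))))
        (trans (+-assoc k ∣ P₁ ∣ _) (k+k (trans (+-suc ∣ P₁ ∣ ∣ R₁ ∣) (cong suc card))))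
      lower⊆ : ∀ {y} → y ∈ lower → y ∉ block b → y ∈ P₁
      lower⊆ {y} h nb = [ (λ h′ → contradiction h′ nb) ,
        id ]′ (∈-∪⁻ {p = block b} (subst (y ∈_) (sym (lower≡ X⊆ R₁⊆ total)) h))
      upper⊆ : upper ⊆ R₁
      upper⊆ {y} = subst (y ∈_) (sym (upper≡ X⊆ R₁⊆ total))
      other : ∀ {S} → Misses b S → S ⊆ W → S₁ ≡ S
      other (P , R , refl , card′ , dis′ , _) s =
        let P⊆ , R⊆ = coned⊆ {P} {R} s
            P⊆P₁ = λ {y} (y∈ : y ∈ P) → lower⊆ (P⊆ y∈) (disjoint⁻ dis′ y∈)
            R⊆R₁ = λ {y} (y∈ : y ∈ R) → upper⊆ (R⊆ y∈)
            le₁ , le₂ = ≤-split (Subset.p⊆q⇒∣p∣≤∣q∣ P⊆P₁) (Subset.p⊆q⇒∣p∣≤∣q∣ R⊆R₁) (trans card′ (sym card))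
        in sym (cong₂ coned (⊆∧∣≤∣⇒≡ P⊆P₁ le₁) (⊆∧∣≤∣⇒≡ R⊆R₁ le₂))
      inP₁ : ∀ {q t} → side b ≢ side q → point q t ∈ lower → point q t ∈ P₁
      inP₁ ne h = lower⊆ h (λ h′ → side-≢ ne (sym (∈block h′)))
      go : Meets b S₂ ⊎ Misses b S₂ → Meets b S₃ ⊎ Misses b S₃ → False
      go (inj₂ v) _ = n₁₂ (other v s₂)
      go (inj₁ _) (inj₂ v) = n₁₃ (other v s₃)
      go (inj₁ mt₂@(q₂ , t₂ , R₂ , ne₂ , ∣R₂∣ , eq₂)) (inj₁ mt₃@(q₃ , t₃ , R₃ , ne₃ , ∣R₃∣ , eq₃)) =
        let p₂∈ , R₂⊆ = meets⊆ s₂ mt₂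
            p₃∈ , R₃⊆ = meets⊆ s₃ mt₃
            q≡ , t≡ = unq ne₂ ne₃ (inP₁ ne₂ p₂∈) (inP₁ ne₃ p₃∈)
            ∣R₁∣ = [ (λ e → contradiction (_ , inP₁ ne₂ p₂∈) e) , id ]′ small
            R₂≡ = ⊆∧∣≤∣⇒≡ {q = R₁} (λ y∈ → upper⊆ (R₂⊆ y∈)) (≤-reflexive (trans ∣R₁∣ (sym ∣R₂∣)))
            R₃≡ = ⊆∧∣≤∣⇒≡ {q = R₁} (λ y∈ → upper⊆ (R₃⊆ y∈)) (≤-reflexive (trans ∣R₁∣ (sym ∣R₃∣)))
        in n₂₃ (trans eq₂ (trans (cong₂ coned (cong₂ (pair b) q≡ t≡) (trans R₂≡ (sym R₃≡))) (sym eq₃)))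

    -- The block, two partners, the apex and the k - 3 upper points of `S₁` make 2k points and fill
    -- `W`. The third set has one of these two partners and the same upper part, so it repeats `S₁`
    -- or `S₂`.
    distinctPartners-⊥ : ∀ {S₁ S₂ S₃} (v₁ : Meets b S₁) (v₂ : Meets b S₂) → Meets b S₃ →
      point (proj₁ v₁) (proj₁ (proj₂ v₁)) ≢ point (proj₁ v₂) (proj₁ (proj₂ v₂)) →
      S₁ ⊆ W → S₂ ⊆ W → S₃ ⊆ W → S₁ ≢ S₃ → S₂ ≢ S₃ → False
    distinctPartners-⊥ v₁@(q₁ , t₁ , R₁ , ne₁ , ∣R₁∣ , eq₁) v₂@(q₂ , t₂ , R₂ , ne₂ , ∣R₂∣ , eq₂) v₃@(q₃ , t₃ , R₃ ,
      ne₃ , ∣R₃∣ , eq₃)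
      b₁≢b₂ s₁ s₂ s₃ n₁₃ n₂₃ = go (∈-fromList⁻ ends (third))
      where
      ends : List (Fin (k * ν))
      ends = point q₁ t₁ ∷ point q₂ t₂ ∷ []
      ends-outside : ∀ {y} → y ∈ˡ ends → y ∉ block b
      ends-outside (here refl) h = side-≢ ne₁ (sym (∈block h))
      ends-outside (there (here refl)) h = side-≢ ne₂ (sym (∈block h))
      ends⊆ : fromList ends ⊆ lower
      ends⊆ h with ∈-fromList⁻ ends h
      ... | here refl = proj₁ (meets⊆ s₁ v₁)
      ... | there (here refl) = proj₁ (meets⊆ s₂ v₂)
      X⊆ : block b ∪ fromList ends ⊆ lower
      X⊆ = ∪-least {p = block b} (base⊆ block⊆) ends⊆
      R₁⊆ : R₁ ⊆ upper
      R₁⊆ = proj₂ (meets⊆ s₁ v₁)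
      total : ∣ block b ∪ fromList ends ∣ + suc ∣ R₁ ∣ ≡ 2 * k
      total = trans (cong₂ (λ u v → u + suc v)
          (trans (∣∪∣-disjoint (block b) (fromList ends) (disjoint⁺ λ h h′ → ends-outside (∈-fromList⁻ ends h′) h))
                 (cong₂ _+_ (∣block∣ b) (∣fromList∣ ((b₁≢b₂ ∷ []) ∷ [] ∷ [])))) ∣R₁∣)
        (trans (+-assoc k 2 (suc i)) (k+k refl))
      third : point q₃ t₃ ∈ fromList ends
      third = [ (λ h → contradiction (sym (∈block h)) (side-≢ ne₃)) , id ]′
        (∈-∪⁻ {p = block b} (subst (point q₃ t₃ ∈_) (sym (lower≡ X⊆ R₁⊆ total)) (proj₁ (meets⊆ s₃ v₃))))
      sameUpper : ∀ {R} → R ⊆ upper → ∣ R ∣ ≡ i → R ≡ R₁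
      sameUpper s ∣R∣ = ⊆∧∣≤∣⇒≡ (λ {y} y∈ → subst (y ∈_) (sym (upper≡ X⊆ R₁⊆ total)) (s y∈))
        (≤-reflexive (trans ∣R₁∣ (sym ∣R∣)))
      R₂≡ : R₂ ≡ R₁
      R₂≡ = sameUpper (proj₂ (meets⊆ s₂ v₂)) ∣R₂∣
      R₃≡ : R₃ ≡ R₁
      R₃≡ = sameUpper (proj₂ (meets⊆ s₃ v₃)) ∣R₃∣
      go : point q₃ t₃ ∈ˡ ends → False
      go (here eq) = let q≡ , t≡ = point-injective eq in
        n₁₃ (trans eq₁ (trans (cong₂ coned (cong₂ (pair b) (sym q≡) (sym t≡)) (sym R₃≡)) (sym eq₃)))
      go (there (here eq)) = let q≡ , t≡ = point-injective eq in
        n₂₃ (trans eq₂ (trans (cong₂ coned (cong₂ (pair b) (sym q≡) (sym t≡)) (trans R₂≡ (sym R₃≡))) (sym eq₃)))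

    -- If all three partners agree, correspondence of points forces one and the same point of the
    -- block into all three sets, and the intersection is not empty.
    meeting-⊥ : ∀ {S₁ S₂ S₃} → Meets b S₁ → Meets b S₂ → Meets b S₃ → S₁ ⊆ W → S₂ ⊆ W → S₃ ⊆ W →
                S₁ ≢ S₂ → S₁ ≢ S₃ → S₂ ≢ S₃ →
                (∀ {y} → y ∈ base (block b) → y ∈ S₁ → y ∈ S₂ → y ∈ S₃ → False) → False
    meeting-⊥ v₁@(q₁ , t₁ , R₁ , _ , _ , eq₁) v₂@(q₂ , t₂ , R₂ , _ , _ , eq₂) v₃@(q₃ , t₃ , R₃ , _ , _ ,
      eq₃) s₁ s₂ s₃ n₁₂ n₁₃ n₂₃ empty
      with point q₁ t₁ Fin.≟ point q₂ t₂ | point q₁ t₁ Fin.≟ point q₃ t₃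
    ... | no ne | _ = distinctPartners-⊥ v₁ v₂ v₃ ne s₁ s₂ s₃ n₁₃ n₂₃
    ... | yes _ | no ne = distinctPartners-⊥ v₁ v₃ v₂ ne s₁ s₃ s₂ n₁₂ (n₂₃ ∘ sym)
    ... | yes e₂ | yes e₃ with refl ← proj₂ (point-injective {q₁} {q₂} e₂) | refl ← proj₂
      (point-injective {q₁} {q₃} e₃) =
      empty (∈-++ˡ⁺ {y = point b t₁} (point∈block b t₁)) (on eq₁) (on eq₂) (on eq₃)
      where
      on : ∀ {S q R} → S ≡ coned (pair b q t₁) R → point b t₁ Fin.↑ˡ suc m ∈ S
      on {q = q} refl = ∈-++ˡ⁺ (pairˡ b q t₁)

    shapes-⊥ : ∀ {S₁ S₂ S₃} → Shape S₁ → Shape S₂ → Shape S₃ → S₁ ⊆ W → S₂ ⊆ W → S₃ ⊆ W →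
               S₁ ≢ S₂ → S₁ ≢ S₃ → S₂ ≢ S₃ →
               (∀ {y} → y ∈ base (block b) → y ∈ S₁ → y ∈ S₂ → y ∈ S₃ → False) → False
    shapes-⊥ sh₁ sh₂ sh₃ s₁ s₂ s₃ n₁₂ n₁₃ n₂₃ empty
      with meets⊎misses b sh₁ | meets⊎misses b sh₂ | meets⊎misses b sh₃
    ... | inj₂ v₁ | v₂ | v₃ = missing-⊥ v₁ v₂ v₃ s₁ s₂ s₃ n₁₂ n₁₃ n₂₃
    ... | inj₁ v₁ | inj₂ v₂ | v₃ = missing-⊥ v₂ (inj₁ v₁) v₃ s₂ s₁ s₃ (n₁₂ ∘ sym) n₂₃ n₁₃
    ... | inj₁ v₁ | inj₁ v₂ | inj₂ v₃ = missing-⊥ v₃ (inj₁ v₁) (inj₁ v₂) s₃ s₁ s₂ (n₁₃ ∘ sym) (n₂₃ ∘ sym) n₁₂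
    ... | inj₁ v₁ | inj₁ v₂ | inj₁ v₃ = meeting-⊥ v₁ v₂ v₃ s₁ s₂ s₃ n₁₂ n₁₃ n₂₃ empty

-- The family for the general lower bound

someSubset : ∀ {m j} → j ≤ m → ∃ λ (R : Subset m) → ∣ R ∣ ≡ j
someSubset {m} {j} j≤m = fromList (take j (allFin m)) ,
  trans (∣fromList∣ (Unique.take⁺ j (Unique.allFin⁺ m)))
    (trans (List.length-take j (allFin m)) (trans (cong (j ⊓_) (length-allFin m)) (m≤n⇒m⊓n≡m j≤m)))

coned-base-disjoint : ∀ {a m} {P Q : Subset a} {R : Subset m} → Disjoint P Q →
  Disjoint (Apex.coned a m P R) (Apex.base a m Q)
coned-base-disjoint {a} {m} {P} {Q} d = disjoint⁺ λ {y} → go (Fin.splitAt a y) (Finₚ.join-splitAt a (suc m) y)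
  where
  go : ∀ {R : Subset m} {y} s → Fin.join a (suc m) s ≡ y → y ∈ Apex.coned a m P R → y ∉ Apex.base a m Q
  go (inj₁ y) refl h h′ = disjoint⁻ d (∈-++ˡ⁻ P h) (∈-++ˡ⁻ Q h′)
  go (inj₂ zero) refl _ h = Apex.apex∉ a m Q h
  go (inj₂ (suc y)) refl _ h = case ∈-++ʳ⁻ Q h of λ { (there m) → Subset.∉⊥ m }

⊥-disjoint : ∀ {Q : Subset n} → Disjoint ⊥ Q
⊥-disjoint = disjoint⁺ λ h → contradiction h Subset.∉⊥

matchingNumber≥ : ∀ {F ℳ : Family n} → Unique ℳ → ℳ ⊆ˡ F → AllPairs Disjoint ℳ → length ℳ ≤ matchingNumber F
matchingNumber≥ {F = F} u s d = maxSize-upper (IsMatchingIn F) (isMatchingIn? F) u ((λ {S} → s {S}) , d)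

f≥ : ∀ {k d ν} {F : Family n} → Unique F → Admissible k d ν F → length F ≤ f n k d ν
f≥ {k = k} {d} {ν} u adm = maxSize-upper (Admissible k d ν) (admissible? k d ν) u adm

module BlockFamily (i l r m : ℕ) (2+i≤m : 2 + i ≤ m) where

  private
    ν k : ℕ
    ν = l + r
    k = 3 + i

  open BlockConstruction i l r m
  open Apex (k * ν) m

  lefts rights : List (Fin ν)
  lefts  = map (Fin._↑ˡ r) (allFin l)
  rights = map (l Fin.↑ʳ_) (allFin r)

  side-left : ∀ {p} → p ∈ˡ lefts → side p ≡ false
  side-left h with p , _ , refl ← Mem.∈-map⁻ (Fin._↑ˡ r) h = cong [ (λ _ → false) ,
    (λ _ → true) ]′ (Finₚ.splitAt-↑ˡ l p r)

  side-right : ∀ {q} → q ∈ˡ rights → side q ≡ true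
  side-right h with q , _ , refl ← Mem.∈-map⁻ (l Fin.↑ʳ_) h = cong [ (λ _ → false) ,
    (λ _ → true) ]′ (Finₚ.splitAt-↑ʳ l r q)

  left≢right : ∀ {p q} → p ∈ˡ lefts → q ∈ˡ rights → side p ≢ side q
  left≢right p∈ q∈ eq = case trans (sym (side-left p∈)) (trans eq (side-right q∈)) of λ ()

  Index : Set
  Index = ((Fin ν × Fin ν) × Fin k) × Subset m

  indices : List Index
  indices = cartesianProduct (cartesianProduct (cartesianProduct lefts rights) (allFin k)) (ksubsets ⊤ i)

  edge : Index → Subset (k * ν + suc m)
  edge (((p , q) , t) , R) = coned (pair p q t) R

  blocks stars edges F : Family (k * ν + suc m)
  blocks = map (base ∘ block) (allFin ν)
  stars  = map (coned ⊥) (ksubsets ⊤ (2 + i))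
  edges  = map edge indices
  F      = blocks ++ stars ++ edges

  ∈-indices : ∀ {p q t R} → (((p , q) , t) , R) ∈ˡ indices → p ∈ˡ lefts × q ∈ˡ rights × ∣ R ∣ ≡ i
  ∈-indices h =
    let h₁ , hR = Mem.∈-cartesianProduct⁻ (cartesianProduct (cartesianProduct lefts rights) (allFin k)) (ksubsets ⊤ i) h
        h₂ , _ = Mem.∈-cartesianProduct⁻ (cartesianProduct lefts rights) (allFin k) h₁
        hp , hq = Mem.∈-cartesianProduct⁻ lefts rights h₂
    in hp , hq , proj₂ (∈-ksubsets⁻ ⊤ i hR)

  shape : ∀ {S} → S ∈ˡ stars ++ edges → Shape S
  shape h with Mem.∈-++⁻ stars h
  ... | inj₁ h′ = let R , R∈ , eq = Mem.∈-map⁻ (coned ⊥) h′ in inj₁ (R , proj₂ (∈-ksubsets⁻ ⊤ (2 + i) R∈) , eq)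
  ... | inj₂ h′ = let (((p , q) , t) , R) , m , eq = Mem.∈-map⁻ edge h′ ; hp , hq , ∣R∣ = ∈-indices m in
    inj₂ (p , q , t , R , left≢right hp hq , ∣R∣ , eq)

  shape-apex : ∀ {S} → Shape S → apex ∈ S
  shape-apex (inj₁ (R , _ , refl)) = apex∈ ⊥ R
  shape-apex (inj₂ (p , q , t , R , _ , _ , refl)) = apex∈ (pair p q t) R

  shape-card : ∀ {S} → Shape S → ∣ S ∣ ≡ k
  shape-card (inj₁ (R , ∣R∣ , refl)) = trans (∣coned∣ ⊥ R) (cong₂ (λ u v → u + suc v) (Subset.∣⊥∣≡0 (k * ν)) ∣R∣)
  shape-card (inj₂ (p , q , t , R , ne , ∣R∣ , refl)) =
    trans (∣coned∣ (pair p q t) R) (cong₂ (λ u v → u + suc v) (∣pair∣ (side-≢ ne)) ∣R∣)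

  member : ∀ {S} → S ∈ˡ F → (∃ λ p → S ≡ base (block p)) ⊎ Shape S
  member h with Mem.∈-++⁻ blocks h
  ... | inj₁ h′ = let p , _ , eq = Mem.∈-map⁻ (base ∘ block) h′ in inj₁ (p , eq)
  ... | inj₂ h′ = inj₂ (shape h′)

  apex⇒shape : ∀ {S} → S ∈ˡ F → apex ∈ S → Shape S
  apex⇒shape h ap = [ (λ (p , eq) → contradiction (subst (apex ∈_) eq ap) (apex∉ (block p))) , id ]′ (member h)

  ∣baseBlock∣ : ∀ p → ∣ base (block p) ∣ ≡ k
  ∣baseBlock∣ p = trans (∣base∣ (block p)) (∣block∣ p)

  F-clusterFree : ClusterFree 4 k F
  F-clusterFree = MatchingPlusStar.clusterFree apex (base ∘ block) (s≤s z≤n) (apex∉ ∘ block) ∣baseBlock∣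
    (λ ne → base-disjoint (block-disjoint ne)) F
    (λ h → Sum.swap (Sum.map₂ shape-apex (member h)))
    λ p W S₁∈ S₂∈ S₃∈ x₁ x₂ x₃ n₁₂ n₁₃ n₂₃ A⊆ s₁ s₂ s₃ ∣W∣ empty →
      shapes-⊥ p (split {k} W (s₁ x₁) ∣W∣) A⊆ (apex⇒shape S₁∈ x₁) (apex⇒shape S₂∈ x₂) (apex⇒shape S₃∈ x₃)
        s₁ s₂ s₃ n₁₂ n₁₃ n₂₃ empty

  F-uniform : Uniform k F
  F-uniform = All.tabulate λ h → [ (λ { (p , refl) → ∣baseBlock∣ p }) , shape-card ]′ (member h)

  blocks-disjoint : AllPairs Disjoint blocks
  blocks-disjoint = AllPairs.map⁺ (AllPairs.map (λ ne → base-disjoint (block-disjoint ne)) (Unique.allFin⁺ ν))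

  blocks-unique : Unique blocks
  blocks-unique = AllPairs.map⁺ (AllPairs.map distinct (Unique.allFin⁺ ν))
    where
    distinct : ∀ {p q} → p ≢ q → base (block p) ≢ base (block q)
    distinct {p} {q} p≢q eq = p≢q (∈block (subst (point p zero ∈_) (Vec.++-injectiveˡ (block p) (block q) eq)
      (point∈block p zero)))

  -- The two ends of a pair are told apart by their sides, so no pair is listed in both orders.
  edge-injective : ∀ {a b} → a ∈ˡ indices → b ∈ˡ indices → edge a ≡ edge b → a ≡ b
  edge-injective {((p , q) , t) , R} {((p′ , q′) , t′) , R′} a∈ b∈ eq =
    let P≡ , R≡ = coned-injective eq
        hp , hq , _ = ∈-indices a∈
        hp′ , hq′ , _ = ∈-indices b∈
        p≡ , t≡ = [ point-injective , (λ e → contradiction (cong side (proj₁ (point-injective e)))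
          (left≢right hp hq′)) ]′
                    (pair⁻ {p′} {q′} (subst (point p t ∈_) P≡ (pairˡ p q t)))
        q≡ , _ = [ (λ e → contradiction (sym (cong side (proj₁ (point-injective e)))) (left≢right hp′ hq)) ,
          point-injective ]′
                    (pair⁻ {p′} {q′} (subst (point q t ∈_) P≡ (pairʳ p q t)))
    in cong₂ _,_ (cong₂ _,_ (cong₂ _,_ p≡ q≡) t≡) R≡

  indices-unique : Unique indices
  indices-unique = Unique.cartesianProduct⁺ (Unique.cartesianProduct⁺ (Unique.cartesianProduct⁺
      (Unique.map⁺ (Finₚ.↑ˡ-injective r _ _) (Unique.allFin⁺ l))
        (Unique.map⁺ (Finₚ.↑ʳ-injective l _ _) (Unique.allFin⁺ r)))
    (Unique.allFin⁺ k)) (ksubsets-unique ⊤ i)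

  stars-edges-disjoint : ∀ {S} → S ∈ˡ stars → S ∉ˡ edges
  stars-edges-disjoint h h′ with R , _ , refl ← Mem.∈-map⁻ (coned ⊥) h with (((p , q) , t) , R′) , _ ,
    eq ← Mem.∈-map⁻ edge h′ =
    Subset.∉⊥ (subst (point p t ∈_) (sym (proj₁ (coned-injective eq))) (pairˡ p q t))

  F-unique : Unique F
  F-unique = Unique.++⁺ blocks-unique
    (Unique.++⁺ (Unique.map⁺ (proj₂ ∘ coned-injective) (ksubsets-unique ⊤ (2 + i)))
      (map-unique edge-injective indices-unique)
      (λ (h , h′) → stars-edges-disjoint h h′))
    λ (h , h′) → let p , _ , eq = Mem.∈-map⁻ (base ∘ block) h in
      apex∉ (block p) (subst (apex ∈_) eq (shape-apex (shape h′)))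

  length-F : length F ≡ ν + (m C (2 + i) + l * r * k * (m C i))
  length-F = trans (List.length-++ blocks) (cong₂ _+_
    (trans (List.length-map (base ∘ block) (allFin ν)) (length-allFin ν))
    (trans (List.length-++ stars) (cong₂ _+_ (trans (List.length-map (coned ⊥) (ksubsets ⊤ (2 + i))) (binom (2 + i)))
      (trans (List.length-map edge indices) (trans
        (length-cartesianProductWith _,_ (cartesianProduct (cartesianProduct lefts rights) (allFin k)) (ksubsets ⊤ i))
        (cong₂ _*_ (trans (length-cartesianProductWith _,_ (cartesianProduct lefts rights) (allFin k))
          (cong₂ _*_ (trans (length-cartesianProductWith _,_ lefts rights)
            (cong₂ _*_ (trans (List.length-map (Fin._↑ˡ r) (allFin l)) (length-allFin l))
                       (trans (List.length-map (l Fin.↑ʳ_) (allFin r)) (length-allFin r)))) (length-allFin k)))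
          (binom i)))))))
    where
    binom : ∀ j → length (ksubsets (⊤ {m}) j) ≡ m C j
    binom j = trans (length-ksubsets (⊤ {m}) j) (cong (_C j) (Subset.∣⊤∣≡n m))

  -- The blocks contribute ν disjoint members, and a cone over `⊥` is disjoint from all of them.
  -- Such a cone exists because at least k - 1 points remain besides the blocks and the apex.
  F-matching : ν + 1 ≤ matchingNumber F
  F-matching = ≤-trans (≤-reflexive (trans (+-comm ν 1)
    (cong suc (sym (trans (List.length-map (base ∘ block) (allFin ν)) (length-allFin ν))))))
    (matchingNumber≥ {ℳ = S₀ ∷ blocks}
      (All.tabulate (λ h eq → let p , _ , eq′ = Mem.∈-map⁻ (base ∘ block) h in coned≢base {⊥} {block p} {proj₁ some} (trans eq eq′)) ∷ blocks-unique)
      (λ { (here refl) → Mem.∈-++⁺ʳ blocks (Mem.∈-++⁺ˡ (Mem.∈-map⁺ (coned ⊥) (∈-ksubsets Subset.⊆⊤ (proj₂ some)))) ;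
        (there h) → Mem.∈-++⁺ˡ h })
      (All.tabulate (λ h → let p , _ , eq = Mem.∈-map⁻ (base ∘ block) h in
        subst (Disjoint S₀) (sym eq) (coned-base-disjoint {P = ⊥} {block p} ⊥-disjoint)) ∷ blocks-disjoint))
    where
    some : ∃ λ (R : Subset m) → ∣ R ∣ ≡ 2 + i
    some = someSubset 2+i≤m
    S₀ : Subset (k * ν + suc m)
    S₀ = coned ⊥ (proj₁ some)

  bound : m C (2 + i) + k * (l * r) * (m C i) ≤ f (k * ν + suc m) k 4 ν
  bound = ≤-trans (≤-trans (≤-reflexive (cong (λ c → m C (2 + i) + c * (m C i)) (*-comm k (l * r)))) (m≤n+m _ ν))
    (≤-trans (≤-reflexive (sym length-F)) (f≥ F-unique (F-uniform , F-clusterFree , F-matching)))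

halves : ∀ ν → ∃₂ λ l r → l + r ≡ ν × (r ≡ l ⊎ r ≡ suc l)
halves zero = 0 , 0 , refl , inj₁ refl
halves (suc ν) with halves ν
... | l , _ , refl , inj₁ refl = l , suc l , +-suc l l , inj₂ refl
... | l , _ , refl , inj₂ refl = suc l , suc l , refl , inj₁ refl

-- For l and r differing by at most one, (l + r)² is at most 4 l r + 1, and rounding down removes
-- the excess.
ν²/4≤ : ∀ {l r} → r ≡ l ⊎ r ≡ suc l → (l + r) ^ 2 / 4 ≤ l * r
ν²/4≤ {l} {r} h = s≤s⁻¹ (m<n*o⇒m/o<n {m = (l + r) ^ 2} {n = suc (l * r)} {o = 4} (square h))
  where
  square : r ≡ l ⊎ r ≡ suc l → (l + r) ^ 2 < suc (l * r) * 4
  square (inj₁ refl) = ≤-trans (m≤m+n _ 3) (≤-reflexive (even l))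
    where
    even : ∀ l → suc ((l + l) * ((l + l) * 1)) + 3 ≡ suc (l * l) * 4
    even = solve-∀
  square (inj₂ refl) = ≤-trans (m≤m+n _ 2) (≤-reflexive (odd l))
    where
    odd : ∀ l → suc ((l + suc l) * ((l + suc l) * 1)) + 2 ≡ suc (l * suc l) * 4
    odd = solve-∀

lowerBound : ∀ i ν → let k = 3 + i in ∃ λ c₁ → k * (ν ^ 2 / 4) ≤ c₁ ×
             (∀ n → k * (ν + 1) ≤ n → (n ∸ k * ν ∸ 1) C (2 + i) + c₁ * ((n ∸ k * ν ∸ 1) C i) ≤ f n k 4 ν)
lowerBound i ν with halves ν
... | l , r , refl , h = k * (l * r) , *-monoʳ-≤ k (ν²/4≤ h) , bounded
  where
  k : ℕ
  k = 3 + i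
  bounded : ∀ n → k * (l + r + 1) ≤ n →
            (n ∸ k * (l + r) ∸ 1) C (2 + i) + k * (l * r) * ((n ∸ k * (l + r) ∸ 1) C i) ≤ f n k 4 (l + r)
  bounded n le = subst (λ n′ → m C (2 + i) + k * (l * r) * (m C i) ≤ f n′ k 4 (l + r)) n≡
    (BlockFamily.bound i l r m 2+i≤m)
    where
    kν m : ℕ
    kν = k * (l + r)
    m = n ∸ kν ∸ 1
    k≤ : k ≤ n ∸ kν
    k≤ = m+n≤o⇒m≤o∸n k (≤-trans (≤-reflexive (trans (+-comm k kν)
      (sym (trans (*-distribˡ-+ k (l + r) 1) (cong (kν +_) (*-identityʳ k)))))) le)
    2+i≤m : 2 + i ≤ m
    2+i≤m = ∸-monoˡ-≤ 1 k≤
    n≡ : kν + suc m ≡ n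
    n≡ = trans (cong (kν +_) (m+[n∸m]≡n (≤-trans (s≤s z≤n) k≤)))
      (m+[n∸m]≡n {kν} {n} (≤-trans (*-monoʳ-≤ k (m≤m+n (l + r) 1)) le))

-- The lower bound for a single block

twoFaces⇒tightPath : ∀ {r} {ℰ : Family n} {S S′ T : Subset n} → S ∈ˡ ℰ → S′ ∈ˡ ℰ → S ≢ S′ → S ⊆ T → S′ ⊆ T →
                     ∣ S ∣ ≡ suc r → ∣ S′ ∣ ≡ suc r → ∣ T ∣ ≡ 2 + r → ContainsTightPath 2 (suc r) ℰ
twoFaces⇒tightPath {r = r} {ℰ} {S} {S′} {T} S∈ S′∈ ne s s′ ∣S∣ ∣S′∣ ∣T∣
  with w , w∈ , refl ← remove-missing {R = S} {T} s (trans (cong suc ∣S∣) (sym ∣T∣))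
  with u , u∈ , refl ← remove-missing {R = S′} {T} s′ (trans (cong suc ∣S′∣) (sym ∣T∣)) =
  vs , length-vs , vs-unique , λ { (here refl) → subst (_∈ˡ ℰ) first S∈ ; (there (here refl)) →
    subst (_∈ˡ ℰ) second S′∈ }
  where
  Q : Subset _
  Q = (T - w) - u
  q vs : List (Fin _)
  q = elems Q
  -- With `u` first and `w` last, the two windows of the path are `T - w` and `T - u`.
  vs = u ∷ q ++ w ∷ []
  u≢w : u ≢ w
  u≢w refl = ne refl
  u∈T-w : u ∈ T - w
  u∈T-w = x∈p-y⁺ u∈ u≢w
  length-q : length q ≡ r
  length-q = trans (length-elems Q) (suc-injective (trans (∣p-x∣ u∈T-w) ∣S∣))
  length-vs : length vs ≡ 2 + r
  length-vs = cong suc (trans (List.length-++ q) (trans (+-comm (length q) 1) (cong suc length-q)))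
  ∈q : ∀ {y} → y ∈ˡ q → y ∈ T × y ≢ w × y ≢ u
  ∈q h = let h′ , y≢u = x∈p-y⁻ (T - w) u (∈-elems⁻ h) ; y∈ , y≢w = x∈p-y⁻ T w h′ in y∈ , y≢w , y≢u
  vs-unique : Unique vs
  vs-unique = All.tabulate (λ h eq → case Mem.∈-++⁻ q h of λ
      { (inj₁ h′) → proj₂ (proj₂ (∈q h′)) (sym eq) ; (inj₂ (here refl)) → u≢w eq })
    ∷ Unique.++⁺ (elems-unique Q) ([] ∷ []) λ { (h , here refl) → proj₁ (proj₂ (∈q h)) refl }
  inQ : ∀ {y} → y ∈ T → y ≢ w → y ≢ u → y ∈ˡ q
  inQ y∈ y≢w y≢u = ∈-elems⁺ (x∈p-y⁺ (x∈p-y⁺ y∈ y≢w) y≢u)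
  first : T - w ≡ fromList (take (suc r) vs)
  first = trans (Subset.⊆-antisym to from)
    (cong fromList (sym (trans (cong (λ l → take (suc l) vs) (sym length-q))
      (cong (u ∷_) (take-length-++ q (w ∷ []))))))
    where
    to : T - w ⊆ fromList (u ∷ q)
    to {y} h with y Fin.≟ u
    ... | yes refl = ∈-fromList⁺ (u ∷ q) (here refl)
    ... | no y≢u = let y∈ , y≢w = x∈p-y⁻ T w h in ∈-fromList⁺ (u ∷ q) (there (inQ y∈ y≢w y≢u))
    from : fromList (u ∷ q) ⊆ T - w
    from h with ∈-fromList⁻ (u ∷ q) h
    ... | here refl = u∈T-w
    ... | there h′ = let y∈ , y≢w , _ = ∈q h′ in x∈p-y⁺ y∈ y≢w
  second : T - u ≡ fromList (take (suc r) (q ++ w ∷ []))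
  second = trans (Subset.⊆-antisym to from)
    (cong fromList (sym (List.take-all (suc r) (q ++ w ∷ []) (≤-reflexive (suc-injective length-vs)))))
    where
    to : T - u ⊆ fromList (q ++ w ∷ [])
    to {y} h with y Fin.≟ w
    ... | yes refl = ∈-fromList⁺ (q ++ w ∷ []) (Mem.∈-++⁺ʳ q (here refl))
    ... | no y≢w = let y∈ , y≢u = x∈p-y⁻ T u h in ∈-fromList⁺ (q ++ w ∷ []) (Mem.∈-++⁺ˡ (inQ y∈ y≢w y≢u))
    from : fromList (q ++ w ∷ []) ⊆ T - u
    from h with Mem.∈-++⁻ q (∈-fromList⁻ (q ++ w ∷ []) h)
    ... | inj₁ h′ = let y∈ , _ , y≢u = ∈q h′ in x∈p-y⁺ y∈ y≢u
    ... | inj₂ (here refl) = x∈p-y⁺ w∈ (u≢w ∘ sym)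

module SingleBlock (i m : ℕ) (2+i≤m : 2 + i ≤ m) (ℰ : Family m) (ℰ-unique : Unique ℰ)
                   (ℰ-free : TightPathFree 2 (1 + i) ℰ) where

  private
    k : ℕ
    k = 3 + i

  open Apex k m

  ℰ-uniform : Uniform (1 + i) ℰ
  ℰ-uniform = proj₁ ℰ-free

  block : Subset (k + suc m)
  block = base ⊤

  -- All added sets use this one point of the block, so the block and any three of them have it in
  -- common.
  foot : Fin k
  foot = zero

  stars edges F : Family (k + suc m)
  stars = map (coned ⊥) (ksubsets ⊤ (2 + i))
  edges = map (coned ⁅ foot ⁆) ℰ
  F     = block ∷ stars ++ edges

  Shape : Subset (k + suc m) → Set
  Shape S = (∃ λ R → ∣ R ∣ ≡ 2 + i × S ≡ coned ⊥ R) ⊎ (∃ λ R → R ∈ˡ ℰ × S ≡ coned ⁅ foot ⁆ R)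

  shape : ∀ {S} → S ∈ˡ stars ++ edges → Shape S
  shape h with Mem.∈-++⁻ stars h
  ... | inj₁ h′ = let R , R∈ , eq = Mem.∈-map⁻ (coned ⊥) h′ in inj₁ (R , proj₂ (∈-ksubsets⁻ ⊤ (2 + i) R∈) , eq)
  ... | inj₂ h′ = inj₂ (Mem.∈-map⁻ (coned ⁅ foot ⁆) h′)

  shape-apex : ∀ {S} → Shape S → apex ∈ S
  shape-apex (inj₁ (R , _ , refl)) = apex∈ ⊥ R
  shape-apex (inj₂ (R , _ , refl)) = apex∈ ⁅ foot ⁆ R

  ∣⁅foot⁆∣ : ∣ ⁅ foot ⁆ ∣ ≡ 1
  ∣⁅foot⁆∣ = Subset.∣⁅x⁆∣≡1 foot

  shape-card : ∀ {S} → Shape S → ∣ S ∣ ≡ k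
  shape-card (inj₁ (R , ∣R∣ , refl)) = trans (∣coned∣ ⊥ R) (cong₂ (λ u v → u + suc v) (Subset.∣⊥∣≡0 k) ∣R∣)
  shape-card (inj₂ (R , R∈ , refl)) =
    trans (∣coned∣ ⁅ foot ⁆ R) (cong₂ (λ u v → u + suc v) ∣⁅foot⁆∣ (All.lookup ℰ-uniform R∈))

  ∣block∣ : ∣ block ∣ ≡ k
  ∣block∣ = trans (∣base∣ ⊤) (Subset.∣⊤∣≡n k)

  member : ∀ {S} → S ∈ˡ F → S ≡ block ⊎ Shape S
  member (here eq) = inj₁ eq
  member (there h) = inj₂ (shape h)

  apex⇒shape : ∀ {S} → S ∈ˡ F → apex ∈ S → Shape S
  apex⇒shape h ap = [ (λ eq → contradiction (subst (apex ∈_) eq ap) (apex∉ ⊤)) , id ]′ (member h)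

  module _ {W} (ws : Split k W) (block⊆ : block ⊆ W) where

    open Split ws

    -- The block and `S₁` have 2k points and fill `W`. A second set of the star then equals `S₁`,
    -- while two added sets have different upper parts among the k - 1 points of `R₁`, which form a
    -- tight path in `ℰ`.
    star-⊥ : ∀ {S₁ S₂ S₃} → (∃ λ R → ∣ R ∣ ≡ 2 + i × S₁ ≡ coned ⊥ R) → Shape S₂ → Shape S₃ →
             S₁ ⊆ W → S₂ ⊆ W → S₃ ⊆ W → S₁ ≢ S₂ → S₁ ≢ S₃ → S₂ ≢ S₃ → False
    star-⊥ {S₁} {S₂} {S₃} (R₁ , ∣R₁∣ , refl) sh₂ sh₃ s₁ s₂ s₃ n₁₂ n₁₃ n₂₃ = go sh₂ sh₃
      where
      R₁⊆ : R₁ ⊆ upper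
      R₁⊆ = proj₂ (coned⊆ {⊥} {R₁} s₁)
      upper⊆ : upper ⊆ R₁
      upper⊆ {y} = subst (y ∈_) (sym (upper≡ {⊤} {R₁} (base⊆ block⊆) R₁⊆
        (trans (cong₂ (λ u v → u + suc v) (Subset.∣⊤∣≡n k) ∣R₁∣) (cong (k +_) (sym (+-identityʳ k))))))
      other : ∀ {S} → (∃ λ R → ∣ R ∣ ≡ 2 + i × S ≡ coned ⊥ R) → S ⊆ W → S₁ ≡ S
      other (R , ∣R∣ , refl) s = cong (coned ⊥) (sym (⊆∧∣≤∣⇒≡ (λ y∈ → upper⊆ (proj₂ (coned⊆ {⊥} {R} s) y∈))
        (≤-reflexive (trans ∣R₁∣ (sym ∣R∣)))))
      go : Shape S₂ → Shape S₃ → False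
      go (inj₁ st) _ = n₁₂ (other st s₂)
      go (inj₂ _) (inj₁ st) = n₁₃ (other st s₃)
      go (inj₂ (R₂ , R₂∈ , refl)) (inj₂ (R₃ , R₃∈ , refl)) = proj₂ ℰ-free
        (twoFaces⇒tightPath R₂∈ R₃∈ (λ eq → n₂₃ (cong (coned ⁅ foot ⁆) eq))
          (λ y∈ → upper⊆ (proj₂ (coned⊆ {⁅ foot ⁆} {R₂} s₂) y∈))
            (λ y∈ → upper⊆ (proj₂ (coned⊆ {⁅ foot ⁆} {R₃} s₃) y∈))
          (All.lookup ℰ-uniform R₂∈) (All.lookup ℰ-uniform R₃∈) ∣R₁∣)

    shapes-⊥ : ∀ {S₁ S₂ S₃} → Shape S₁ → Shape S₂ → Shape S₃ → S₁ ⊆ W → S₂ ⊆ W → S₃ ⊆ W →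
               S₁ ≢ S₂ → S₁ ≢ S₃ → S₂ ≢ S₃ →
               (∀ {y} → y ∈ block → y ∈ S₁ → y ∈ S₂ → y ∈ S₃ → False) → False
    shapes-⊥ (inj₁ v₁) v₂ v₃ s₁ s₂ s₃ n₁₂ n₁₃ n₂₃ _ = star-⊥ v₁ v₂ v₃ s₁ s₂ s₃ n₁₂ n₁₃ n₂₃
    shapes-⊥ v₁@(inj₂ _) (inj₁ v₂) v₃ s₁ s₂ s₃ n₁₂ n₁₃ n₂₃ _ = star-⊥ v₂ v₁ v₃ s₂ s₁ s₃ (n₁₂ ∘ sym) n₂₃ n₁₃
    shapes-⊥ v₁@(inj₂ _) v₂@(inj₂ _) (inj₁ v₃) s₁ s₂ s₃ n₁₂ n₁₃ n₂₃ _ =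
      star-⊥ v₃ v₁ v₂ s₃ s₁ s₂ (n₁₃ ∘ sym) (n₂₃ ∘ sym) n₁₂
    shapes-⊥ (inj₂ (_ , _ , e₁)) (inj₂ (_ , _ , e₂)) (inj₂ (_ , _ , e₃)) _ _ _ _ _ _ empty =
      empty (∈-++ˡ⁺ {y = foot} Subset.∈⊤) (on e₁) (on e₂) (on e₃)
      where
      on : ∀ {S R} → S ≡ coned ⁅ foot ⁆ R → foot Fin.↑ˡ suc m ∈ S
      on refl = ∈-++ˡ⁺ (Subset.x∈⁅x⁆ foot)

  F-clusterFree : ClusterFree 4 k F
  F-clusterFree = MatchingPlusStar.clusterFree {ν = 1} apex (λ _ → block) (s≤s z≤n) (λ _ → apex∉ ⊤) (λ _ → ∣block∣)
    (λ { {zero} {zero} ne → contradiction refl ne }) F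
    (λ h → Sum.swap (Sum.map (λ eq → zero , eq) shape-apex (member h)))
    λ _ W S₁∈ S₂∈ S₃∈ x₁ x₂ x₃ n₁₂ n₁₃ n₂₃ A⊆ s₁ s₂ s₃ ∣W∣ empty →
      shapes-⊥ (split {k} W (s₁ x₁) ∣W∣) A⊆ (apex⇒shape S₁∈ x₁) (apex⇒shape S₂∈ x₂) (apex⇒shape S₃∈ x₃)
        s₁ s₂ s₃ n₁₂ n₁₃ n₂₃ empty

  F-uniform : Uniform k F
  F-uniform = All.tabulate λ h → [ (λ { refl → ∣block∣ }) , shape-card ]′ (member h)

  F-unique : Unique F
  F-unique = All.tabulate (λ h eq → apex∉ ⊤ (subst (apex ∈_) (sym eq) (shape-apex (shape h))))
    ∷ Unique.++⁺ (Unique.map⁺ (proj₂ ∘ coned-injective {⊥} {⊥}) (ksubsets-unique ⊤ (2 + i)))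
      (Unique.map⁺ (proj₂ ∘ coned-injective {⁅ foot ⁆} {⁅ foot ⁆}) ℰ-unique)
        λ (h , h′) → apart (Mem.∈-map⁻ (coned ⊥) h) (Mem.∈-map⁻ (coned ⁅ foot ⁆) h′)
    where
    apart : ∀ {S} → (∃ λ R → R ∈ˡ ksubsets ⊤ (2 + i) × S ≡ coned ⊥ R) → (∃ λ R → R ∈ˡ ℰ × S ≡ coned ⁅ foot ⁆ R) →
      False
    apart (_ , _ , refl) (_ , _ , eq) =
      Subset.∉⊥ (subst (foot ∈_) (sym (proj₁ (coned-injective {⊥} {⁅ foot ⁆} eq))) (Subset.x∈⁅x⁆ foot))

  F-matching : 2 ≤ matchingNumber F
  F-matching = matchingNumber≥ {ℳ = S₀ ∷ block ∷ []}
    ((coned≢base {⊥} {⊤} {proj₁ some} ∷ []) ∷ [] ∷ [])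
    (λ { (here refl) → there (Mem.∈-++⁺ˡ (Mem.∈-map⁺ (coned ⊥) (∈-ksubsets Subset.⊆⊤ (proj₂ some)))) ;
      (there (here refl)) → here refl })
    ((coned-base-disjoint {a = k} {m} {⊥} {⊤} {proj₁ some} (⊥-disjoint {Q = ⊤}) ∷ []) ∷ [] ∷ [])
    where
    some : ∃ λ (R : Subset m) → ∣ R ∣ ≡ 2 + i
    some = someSubset 2+i≤m
    S₀ : Subset (k + suc m)
    S₀ = coned ⊥ (proj₁ some)

  length-F : length F ≡ m C (2 + i) + length ℰ + 1
  length-F = trans (cong suc (trans (List.length-++ stars) (cong₂ _+_
    (trans (List.length-map (coned ⊥) (ksubsets ⊤ (2 + i)))
      (trans (length-ksubsets (⊤ {m}) (2 + i)) (cong (_C (2 + i)) (Subset.∣⊤∣≡n m))))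
    (List.length-map (coned ⁅ foot ⁆) ℰ)))) (+-comm 1 _)

  bound : m C (2 + i) + length ℰ + 1 ≤ f (3 + i + suc m) (3 + i) 4 1
  bound = ≤-trans (≤-reflexive (sym length-F)) (f≥ {ν = 1} F-unique (F-uniform , F-clusterFree , F-matching))

-- If the maximum is the default value 0, the empty family attains it: a tight path with two edges
-- needs an edge.
extremal : ∀ m r → ∃ λ (ℰ : Family m) → length ℰ ≡ exTightPath m 2 r × Unique ℰ × TightPathFree 2 r ℰ
extremal m r = [ id , (λ eq → [] , sym eq , [] , [] , λ { (_ , _ , _ , s) → case s (here refl) of λ () }) ]′
  (greatest-holds (hasSize? (tightPathFree? {m} 2 r)) (2 ^ m))

singleBlockBound : ∀ i n m → m ≡ n ∸ (3 + i) ∸ 1 → 2 * (3 + i) ≤ n →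
                    m C (2 + i) + exTightPath m 2 (1 + i) + 1 ≤ f n (3 + i) 4 1
singleBlockBound i n m m≡ le = bounded (extremal m (1 + i))
  where
  k : ℕ
  k = 3 + i
  k+k≤ : k + k ≤ n
  k+k≤ = ≤-trans (+-monoʳ-≤ k (≤-reflexive (sym (+-identityʳ k)))) le
  k≤ : k ≤ n ∸ k
  k≤ = m+n≤o⇒m≤o∸n k k+k≤
  2+i≤m : 2 + i ≤ m
  2+i≤m = subst (2 + i ≤_) (sym m≡) (∸-monoˡ-≤ 1 k≤)
  n≡ : 3 + i + suc m ≡ n
  n≡ = trans (cong (λ m → k + suc m) m≡) (trans (cong (k +_) (m+[n∸m]≡n (≤-trans (s≤s z≤n) k≤)))
    (m+[n∸m]≡n {k} {n} (≤-trans (m≤m+n k k) k+k≤)))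
  bounded : (∃ λ (ℰ : Family m) → length ℰ ≡ exTightPath m 2 (1 + i) × Unique ℰ × TightPathFree 2 (1 + i) ℰ) →
            m C (2 + i) + exTightPath m 2 (1 + i) + 1 ≤ f n (3 + i) 4 1
  bounded (ℰ , len , u , free) = begin
    m C (2 + i) + exTightPath m 2 (1 + i) + 1 ≡⟨ cong (λ e → m C (2 + i) + e + 1) len ⟨
    m C (2 + i) + length ℰ + 1                ≤⟨ SingleBlock.bound i m 2+i≤m ℰ u free ⟩
    f (3 + i + suc m) (3 + i) 4 1             ≡⟨ cong (λ n′ → f n′ (3 + i) 4 1) n≡ ⟩
    f n (3 + i) 4 1                           ∎
    where open ≤-Reasoning

theorem1p7 : (k : ℕ) → 4 ≤ k →
    ((ν : ℕ) → ∃₂ λ c₁ c₂ →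
    k * (ν ^ 2 / 4) ≤ c₁ ×
    k * (ν ^ 2 / 4) ≤ c₂ ×
    ((n : ℕ) → k * (ν + 1) ≤ n →
    ((n ∸ k * ν ∸ 1) C (k ∸ 1)) + c₁ * ((n ∸ k * ν ∸ 1) C (k ∸ 3)) ≤ f n k 4 ν) ×
    (∃ λ N → (n : ℕ) → N ≤ n →
    f n k 4 ν ≤ ((n ∸ k * ν ∸ 1) C (k ∸ 1)) + c₂ * ((n ∸ k * ν ∸ 1) C (k ∸ 3)))) ×
    ((n : ℕ) → 2 * k ≤ n →
    ((n ∸ k ∸ 1) C (k ∸ 1)) + exTightPath (n ∸ k ∸ 1) 2 (k ∸ 2) + 1 ≤ f n k 4 1)
theorem1p7 (suc (suc (suc (suc i′)))) (s≤s (s≤s (s≤s (s≤s z≤n)))) =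
  (λ ν → let c₁ , le₁ , lower = lowerBound (suc i′) ν
             c₂ , N , le₂ , upper = upperBound i′ ν
         in c₁ , c₂ , le₁ , le₂ , lower , N , upper)
  , λ n → singleBlockBound (suc i′) n _ refl
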